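{- Let $\{u_n\}_{n\ge 0}$ be any one of the fifteen sporadic sequences $\mathbf{A},\mathbf{B},\mathbf{C},\mathbf{D},\mathbf{E},\mathbf{F},(\delta),(\eta),(\alpha),(\epsilon),(\zeta),(\gamma),s_7,s_{10},s_{18}$ defined below, and let $k=2$ if the sequence is one of $\mathbf{A},\dots,\mathbf{F}$ (these satisfy second-order recurrences/differential equations) and $k=3$ otherwise (these satisfy third-order ones). Then: (i) there is a Laurent polynomial $\Lambda\in\mathbb{Z}[x_1^{\pm1},\dots,x_k^{\pm1}]$ in $k$ variables such that $u_n=\mathrm{CT}(\Lambda^n)$ for every $n\ge 1$; (ii) such a $\Lambda$ (with $u_n=\mathrm{CT}(\Lambda^n)$ for all $n\ge1$) can be chosen so that it factors as a product of Laurent polynomials each of whose coefficients lie in $\{ -1,0,1\}$; (iii) if the sequence is not $(\eta)$, such a $\Lambda$ (with integer coefficients and $u_n=\mathrm{CT}(\Lambda^n)$ for all $n\ge1$) can be chosen so that its Newton polytope contains the origin as its only interior integral point.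
   Context: For a Laurent polynomial (or series) $f$, $\mathrm{CT}(f)$ denotes its constant term (the coefficient of $x_1^0\cdots x_d^0$). The Newton polytope of a Laurent polynomial $\sum c_{\mathbf a}x^{\mathbf a}$ is the convex hull in $\mathbb{R}^d$ of $\{\mathbf a\in\mathbb{Z}^d: c_{\mathbf a}\ne0\}$. The sequences are defined by recurrences with $u_{ -1}=0$, $u_0=1$: Zagier-type: $(n+1)^2u_{n+1}-(An^2+An+\lambda)u_n+Bn^2u_{n-1}=0$ for $n\ge0$, with $(A,B,\lambda)=(7,-8,2)$ for $\mathbf{A}$, $(9,27,3)$ for $\mathbf{B}$, $(10,9,3)$ for $\mathbf{C}$, $(11,-1,3)$ for $\mathbf{D}$, $(12,32,4)$ for $\mathbf{E}$, $(17,72,6)$ for $\mathbf{F}$. Cooper-type: $(n+1)^3u_{n+1}-(2n+1)(an^2+an+b)u_n+n(cn^2+d)u_{n-1}=0$ for $n\ge0$, with $(a,b,c,d)=(7,3,81,0)$ for $(\delta)$, $(11,5,125,0)$ for $(\eta)$, $(10,4,64,0)$ for $(\alpha)$, $(12,4,16,0)$ for $(\epsilon)$, $(9,3,-27,0)$ for $(\zeta)$, $(17,5,1,0)$ for $(\gamma)$, $(13,4,-27,3)$ for $s_7$, $(6,2,-64,4)$ for $s_{10}$, $(14,6,192,-12)$ for $s_{18}$. (For instance $\mathbf{A}$: $u_n=\sum_k\binom nk^3$; $\mathbf{D}$: $u_n=\sum_k\binom nk^2\binom{n+k}{n}$; $(\gamma)$: $u_n=\sum_k\binom nk^2\binom{n+k}{k}^2$;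 $s_{10}$: $u_n=\sum_k\binom nk^4$.) -}

module Defs where

open import Data.Nat as ℕ using (ℕ; zero; suc)
open import Data.Integer as ℤ using (ℤ; +_; -[1+_])
open import Data.Rational as ℚ using (ℚ)
open import Data.Fin using (Fin; zero; suc)
open import Data.Vec using (Vec; []; _∷_; lookup; zipWith; replicate)
open import Data.Vec.Properties using (≡-dec)
open import Data.List using (List; []; _∷_; concatMap; map; filter; length; foldr)
open import Data.List.Relation.Unary.Any using (Any)
open import Data.Product using (_×_; _,_; proj₁; proj₂; Σ; ∃)
open import Data.Sum using (_⊎_)
open import Relation.Binary.PropositionalEquality using (_≡_)
open import Relation.Nullary using (yes; no; ¬_)
open import Relation.Nullary.Decidable using (¬?)

data Sporadic : Set where
  𝐀 𝐁 𝐂 𝐃 𝐄 𝐅 δ η α ε ζ γ s7 s10 s18 : Sporadic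

nvars : Sporadic → ℕ
nvars 𝐀 = 2
nvars 𝐁 = 2
nvars 𝐂 = 2
nvars 𝐃 = 2
nvars 𝐄 = 2
nvars 𝐅 = 2
nvars _ = 3

ιℤ : ℤ → ℚ
ιℤ z = z ℚ./ 1

ιℕ : ℕ → ℚ
ιℕ n = ιℤ (+ n)

-- Zagier-type: (n+1)^2 u_{n+1} = (A n^2 + A n + λ) u_n - B n^2 u_{n-1}
-- Returns (u_n, u_{n+1}); u_{-1} = 0, u_0 = 1.
zagierPair : (A B lam : ℤ) → ℕ → ℚ × ℚ
zagierPair A B lam zero = ℚ.0ℚ , ℚ.1ℚ
zagierPair A B lam (suc n) with zagierPair A B lam n
... | (uprev , ucur) =
  ucur ,
  ((ιℤ (A ℤ.* (+ n) ℤ.* (+ n) ℤ.+ A ℤ.* (+ n) ℤ.+ lam) ℚ.* ucur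
     ℚ.- ιℤ (B ℤ.* (+ n) ℤ.* (+ n)) ℚ.* uprev)
   ℚ.* ((+ 1) ℚ./ suc (n ℕ.* (n ℕ.+ 2))))   -- 1/(n+1)^2

-- Cooper-type: (n+1)^3 u_{n+1} = (2n+1)(a n^2 + a n + b) u_n - n (c n^2 + d) u_{n-1}
cooperPair : (a b c d : ℤ) → ℕ → ℚ × ℚ
cooperPair a b c d zero = ℚ.0ℚ , ℚ.1ℚ
cooperPair a b c d (suc n) with cooperPair a b c d n
... | (uprev , ucur) =
  ucur ,
  ((ιℤ ((+ (2 ℕ.* n ℕ.+ 1)) ℤ.* (a ℤ.* (+ n) ℤ.* (+ n) ℤ.+ a ℤ.* (+ n) ℤ.+ b)) ℚ.* ucur
     ℚ.- ιℤ ((+ n) ℤ.* (c ℤ.* (+ n) ℤ.* (+ n) ℤ.+ d)) ℚ.* uprev)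
   ℚ.* ((+ 1) ℚ./ suc (n ℕ.* n ℕ.* n ℕ.+ 3 ℕ.* n ℕ.* n ℕ.+ 3 ℕ.* n)))  -- 1/(n+1)^3

zagier : (A B lam : ℤ) → ℕ → ℚ
zagier A B lam n = proj₂ (zagierPair A B lam n)

cooper : (a b c d : ℤ) → ℕ → ℚ
cooper a b c d n = proj₂ (cooperPair a b c d n)

seq : Sporadic → ℕ → ℚ
seq 𝐀 = zagier (+ 7) (ℤ.- (+ 8)) (+ 2)
seq 𝐁 = zagier (+ 9) (+ 27) (+ 3)
seq 𝐂 = zagier (+ 10) (+ 9) (+ 3)
seq 𝐃 = zagier (+ 11) (ℤ.- (+ 1)) (+ 3)
seq 𝐄 = zagier (+ 12) (+ 32) (+ 4)
seq 𝐅 = zagier (+ 17) (+ 72) (+ 6)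
seq δ = cooper (+ 7) (+ 3) (+ 81) (+ 0)
seq η = cooper (+ 11) (+ 5) (+ 125) (+ 0)
seq α = cooper (+ 10) (+ 4) (+ 64) (+ 0)
seq ε = cooper (+ 12) (+ 4) (+ 16) (+ 0)
seq ζ = cooper (+ 9) (+ 3) (ℤ.- (+ 27)) (+ 0)
seq γ = cooper (+ 17) (+ 5) (+ 1) (+ 0)
seq s7 = cooper (+ 13) (+ 4) (ℤ.- (+ 27)) (+ 3)
seq s10 = cooper (+ 6) (+ 2) (ℤ.- (+ 64)) (+ 4)
seq s18 = cooper (+ 14) (+ 6) (+ 192) (ℤ.- (+ 12))

-- Laurent polynomials in ℤ[x₁^{±1},…,x_k^{±1}], represented by a finite
-- list of (exponent vector, coefficient) terms; the polynomial denoted is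
-- the sum of the terms (repeated exponents are added up).

Laurent : ℕ → Set
Laurent k = List (Vec ℤ k × ℤ)

coeff : ∀ {k} → Laurent k → Vec ℤ k → ℤ
coeff [] a = + 0
coeff ((b , c) ∷ f) a with ≡-dec ℤ._≟_ b a
... | yes _ = c ℤ.+ coeff f a
... | no _ = coeff f a

CT : ∀ {k} → Laurent k → ℤ
CT f = coeff f (replicate _ (+ 0))

oneL : ∀ {k} → Laurent k
oneL = (replicate _ (+ 0) , + 1) ∷ []

_*L_ : ∀ {k} → Laurent k → Laurent k → Laurent k
f *L g = concatMap (λ { (a , c) → map (λ { (b , d) → (zipWith ℤ._+_ a b , c ℤ.* d) }) g }) f

_^L_ : ∀ {k} → Laurent k → ℕ → Laurent k
f ^L zero = oneL
f ^L suc n = f *L (f ^L n)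

productL : ∀ {k} → List (Laurent k) → Laurent k
productL = foldr _*L_ oneL

_≈L_ : ∀ {k} → Laurent k → Laurent k → Set
f ≈L g = ∀ a → coeff f a ≡ coeff g a

Coeffs01 : ∀ {k} → Laurent k → Set
Coeffs01 f = ∀ a → (coeff f a ≡ ℤ.- (+ 1)) ⊎ (coeff f a ≡ + 0) ⊎ (coeff f a ≡ + 1)

support : ∀ {k} → Laurent k → List (Vec ℤ k)
support f = filter (λ a → ¬? (coeff f a ℤ.≟ + 0)) (map proj₁ f)

sumFin : (n : ℕ) → (Fin n → ℚ) → ℚ
sumFin zero g = ℚ.0ℚ
sumFin (suc n) g = g zero ℚ.+ sumFin n (λ i → g (suc i))

listLookup : ∀ {A : Set} (xs : List A) → Fin (length xs) → A
listLookup (x ∷ xs) zero = x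
listLookup (x ∷ xs) (suc i) = listLookup xs i

InConvexHull : ∀ {k} → List (Vec ℤ k) → Vec ℚ k → Set
InConvexHull {k} S q =
  Σ (Fin (length S) → ℚ) λ w →
    (∀ i → ℚ.0ℚ ℚ.≤ w i) ×
    (sumFin (length S) w ≡ ℚ.1ℚ) ×
    (∀ (j : Fin k) → sumFin (length S) (λ i → w i ℚ.* ιℤ (lookup (listLookup S i) j)) ≡ lookup q j)

-- the integral point p is an interior point of conv(S) (⊆ ℝ^k): some
-- sup-norm neighbourhood of p is contained in conv(S).  Points of the
-- neighbourhood are tested at rational coordinates (conv(S) is closed).
InteriorPoint : ∀ {k} → List (Vec ℤ k) → Vec ℤ k → Set
InteriorPoint {k} S p =
  Σ ℚ λ r → (ℚ.0ℚ ℚ.< r) ×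
    (∀ (q : Vec ℚ k) → (∀ (j : Fin k) → ℚ.∣ lookup q j ℚ.- ιℤ (lookup p j) ∣ ℚ.≤ r) →
       InConvexHull S q)

OriginUniqueInteriorPoint : ∀ {k} → Laurent k → Set
OriginUniqueInteriorPoint {k} f =
  InteriorPoint (support f) (replicate k (+ 0)) ×
  (∀ (p : Vec ℤ k) → InteriorPoint (support f) p → p ≡ replicate k (+ 0))

Represents : (s : Sporadic) → Laurent (nvars s) → Set
Represents s Λ = ∀ (n : ℕ) → 1 ℕ.≤ n → ιℤ (CT (Λ ^L n)) ≡ seq s n

module Submission where

-- With θᵢ = xᵢ ∂/∂xᵢ, the constant term of θᵢ(RΛⁿ⁻¹) = Λⁿ⁻²(θᵢR · Λ + (n - 1) R θᵢΛ) vanishes for all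
-- Laurent polynomials R.  A three-term recurrence for CT(Λⁿ) therefore follows from one identity
--   p₃(n) Λ³ + p₂(n) Λ² + p₁(n) Λ = Σᵢ (θᵢRᵢ · Λ + (n - 1) Rᵢ θᵢΛ)
-- of Laurent polynomials over ℤ[n], which is verified by expansion.  Such R₁, …, R_k, supported in twice
-- the Newton polytope of Λ, exist for all fifteen sequences.  For the Newton polytope, the origin is
-- interior since the barycentric coordinates of a point near it can be chosen affine in the point;
-- no other integral point is interior since enough integral functionals are at most 1 on the polytope,
-- hence at most 0 at interior integral points, and they positively span.

open import Defs
open import Algebra.Bundles using (module AbelianGroup)
open import Data.Fin using (Fin; zero; suc)
open import Data.Fin.Properties using (all?)
open import Data.Integer as ℤ using (ℤ; +_; -[1+_]; _+_; _*_; -_; _⊖_)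
import Data.Integer.Literals
import Data.Integer.Properties as ℤₚ
  using (*-assoc; *-cancelˡ-≡; *-comm; *-distribʳ-+; *-identityʳ; *-identityˡ; *-monoʳ-≤-nonNeg;
    *-zeroʳ; +-0-abelianGroup; +-assoc; +-comm; +-identityʳ; +-identityˡ; +-inverseˡ; -1*i≡-i; <⇒≱;
    i-j≡0⇒i≡j; i<j⇒i≤pred[j]; neg-cancel-≤; pos-*; ≤-antisym; ≰⇒>)
open import Data.Integer.Tactic.RingSolver using (solve-∀)
open import Data.List using (List; []; _∷_; _++_; concatMap; map; foldr; length)
open import Data.List.Relation.Unary.All as All using (All; []; _∷_)
open import Data.List.Relation.Unary.AllPairs using (AllPairs; []; _∷_; allPairs?)
open import Data.Bool using (if_then_else_)
open import Data.Nat as ℕ using (ℕ; zero; suc)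
import Data.Nat.Literals
import Data.Nat.Properties as ℕₚ using (*-identityʳ; +-comm)
open import Data.Product using (_×_; _,_; proj₁; proj₂; Σ)
open import Data.Rational as ℚ using (ℚ; 0ℚ; 1ℚ)
import Data.Rational.Properties as ℚₚ
  using (*-assoc; *-comm; *-distribˡ-+; *-identityʳ; *-identityˡ; *-monoʳ-≤-nonNeg;
    *-monoˡ-≤-nonNeg; *-zeroʳ; *-zeroˡ; +-0-group; +-identityʳ; +-identityˡ; +-inverseˡ; +-mono-≤;
    +-monoʳ-<; 0≤p⇒∣p∣≡p; <-irrefl; <-≤-trans; <⇒≤; neg-distribʳ-*; nonNeg*nonNeg⇒nonNeg;
    nonNegative⁻¹; normalize-pos; pos*pos⇒pos; positive⁻¹; toℚᵘ-cancel-≤; toℚᵘ-fromℚᵘ; toℚᵘ-homo-*;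
    toℚᵘ-homo-+; toℚᵘ-injective; toℚᵘ-mono-≤; ∣-p∣≡∣p∣; ∣-∣-nonNeg; ∣p∣≡p∨∣p∣≡-p;
    module ≤-Reasoning; ≤-refl; ≤-reflexive; ≤-trans; ≰⇒>)
open import Data.Rational.Solver using (module +-*-Solver)
open import Data.Rational.Unnormalised as ℚᵘ using (mkℚᵘ; *≡*; *≤*)
import Data.Rational.Unnormalised.Properties as ℚᵘₚ
  using (*-cong; +-cong; module ≃-Reasoning; ≃-refl; module ≤-Reasoning; ≤-respʳ-≃; ≤-respˡ-≃)
open import Data.Sum using (_⊎_; inj₁; inj₂)
open import Data.Vec as Vec using (Vec; []; _∷_; lookup; replicate; tabulate; zipWith)
open import Data.Vec.Properties
  using (≡-dec; lookup-replicate; lookup∘tabulate; tabulate∘lookup; tabulate-cong; zipWith-assoc;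
    zipWith-comm; zipWith-identityˡ; zipWith-identityʳ)
open import Function using (id; _∘_)
open import Relation.Binary.PropositionalEquality
  using (_≡_; _≢_; refl; sym; trans; cong; cong₂; subst; subst₂; module ≡-Reasoning)
open import Relation.Nullary using (Dec; yes; no; contradiction; does)
open import Relation.Nullary.Decidable using (map′; _×-dec_; _⊎-dec_; ¬?; True; toWitness)
open import Algebra.Properties.Group (AbelianGroup.group ℤₚ.+-0-abelianGroup) using (identityˡ-unique)
open import Algebra.Properties.Group ℚₚ.+-0-group using (inverseˡ-unique)
open +-*-Solver using (solve; _:=_; _:+_; _:*_; _:-_; :-_)

-- Once Λ and the recurrence are fixed, the identity is linear in the coefficients of R₁, ..., R_k.
-- A certificate is thus a solution of a finite linear system, and one verification covers all
-- fifteen sequences, whatever formula each of them has. The factor Λⁿ⁻² restricts the argument to n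
-- ≥ 2, written as n = m + 2; the steps n = 0 and n = 1 are evaluated. The recurrence determines the
-- sequence over ℚ, and its integrality comes for free since constant terms are integers.
--
-- The obstacle is the representation: a Laurent polynomial is a list of terms, so one polynomial
-- has many lists. The arguments are therefore about the linear functional that a list induces on
-- functions of the exponent, where order and repetition of terms disappear. Lists are brought to a
-- normal form only where an identity is decided by evaluation.
--
-- Being interior quantifies over all rational points of a neighbourhood, so its witness has to be a
-- formula in the point; hence the affine barycentric coordinates.

private variable
  k : ℕ
  C : Set

-- Laurent polynomials as functionals on functions of the exponent

𝟎 : Vec ℤ k
𝟎 = replicate _ (+ 0)

infixl 6 _⊞_
_⊞_ : ∀ {k} → Vec ℤ k → Vec ℤ k → Vec ℤ k
_⊞_ = zipWith _+_

module Pairing {C : Set} (ev : C → ℤ) where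

  -- The coefficient type is arbitrary so that the same lemmas serve integer coefficients
  -- (`ev = id`) and coefficients that are polynomials in the index (`ev = eval x`).
  pair : (Vec ℤ k → ℤ) → List (Vec ℤ k × C) → ℤ
  pair φ [] = + 0
  pair φ ((a , c) ∷ f) = ev c * φ a + pair φ f

  pair-cong : {φ χ : Vec ℤ k → ℤ} → (∀ a → φ a ≡ χ a) → ∀ f → pair φ f ≡ pair χ f
  pair-cong e [] = refl
  pair-cong e ((a , c) ∷ f) = cong₂ (λ x y → ev c * x + y) (e a) (pair-cong e f)

  pair-++ : ∀ (φ : Vec ℤ k → ℤ) f g → pair φ (f ++ g) ≡ pair φ f + pair φ g
  pair-++ φ [] g = sym (ℤₚ.+-identityˡ _)
  pair-++ φ ((a , c) ∷ f) g = trans (cong (λ u → ev c * φ a + u) (pair-++ φ f g)) (sym (ℤₚ.+-assoc (ev c * φ a) _ _))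

  pair-+ : ∀ (φ χ : Vec ℤ k → ℤ) f → pair (λ a → φ a + χ a) f ≡ pair φ f + pair χ f
  pair-+ φ χ [] = refl
  pair-+ φ χ ((a , c) ∷ f) = trans (cong (λ u → ev c * (φ a + χ a) + u) (pair-+ φ χ f)) (lemma (ev c) (φ a) (χ a) _ _)
    where
    lemma : ∀ c x y u v → c * (x + y) + (u + v) ≡ (c * x + u) + (c * y + v)
    lemma = solve-∀

  pair-* : ∀ x (φ : Vec ℤ k → ℤ) f → pair (λ a → x * φ a) f ≡ x * pair φ f
  pair-* x φ [] = sym (ℤₚ.*-zeroʳ x)
  pair-* x φ ((a , c) ∷ f) = trans (cong (λ u → ev c * (x * φ a) + u) (pair-* x φ f)) (lemma (ev c) x (φ a) _)
    where
    lemma : ∀ c x y u → c * (x * y) + x * u ≡ x * (c * y + u)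
    lemma = solve-∀

  pair-0 : ∀ {φ : Vec ℤ k → ℤ} → (∀ a → φ a ≡ + 0) → ∀ f → pair φ f ≡ + 0
  pair-0 e [] = refl
  pair-0 e ((a , c) ∷ f) = cong₂ _+_ (trans (cong (ev c *_) (e a)) (ℤₚ.*-zeroʳ (ev c))) (pair-0 e f)

open Pairing

-- Exchange of two finite sums. It plays the role of commutativity of the product, which fails for
-- lists of terms, when two factors Λ change places in the Leibniz rule.
pair-swap : ∀ {C D : Set} (ev : C → ℤ) (ew : D → ℤ) {l} (φ : Vec ℤ k → Vec ℤ l → ℤ) f g →
  pair ev (λ a → pair ew (φ a) g) f ≡ pair ew (λ b → pair ev (λ a → φ a b) f) g
pair-swap ev ew φ [] g = sym (pair-0 ew (λ _ → refl) g)
pair-swap ev ew φ ((a , c) ∷ f) g = begin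
  ev c * pair ew (φ a) g + pair ev (λ a → pair ew (φ a) g) f
    ≡⟨ cong₂ _+_ (sym (pair-* ew (ev c) (φ a) g)) (pair-swap ev ew φ f g) ⟩
  pair ew (λ b → ev c * φ a b) g + pair ew (λ b → pair ev (λ a → φ a b) f) g
    ≡⟨ sym (pair-+ ew _ _ g) ⟩
  pair ew (λ b → ev c * φ a b + pair ev (λ a → φ a b) f) g ∎
  where open ≡-Reasoning

⟨_,_⟩ : (Vec ℤ k → ℤ) → Laurent k → ℤ
⟨_,_⟩ = pair id

δ[_] : Vec ℤ k → Vec ℤ k → ℤ
δ[ a ] b with ≡-dec ℤ._≟_ b a
... | yes _ = + 1
... | no _ = + 0

-- The bridge by which statements about `CT` and `_≈L_` become statements about functionals.
coeff-pair : ∀ (f : Laurent k) a → coeff f a ≡ ⟨ δ[ a ] , f ⟩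
coeff-pair [] a = refl
coeff-pair ((b , c) ∷ f) a with ≡-dec ℤ._≟_ b a
... | yes _ = cong₂ _+_ (sym (ℤₚ.*-identityʳ c)) (coeff-pair f a)
... | no _ = trans (coeff-pair f a) (sym (trans (cong (_+ ⟨ δ[ a ] , f ⟩) (ℤₚ.*-zeroʳ c)) (ℤₚ.+-identityˡ _)))

-- Covers every `map` over terms that moves all exponents by one rule and scales all coefficients by
-- one factor: multiplication by a monomial, prefixing an exponent in the trie, and multiplication
-- by a polynomial in the index.
pair-map : ∀ {D : Set} (ev : C → ℤ) (ew : D → ℤ) (φ : Vec ℤ k → ℤ) {l} (s : Vec ℤ l → Vec ℤ k) x
  (h : Vec ℤ l × D → Vec ℤ k × C) → (∀ b d → φ (proj₁ (h (b , d))) ≡ φ (s b)) →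
  (∀ b d → ev (proj₂ (h (b , d))) ≡ x * ew d) →
  ∀ g → pair ev φ (map h g) ≡ x * pair ew (φ ∘ s) g
pair-map ev ew φ s x h e₁ e₂ [] = sym (ℤₚ.*-zeroʳ x)
pair-map ev ew φ s x h e₁ e₂ ((b , d) ∷ g) =
  trans (cong₂ _+_ (cong₂ _*_ (e₂ b d) (e₁ b d)) (pair-map ev ew φ s x h e₁ e₂ g)) (lemma x (ew d) (φ (s b)) _)
  where
  lemma : ∀ x y z u → x * y * z + x * u ≡ x * (y * z + u)
  lemma = solve-∀

-- Multiplication becomes convolution, and the collection of like terms in a product never has to be
-- followed.
pair-*L : ∀ (φ : Vec ℤ k → ℤ) f g → ⟨ φ , f *L g ⟩ ≡ ⟨ (λ a → ⟨ (λ b → φ (a ⊞ b)) , g ⟩) , f ⟩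
pair-*L φ [] g = refl
pair-*L φ ((a , c) ∷ f) g = trans (pair-++ id φ (map _ g) (f *L g))
  (cong₂ _+_ (pair-map id id φ (a ⊞_) c _ (λ _ _ → refl) (λ _ _ → refl) g) (pair-*L φ f g))

-- Integer polynomials in the index m

Poly : Set
Poly = List ℤ

eval : ℤ → Poly → ℤ
eval x [] = + 0
eval x (c ∷ p) = c + x * eval x p

infixl 6 _⊕_
_⊕_ : Poly → Poly → Poly
[] ⊕ q = q
(c ∷ p) ⊕ [] = c ∷ p
(c ∷ p) ⊕ (d ∷ q) = (c + d) ∷ (p ⊕ q)

infixl 7 _·_
_·_ : ℤ → Poly → Poly
c · p = map (c *_) p

eval-⊕ : ∀ x p q → eval x (p ⊕ q) ≡ eval x p + eval x q
eval-⊕ x [] q = sym (ℤₚ.+-identityˡ _)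
eval-⊕ x (c ∷ p) [] = sym (ℤₚ.+-identityʳ _)
eval-⊕ x (c ∷ p) (d ∷ q) = trans (cong (λ u → c + d + x * u) (eval-⊕ x p q)) (lemma c d x _ _)
  where
  lemma : ∀ c d x u v → c + d + x * (u + v) ≡ (c + x * u) + (d + x * v)
  lemma = solve-∀

eval-· : ∀ x c p → eval x (c · p) ≡ c * eval x p
eval-· x c [] = sym (ℤₚ.*-zeroʳ c)
eval-· x c (d ∷ p) = trans (cong (λ u → c * d + x * u) (eval-· x c p)) (lemma c d x _)
  where
  lemma : ∀ c d x u → c * d + x * (c * u) ≡ c * (d + x * u)
  lemma = solve-∀

-- Dropping trailing zeros makes `[]` the only form of the zero polynomial, so that a coefficient
-- which cancels leaves no entry behind.
trim : Poly → Poly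
trim [] = []
trim (c ∷ p) with trim p
... | d ∷ q = c ∷ d ∷ q
... | [] = if does (c ℤ.≟ + 0) then [] else c ∷ []

eval-trim : ∀ x p → eval x (trim p) ≡ eval x p
eval-trim x [] = refl
eval-trim x (c ∷ p) with trim p | eval-trim x p
... | d ∷ q | e = cong (λ u → c + x * u) e
... | [] | e with c ℤ.≟ + 0
...   | no _ = cong (λ u → c + x * u) e
...   | yes refl = trans (sym (trans (ℤₚ.+-identityˡ _) (ℤₚ.*-zeroʳ x))) (cong (λ u → + 0 + x * u) e)

-- Collecting like terms in a trie

Terms : ℕ → Set
Terms k = List (Vec ℤ k × Poly)

⟨_,_⟩at_ : (Vec ℤ k → ℤ) → Terms k → ℤ → ℤ
⟨ φ , t ⟩at x = pair (eval x) φ t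

-- A node holds the children at exponents 0, 1, 2, … and those at -1, -2, -3, ….
Trie : ℕ → Set
Trie zero = Poly
Trie (suc k) = List (Trie k) × List (Trie k)

empty : Trie k
empty {zero} = []
empty {suc k} = [] , []

insert : Vec ℤ k → Poly → Trie k → Trie k
insertAt : ℕ → Vec ℤ k → Poly → List (Trie k) → List (Trie k)
insert [] p q = p ⊕ q
insert (+ n ∷ a) p (u , v) = insertAt n a p u , v
insert (-[1+ n ] ∷ a) p (u , v) = u , insertAt n a p v
insertAt zero a p [] = insert a p empty ∷ []
insertAt zero a p (t ∷ ts) = insert a p t ∷ ts
insertAt (suc n) a p [] = empty ∷ insertAt n a p []
insertAt (suc n) a p (t ∷ ts) = t ∷ insertAt n a p ts

constant : Poly → Terms 0
constant [] = []
constant p@(_ ∷ _) = ([] , p) ∷ []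

entries : Trie k → Terms k
entriesFrom : (ℕ → ℤ) → List (Trie k) → Terms (suc k)
entries {zero} p = constant (trim p)
entries {suc k} (u , v) = entriesFrom +_ u ++ entriesFrom -[1+_] v
entriesFrom i [] = []
entriesFrom i (t ∷ ts) = map (λ { (a , p) → i 0 ∷ a , p }) (entries t) ++ entriesFrom (i ∘ suc) ts

-- The exponent is itself the path into the trie, so collecting a term takes a few list steps and no
-- comparison with other terms. This keeps the large expansions feasible by evaluation.
normalize : Terms k → Terms k
normalize t = entries (foldr (λ { (a , p) → insert a p }) empty t)

module _ (x : ℤ) where

  open ≡-Reasoning

  private
    ⟪_,_⟫ : (Vec ℤ k → ℤ) → Terms k → ℤ
    ⟪_,_⟫ = pair (eval x)

  pair-constant : ∀ φ p → ⟪ φ , constant p ⟫ ≡ eval x p * φ []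
  pair-constant φ [] = refl
  pair-constant φ (_ ∷ _) = ℤₚ.+-identityʳ _

  pair-entriesFrom : ∀ (φ : Vec ℤ (suc k) → ℤ) i t ts →
    ⟪ φ , entriesFrom i (t ∷ ts) ⟫ ≡ ⟪ (λ a → φ (i 0 ∷ a)) , entries t ⟫ + ⟪ φ , entriesFrom (i ∘ suc) ts ⟫
  pair-entriesFrom φ i t ts = trans (pair-++ (eval x) φ (map _ (entries t)) _)
    (cong (_+ ⟪ φ , entriesFrom (i ∘ suc) ts ⟫)
      (trans (pair-map (eval x) (eval x) φ (i 0 ∷_) (+ 1) _ (λ _ _ → refl) (λ _ _ → sym (ℤₚ.*-identityˡ _)) (entries t))
        (ℤₚ.*-identityˡ _)))

  pair-empty : ∀ (φ : Vec ℤ k → ℤ) → ⟪ φ , entries empty ⟫ ≡ + 0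
  pair-empty {zero} φ = refl
  pair-empty {suc k} φ = refl

  pair-insert : ∀ (φ : Vec ℤ k → ℤ) a p t →
    ⟪ φ , entries (insert a p t) ⟫ ≡ eval x p * φ a + ⟪ φ , entries t ⟫
  -- The exponent `i n` of the child at position n is a parameter because the recursion passes from
  -- `i` to `i ∘ suc`; it starts from `+_` or `-[1+_]`.
  pair-insertAt : ∀ (φ : Vec ℤ (suc k) → ℤ) i n a p ts →
    ⟪ φ , entriesFrom i (insertAt n a p ts) ⟫ ≡ eval x p * φ (i n ∷ a) + ⟪ φ , entriesFrom i ts ⟫
  pair-insert φ [] p q = begin
    ⟪ φ , constant (trim (p ⊕ q)) ⟫
      ≡⟨ pair-constant φ (trim (p ⊕ q)) ⟩
    eval x (trim (p ⊕ q)) * φ []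
      ≡⟨ cong (_* φ []) (trans (eval-trim x (p ⊕ q)) (eval-⊕ x p q)) ⟩
    (eval x p + eval x q) * φ []
      ≡⟨ ℤₚ.*-distribʳ-+ (φ []) (eval x p) (eval x q) ⟩
    eval x p * φ [] + eval x q * φ []
      ≡⟨ cong (λ u → eval x p * φ [] + u * φ []) (sym (eval-trim x q)) ⟩
    eval x p * φ [] + eval x (trim q) * φ []
      ≡⟨ cong (λ u → eval x p * φ [] + u) (sym (pair-constant φ (trim q))) ⟩
    eval x p * φ [] + ⟪ φ , constant (trim q) ⟫ ∎
  pair-insert φ (+ n ∷ a) p (u , v) = begin
    ⟪ φ , entriesFrom +_ (insertAt n a p u) ++ entriesFrom -[1+_] v ⟫
      ≡⟨ pair-++ (eval x) φ (entriesFrom +_ (insertAt n a p u)) _ ⟩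
    ⟪ φ , entriesFrom +_ (insertAt n a p u) ⟫ + ⟪ φ , entriesFrom -[1+_] v ⟫
      ≡⟨ cong (_+ ⟪ φ , entriesFrom -[1+_] v ⟫) (pair-insertAt φ +_ n a p u) ⟩
    eval x p * φ (+ n ∷ a) + ⟪ φ , entriesFrom +_ u ⟫ + ⟪ φ , entriesFrom -[1+_] v ⟫
      ≡⟨ ℤₚ.+-assoc (eval x p * φ (+ n ∷ a)) _ _ ⟩
    eval x p * φ (+ n ∷ a) + (⟪ φ , entriesFrom +_ u ⟫ + ⟪ φ , entriesFrom -[1+_] v ⟫)
      ≡⟨ cong (λ w → eval x p * φ (+ n ∷ a) + w) (sym (pair-++ (eval x) φ (entriesFrom +_ u) _)) ⟩
    eval x p * φ (+ n ∷ a) + ⟪ φ , entries (u , v) ⟫ ∎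
  pair-insert φ (-[1+ n ] ∷ a) p (u , v) = begin
    ⟪ φ , entriesFrom +_ u ++ entriesFrom -[1+_] (insertAt n a p v) ⟫
      ≡⟨ pair-++ (eval x) φ (entriesFrom +_ u) _ ⟩
    ⟪ φ , entriesFrom +_ u ⟫ + ⟪ φ , entriesFrom -[1+_] (insertAt n a p v) ⟫
      ≡⟨ cong (λ w → ⟪ φ , entriesFrom +_ u ⟫ + w) (pair-insertAt φ -[1+_] n a p v) ⟩
    ⟪ φ , entriesFrom +_ u ⟫ + (eval x p * φ (-[1+ n ] ∷ a) + ⟪ φ , entriesFrom -[1+_] v ⟫)
      ≡⟨ lemma ⟪ φ , entriesFrom +_ u ⟫ (eval x p * φ (-[1+ n ] ∷ a)) ⟪ φ , entriesFrom -[1+_] v ⟫ ⟩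
    eval x p * φ (-[1+ n ] ∷ a) + (⟪ φ , entriesFrom +_ u ⟫ + ⟪ φ , entriesFrom -[1+_] v ⟫)
      ≡⟨ cong (λ w → eval x p * φ (-[1+ n ] ∷ a) + w) (sym (pair-++ (eval x) φ (entriesFrom +_ u) _)) ⟩
    eval x p * φ (-[1+ n ] ∷ a) + ⟪ φ , entries (u , v) ⟫ ∎
    where
    lemma : ∀ u v w → u + (v + w) ≡ v + (u + w)
    lemma = solve-∀
  pair-insertAt {k} φ i zero a p [] = begin
    ⟪ φ , entriesFrom i (insert a p empty ∷ []) ⟫
      ≡⟨ pair-entriesFrom φ i (insert a p empty) [] ⟩
    ⟪ (λ b → φ (i 0 ∷ b)) , entries (insert a p empty) ⟫ + + 0
      ≡⟨ cong (_+ + 0) (pair-insert (λ b → φ (i 0 ∷ b)) a p empty) ⟩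
    eval x p * φ (i 0 ∷ a) + ⟪ (λ b → φ (i 0 ∷ b)) , entries {k} empty ⟫ + + 0
      ≡⟨ cong (λ u → eval x p * φ (i 0 ∷ a) + u + + 0) (pair-empty (λ b → φ (i 0 ∷ b))) ⟩
    eval x p * φ (i 0 ∷ a) + + 0 + + 0
      ≡⟨ ℤₚ.+-identityʳ _ ⟩
    eval x p * φ (i 0 ∷ a) + + 0 ∎
  pair-insertAt φ i zero a p (t ∷ ts) = begin
    ⟪ φ , entriesFrom i (insert a p t ∷ ts) ⟫
      ≡⟨ pair-entriesFrom φ i (insert a p t) ts ⟩
    ⟪ (λ b → φ (i 0 ∷ b)) , entries (insert a p t) ⟫ + ⟪ φ , entriesFrom (i ∘ suc) ts ⟫
      ≡⟨ cong (_+ ⟪ φ , entriesFrom (i ∘ suc) ts ⟫) (pair-insert (λ b → φ (i 0 ∷ b)) a p t) ⟩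
    eval x p * φ (i 0 ∷ a) + ⟪ (λ b → φ (i 0 ∷ b)) , entries t ⟫ + ⟪ φ , entriesFrom (i ∘ suc) ts ⟫
      ≡⟨ ℤₚ.+-assoc (eval x p * φ (i 0 ∷ a)) _ _ ⟩
    eval x p * φ (i 0 ∷ a) + (⟪ (λ b → φ (i 0 ∷ b)) , entries t ⟫ + ⟪ φ , entriesFrom (i ∘ suc) ts ⟫)
      ≡⟨ cong (λ u → eval x p * φ (i 0 ∷ a) + u) (sym (pair-entriesFrom φ i t ts)) ⟩
    eval x p * φ (i 0 ∷ a) + ⟪ φ , entriesFrom i (t ∷ ts) ⟫ ∎
  pair-insertAt {k} φ i (suc n) a p [] = begin
    ⟪ φ , entriesFrom i (empty ∷ insertAt n a p []) ⟫
      ≡⟨ pair-entriesFrom φ i empty (insertAt n a p []) ⟩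
    ⟪ (λ b → φ (i 0 ∷ b)) , entries {k} empty ⟫ + ⟪ φ , entriesFrom (i ∘ suc) (insertAt n a p []) ⟫
      ≡⟨ cong₂ _+_ (pair-empty (λ b → φ (i 0 ∷ b))) (pair-insertAt φ (i ∘ suc) n a p []) ⟩
    + 0 + (eval x p * φ (i (suc n) ∷ a) + + 0)
      ≡⟨ ℤₚ.+-identityˡ _ ⟩
    eval x p * φ (i (suc n) ∷ a) + + 0 ∎
  pair-insertAt φ i (suc n) a p (t ∷ ts) = begin
    ⟪ φ , entriesFrom i (t ∷ insertAt n a p ts) ⟫
      ≡⟨ pair-entriesFrom φ i t (insertAt n a p ts) ⟩
    ⟪ (λ b → φ (i 0 ∷ b)) , entries t ⟫ + ⟪ φ , entriesFrom (i ∘ suc) (insertAt n a p ts) ⟫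
      ≡⟨ cong (λ u → ⟪ (λ b → φ (i 0 ∷ b)) , entries t ⟫ + u) (pair-insertAt φ (i ∘ suc) n a p ts) ⟩
    ⟪ (λ b → φ (i 0 ∷ b)) , entries t ⟫ + (eval x p * φ (i (suc n) ∷ a) + ⟪ φ , entriesFrom (i ∘ suc) ts ⟫)
      ≡⟨ lemma ⟪ (λ b → φ (i 0 ∷ b)) , entries t ⟫ (eval x p * φ (i (suc n) ∷ a)) ⟪ φ , entriesFrom (i ∘ suc) ts ⟫ ⟩
    eval x p * φ (i (suc n) ∷ a) + (⟪ (λ b → φ (i 0 ∷ b)) , entries t ⟫ + ⟪ φ , entriesFrom (i ∘ suc) ts ⟫)
      ≡⟨ cong (λ u → eval x p * φ (i (suc n) ∷ a) + u) (sym (pair-entriesFrom φ i t ts)) ⟩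
    eval x p * φ (i (suc n) ∷ a) + ⟪ φ , entriesFrom i (t ∷ ts) ⟫ ∎
    where
    lemma : ∀ u v w → u + (v + w) ≡ v + (u + w)
    lemma = solve-∀

  pair-normalize : ∀ (φ : Vec ℤ k → ℤ) t → ⟪ φ , normalize t ⟫ ≡ ⟪ φ , t ⟫
  pair-normalize φ [] = pair-empty φ
  pair-normalize φ ((a , p) ∷ t) =
    trans (pair-insert φ a p (foldr _ empty t)) (cong (λ u → eval x p * φ a + u) (pair-normalize φ t))

-- Certificates and the residue they leave

times : Poly → Laurent k → Terms k
times p = map (λ { (a , c) → a , c · p })

infixl 7 _⊛_
_⊛_ : Laurent k → Terms k → Terms k
f ⊛ t = concatMap (λ { (a , c) → map (λ { (b , p) → a ⊞ b , c · p }) t }) f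

pair-times : ∀ x (φ : Vec ℤ k → ℤ) p f → ⟨ φ , times p f ⟩at x ≡ eval x p * ⟨ φ , f ⟩
pair-times x φ p = pair-map (eval x) id φ id (eval x p) _ (λ _ _ → refl)
  (λ _ c → trans (eval-· x c p) (ℤₚ.*-comm c _))

pair-⊛ : ∀ x (φ : Vec ℤ k → ℤ) f t → ⟨ φ , f ⊛ t ⟩at x ≡ ⟨ (λ a → ⟨ (λ b → φ (a ⊞ b)) , t ⟩at x) , f ⟩
pair-⊛ x φ [] t = refl
pair-⊛ x φ ((a , c) ∷ f) t = trans (pair-++ (eval x) φ (map _ t) (f ⊛ t))
  (cong₂ _+_ (pair-map (eval x) (eval x) φ (a ⊞_) c _ (λ _ _ → refl) (λ _ p → eval-· x c p) t) (pair-⊛ x φ f t))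

Cert : ℕ → Set
Cert k = List (Vec ℤ k × Vec Poly k)

_⊙_ : Vec ℤ k → Vec Poly k → Poly
[] ⊙ [] = []
(c ∷ a) ⊙ (r ∷ rs) = c · r ⊕ a ⊙ rs

derivativeTerm : Vec ℤ k → Poly → Vec Poly k → Vec ℤ k × ℤ → Vec ℤ k × Poly
derivativeTerm q s ts (e , v) = q ⊞ e , v · (s ⊕ e ⊙ ts)

-- The contribution of one monomial x^q of R₁, ..., R_k. Since θᵢ multiplies x^q by qᵢ, `q ⊙ rs` is
-- its share in Σᵢ θᵢRᵢ. The polynomial `r ⊕ (+ 0 ∷ r)` is (1 + m) r, the factor n - 1 in front of
-- Rᵢ θᵢΛ.
derivative : Laurent k → Vec ℤ k × Vec Poly k → Terms k
derivative Λ (q , rs) = map (derivativeTerm q (q ⊙ rs) (Vec.map (λ r → r ⊕ (+ 0 ∷ r)) rs)) Λ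

-- The list of terms of p₃ Λ³ + p₂ Λ² + p₁ Λ + Σᵢ (θᵢRᵢ · Λ + (m + 1) Rᵢ θᵢΛ), where θᵢ = xᵢ ∂/∂xᵢ and
-- the certificate lists the coefficients of each monomial in R₁, …, Rₖ as polynomials in m.
residue : (p₃ p₂ p₁ : Poly) → Laurent k → Cert k → Terms k
residue p₃ p₂ p₁ Λ cert = normalize
  (Λ ⊛ normalize (times p₃ (Λ *L Λ) ++ (times p₂ Λ ++ (𝟎 , p₁) ∷ []))
    ++ concatMap (derivative Λ) cert)

-- Linear forms in the exponent

⊞-assoc : (a b c : Vec ℤ k) → (a ⊞ b) ⊞ c ≡ a ⊞ (b ⊞ c)
⊞-assoc = zipWith-assoc ℤₚ.+-assoc

⊞-comm : (a b : Vec ℤ k) → a ⊞ b ≡ b ⊞ a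
⊞-comm = zipWith-comm ℤₚ.+-comm

⊞-identityˡ : (a : Vec ℤ k) → 𝟎 ⊞ a ≡ a
⊞-identityˡ = zipWith-identityˡ ℤₚ.+-identityˡ

⊞-identityʳ : (a : Vec ℤ k) → a ⊞ 𝟎 ≡ a
⊞-identityʳ = zipWith-identityʳ ℤₚ.+-identityʳ

⊞-left-comm : (a b c : Vec ℤ k) → a ⊞ (b ⊞ c) ≡ b ⊞ (a ⊞ c)
⊞-left-comm a b c = trans (sym (⊞-assoc a b c)) (trans (cong (_⊞ c) (⊞-comm a b)) (⊞-assoc b a c))

-- Additivity in the exponent is exactly what makes weighting the terms by `a ⊙ rs` a derivation,
-- namely Σᵢ rᵢθᵢ.
eval-⊙-⊞ : ∀ x (a b : Vec ℤ k) rs → eval x ((a ⊞ b) ⊙ rs) ≡ eval x (a ⊙ rs) + eval x (b ⊙ rs)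
eval-⊙-⊞ x [] [] [] = refl
eval-⊙-⊞ x (a ∷ as) (b ∷ bs) (r ∷ rs) = begin
  eval x ((a + b) · r ⊕ (as ⊞ bs) ⊙ rs)
    ≡⟨ eval-⊕ x ((a + b) · r) _ ⟩
  eval x ((a + b) · r) + eval x ((as ⊞ bs) ⊙ rs)
    ≡⟨ cong₂ _+_ (eval-· x (a + b) r) (eval-⊙-⊞ x as bs rs) ⟩
  (a + b) * eval x r + (eval x (as ⊙ rs) + eval x (bs ⊙ rs))
    ≡⟨ lemma a b (eval x r) (eval x (as ⊙ rs)) (eval x (bs ⊙ rs)) ⟩
  (a * eval x r + eval x (as ⊙ rs)) + (b * eval x r + eval x (bs ⊙ rs))
    ≡⟨ cong₂ _+_ (step a as) (step b bs) ⟨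
  eval x (a · r ⊕ as ⊙ rs) + eval x (b · r ⊕ bs ⊙ rs) ∎
  where
  open ≡-Reasoning
  lemma : ∀ a b r u v → (a + b) * r + (u + v) ≡ (a * r + u) + (b * r + v)
  lemma = solve-∀
  step : ∀ c cs → eval x (c · r ⊕ cs ⊙ rs) ≡ c * eval x r + eval x (cs ⊙ rs)
  step c cs = trans (eval-⊕ x (c · r) _) (cong (_+ eval x (cs ⊙ rs)) (eval-· x c r))

eval-⊙-shift : ∀ x (a : Vec ℤ k) rs →
  eval x (a ⊙ Vec.map (λ r → r ⊕ (+ 0 ∷ r)) rs) ≡ (+ 1 + x) * eval x (a ⊙ rs)
eval-⊙-shift x [] [] = sym (ℤₚ.*-zeroʳ (+ 1 + x))
eval-⊙-shift x (a ∷ as) (r ∷ rs) = begin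
  eval x (a · (r ⊕ (+ 0 ∷ r)) ⊕ as ⊙ rs′)
    ≡⟨ eval-⊕ x (a · (r ⊕ (+ 0 ∷ r))) _ ⟩
  eval x (a · (r ⊕ (+ 0 ∷ r))) + eval x (as ⊙ rs′)
    ≡⟨ cong₂ _+_ (trans (eval-· x a (r ⊕ (+ 0 ∷ r))) (cong (a *_) (eval-⊕ x r (+ 0 ∷ r)))) (eval-⊙-shift x as rs) ⟩
  a * (eval x r + (+ 0 + x * eval x r)) + (+ 1 + x) * eval x (as ⊙ rs)
    ≡⟨ lemma a (eval x r) x (eval x (as ⊙ rs)) ⟩
  (+ 1 + x) * (a * eval x r + eval x (as ⊙ rs))
    ≡⟨ cong ((+ 1 + x) *_) (trans (eval-⊕ x (a · r) _) (cong (_+ eval x (as ⊙ rs)) (eval-· x a r))) ⟨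
  (+ 1 + x) * eval x (a · r ⊕ as ⊙ rs) ∎
  where
  open ≡-Reasoning
  rs′ = Vec.map (λ r → r ⊕ (+ 0 ∷ r)) rs
  lemma : ∀ a r x u → a * (r + (+ 0 + x * r)) + (+ 1 + x) * u ≡ (+ 1 + x) * (a * r + u)
  lemma = solve-∀

pair-derivative : ∀ x (φ : Vec ℤ k → ℤ) q s ts f →
  ⟨ φ , map (derivativeTerm q s ts) f ⟩at x ≡ ⟨ (λ e → (eval x s + eval x (e ⊙ ts)) * φ (q ⊞ e)) , f ⟩
pair-derivative x φ q s ts [] = refl
pair-derivative x φ q s ts ((e , v) ∷ f) = cong₂ _+_
  (trans (cong (_* φ (q ⊞ e)) (trans (eval-· x v (s ⊕ e ⊙ ts)) (cong (v *_) (eval-⊕ x s (e ⊙ ts)))))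
    (ℤₚ.*-assoc v _ (φ (q ⊞ e))))
  (pair-derivative x φ q s ts f)

-- The reason why a derivative has constant term 0: a derivation multiplies each coefficient by a
-- linear form in its exponent, and this form vanishes at the exponent that `δ[ 𝟎 ]` selects.
*δ-vanishes : ∀ (L : Vec ℤ k → ℤ) → L 𝟎 ≡ + 0 → ∀ a → L a * δ[ 𝟎 ] a ≡ + 0
*δ-vanishes L L0 a with ≡-dec ℤ._≟_ a 𝟎
... | yes refl = trans (ℤₚ.*-identityʳ _) L0
... | no _ = ℤₚ.*-zeroʳ (L a)

-- Constant terms of powers and their recurrence

module Powers {k} (Λ : Laurent k) where

  open ≡-Reasoning

  E : ℕ → (Vec ℤ k → ℤ) → ℤ
  E n φ = ⟨ φ , Λ ^L n ⟩

  E-suc : ∀ n φ → E (suc n) φ ≡ ⟨ (λ a → E n (λ b → φ (a ⊞ b))) , Λ ⟩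
  E-suc n φ = pair-*L φ Λ (Λ ^L n)

  module _ (L : Vec ℤ k → ℤ) (L-⊞ : ∀ a b → L (a ⊞ b) ≡ L a + L b) where

    L-𝟎 : L 𝟎 ≡ + 0
    L-𝟎 = identityˡ-unique (L 𝟎) (L 𝟎) (trans (sym (L-⊞ 𝟎 𝟎)) (cong L (⊞-identityˡ 𝟎)))

    -- The rule θ(Λᵐ⁺¹) = (m + 1) Λᵐ θΛ tested against χ, for the derivation θ that weights terms by
    -- `L`. Splitting off one factor Λ leaves one term where θ meets this factor and a rest where it
    -- meets the other m.
    E-leibniz : ∀ m χ → E (suc m) (λ b → L b * χ b) ≡ + suc m * ⟨ (λ e → L e * E m (λ b → χ (e ⊞ b))) , Λ ⟩
    -- By induction θ meets one of the m remaining factors, with multiplicity m; exchanging that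
    -- factor with the one split off gives the same sum as before.
    E-leibniz-tail : ∀ m χ → ⟨ (λ a → E m (λ b → L b * χ (a ⊞ b))) , Λ ⟩ ≡ + m * ⟨ (λ e → L e * E m (λ b → χ (e ⊞ b))) , Λ ⟩

    E-leibniz m χ = begin
      E (suc m) (λ b → L b * χ b)
        ≡⟨ E-suc m _ ⟩
      ⟨ (λ a → E m (λ b → L (a ⊞ b) * χ (a ⊞ b))) , Λ ⟩
        ≡⟨ pair-cong id split Λ ⟩
      ⟨ (λ a → L a * E m (λ b → χ (a ⊞ b)) + E m (λ b → L b * χ (a ⊞ b))) , Λ ⟩
        ≡⟨ pair-+ id _ _ Λ ⟩
      X + ⟨ (λ a → E m (λ b → L b * χ (a ⊞ b))) , Λ ⟩
        ≡⟨ cong (λ u → X + u) (E-leibniz-tail m χ) ⟩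
      X + + m * X
        ≡⟨ lemma X (+ m) ⟩
      + suc m * X ∎
      where
      X = ⟨ (λ e → L e * E m (λ b → χ (e ⊞ b))) , Λ ⟩
      lemma : ∀ x m → x + m * x ≡ (+ 1 + m) * x
      lemma = solve-∀
      split : ∀ a → E m (λ b → L (a ⊞ b) * χ (a ⊞ b)) ≡ L a * E m (λ b → χ (a ⊞ b)) + E m (λ b → L b * χ (a ⊞ b))
      split a = begin
        E m (λ b → L (a ⊞ b) * χ (a ⊞ b))
          ≡⟨ pair-cong id (λ b → trans (cong (_* χ (a ⊞ b)) (L-⊞ a b)) (ℤₚ.*-distribʳ-+ (χ (a ⊞ b)) (L a) (L b))) (Λ ^L m) ⟩
        E m (λ b → L a * χ (a ⊞ b) + L b * χ (a ⊞ b))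
          ≡⟨ pair-+ id _ _ (Λ ^L m) ⟩
        E m (λ b → L a * χ (a ⊞ b)) + E m (λ b → L b * χ (a ⊞ b))
          ≡⟨ cong (_+ E m (λ b → L b * χ (a ⊞ b))) (pair-* id (L a) _ (Λ ^L m)) ⟩
        L a * E m (λ b → χ (a ⊞ b)) + E m (λ b → L b * χ (a ⊞ b)) ∎

    -- Λ⁰ has its only term at `𝟎`, where the additive `L` vanishes.
    E-leibniz-tail zero χ = pair-0 id (λ a → cong (λ u → + 1 * (u * χ (a ⊞ 𝟎)) + + 0) L-𝟎) Λ
    E-leibniz-tail (suc m) χ = begin
      ⟨ (λ a → E (suc m) (λ b → L b * χ (a ⊞ b))) , Λ ⟩
        ≡⟨ pair-cong id (λ a → E-leibniz m (λ b → χ (a ⊞ b))) Λ ⟩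
      ⟨ (λ a → + suc m * ⟨ (λ e → L e * E m (λ b → χ (a ⊞ (e ⊞ b)))) , Λ ⟩) , Λ ⟩
        ≡⟨ pair-* id (+ suc m) _ Λ ⟩
      + suc m * ⟨ (λ a → ⟨ (λ e → L e * E m (λ b → χ (a ⊞ (e ⊞ b)))) , Λ ⟩) , Λ ⟩
        ≡⟨ cong (+ suc m *_) (pair-swap id id (λ a e → L e * E m (λ b → χ (a ⊞ (e ⊞ b)))) Λ Λ) ⟩
      + suc m * ⟨ (λ e → ⟨ (λ a → L e * E m (λ b → χ (a ⊞ (e ⊞ b)))) , Λ ⟩) , Λ ⟩
        ≡⟨ cong (+ suc m *_) (pair-cong id collect Λ) ⟩
      + suc m * ⟨ (λ e → L e * E (suc m) (λ b → χ (e ⊞ b))) , Λ ⟩ ∎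
      where
      collect : ∀ e → ⟨ (λ a → L e * E m (λ b → χ (a ⊞ (e ⊞ b)))) , Λ ⟩ ≡ L e * E (suc m) (λ b → χ (e ⊞ b))
      collect e = begin
        ⟨ (λ a → L e * E m (λ b → χ (a ⊞ (e ⊞ b)))) , Λ ⟩
          ≡⟨ pair-* id (L e) _ Λ ⟩
        L e * ⟨ (λ a → E m (λ b → χ (a ⊞ (e ⊞ b)))) , Λ ⟩
          ≡⟨ cong (L e *_) (pair-cong id (λ a → pair-cong id (λ b → cong χ (⊞-left-comm a e b)) (Λ ^L m)) Λ) ⟩
        L e * ⟨ (λ a → E m (λ b → χ (e ⊞ (a ⊞ b)))) , Λ ⟩
          ≡⟨ cong (L e *_) (sym (E-suc m _)) ⟩
        L e * E (suc m) (λ b → χ (e ⊞ b)) ∎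

  -- Its value at a is the constant term of x^a Λᵐ, so that pairing with `ψ m` is the functional f ↦
  -- CT (f Λᵐ).
  ψ : ℕ → Vec ℤ k → ℤ
  ψ m a = E m (λ b → δ[ 𝟎 ] (a ⊞ b))

  ψ-assoc : ∀ m q e → ψ m (q ⊞ e) ≡ E m (λ b → δ[ 𝟎 ] (q ⊞ (e ⊞ b)))
  ψ-assoc m q e = pair-cong id (λ b → cong δ[ 𝟎 ] (⊞-assoc q e b)) (Λ ^L m)

  ψ-suc : ∀ m q → ⟨ (λ e → ψ m (q ⊞ e)) , Λ ⟩ ≡ ψ (suc m) q
  ψ-suc m q = trans (pair-cong id (ψ-assoc m q) Λ) (sym (E-suc m _))

  -- The Leibniz rule reassembles both summands of `derivative` into the constant term of a
  -- derivative of x^q Λᵐ⁺¹. There the term with exponent b of Λᵐ⁺¹ carries the weight L(q + b),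
  -- which is 0 whenever q + b = 0.
  pair-derivative-0 : ∀ m r → ⟨ ψ m , derivative Λ r ⟩at (+ m) ≡ + 0
  pair-derivative-0 m (q , rs) = begin
    ⟨ ψ m , derivative Λ (q , rs) ⟩at (+ m)
      ≡⟨ pair-derivative (+ m) (ψ m) q _ _ Λ ⟩
    ⟨ (λ e → (L q + eval (+ m) (e ⊙ Vec.map (λ r → r ⊕ (+ 0 ∷ r)) rs)) * ψ m (q ⊞ e)) , Λ ⟩
      ≡⟨ pair-cong id expand Λ ⟩
    ⟨ (λ e → L q * ψ m (q ⊞ e) + + suc m * (L e * E m (λ b → χ (e ⊞ b)))) , Λ ⟩
      ≡⟨ pair-+ id _ _ Λ ⟩
    ⟨ (λ e → L q * ψ m (q ⊞ e)) , Λ ⟩ + ⟨ (λ e → + suc m * (L e * E m (λ b → χ (e ⊞ b)))) , Λ ⟩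
      ≡⟨ cong₂ _+_ (trans (pair-* id (L q) _ Λ) (cong (L q *_) (ψ-suc m q)))
           (trans (pair-* id (+ suc m) _ Λ) (sym (E-leibniz L L-⊞ m χ))) ⟩
    L q * E (suc m) χ + E (suc m) (λ b → L b * χ b)
      ≡⟨ cong (_+ E (suc m) (λ b → L b * χ b)) (sym (pair-* id (L q) χ (Λ ^L suc m))) ⟩
    E (suc m) (λ b → L q * χ b) + E (suc m) (λ b → L b * χ b)
      ≡⟨ sym (pair-+ id _ _ (Λ ^L suc m)) ⟩
    E (suc m) (λ b → L q * χ b + L b * χ b)
      ≡⟨ pair-0 id vanish (Λ ^L suc m) ⟩
    + 0 ∎
    where
    L : Vec ℤ k → ℤ
    L a = eval (+ m) (a ⊙ rs)
    L-⊞ : ∀ a b → L (a ⊞ b) ≡ L a + L b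
    L-⊞ a b = eval-⊙-⊞ (+ m) a b rs
    χ : Vec ℤ k → ℤ
    χ b = δ[ 𝟎 ] (q ⊞ b)
    lemma : ∀ a x c d → (a + x * c) * d ≡ a * d + x * (c * d)
    lemma = solve-∀
    expand : ∀ e → (L q + eval (+ m) (e ⊙ Vec.map (λ r → r ⊕ (+ 0 ∷ r)) rs)) * ψ m (q ⊞ e) ≡
      L q * ψ m (q ⊞ e) + + suc m * (L e * E m (λ b → χ (e ⊞ b)))
    expand e = begin
      (L q + eval (+ m) (e ⊙ Vec.map (λ r → r ⊕ (+ 0 ∷ r)) rs)) * ψ m (q ⊞ e)
        ≡⟨ cong (λ u → (L q + u) * ψ m (q ⊞ e)) (eval-⊙-shift (+ m) e rs) ⟩
      (L q + + suc m * L e) * ψ m (q ⊞ e)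
        ≡⟨ lemma (L q) (+ suc m) (L e) (ψ m (q ⊞ e)) ⟩
      L q * ψ m (q ⊞ e) + + suc m * (L e * ψ m (q ⊞ e))
        ≡⟨ cong (λ u → L q * ψ m (q ⊞ e) + + suc m * (L e * u)) (ψ-assoc m q e) ⟩
      L q * ψ m (q ⊞ e) + + suc m * (L e * E m (λ b → χ (e ⊞ b))) ∎
    vanish : ∀ b → L q * χ b + L b * χ b ≡ + 0
    vanish b = trans (sym (ℤₚ.*-distribʳ-+ (χ b) (L q) (L b)))
      (trans (cong (_* χ b) (sym (L-⊞ q b))) (*δ-vanishes L (L-𝟎 L L-⊞) (q ⊞ b)))

  pair-derivatives-0 : ∀ m rs → ⟨ ψ m , concatMap (derivative Λ) rs ⟩at (+ m) ≡ + 0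
  pair-derivatives-0 m [] = refl
  pair-derivatives-0 m (r ∷ rs) = trans (pair-++ (eval (+ m)) (ψ m) (derivative Λ r) _)
    (cong₂ _+_ (pair-derivative-0 m r) (pair-derivatives-0 m rs))

  -- Apply f ↦ CT (f Λᵐ) to the vanishing residue: the derivatives are annihilated, and Λ³, Λ², Λ
  -- turn into the constant terms of Λᵐ⁺³, Λᵐ⁺², Λᵐ⁺¹.
  recurrence : ∀ p₃ p₂ p₁ cert → residue p₃ p₂ p₁ Λ cert ≡ [] → ∀ m →
    eval (+ m) p₃ * CT (Λ ^L (3 ℕ.+ m)) + (eval (+ m) p₂ * CT (Λ ^L (2 ℕ.+ m)) + eval (+ m) p₁ * CT (Λ ^L (1 ℕ.+ m))) ≡ + 0
  recurrence p₃ p₂ p₁ cert residue≡[] m = begin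
    y₃ * CT (Λ ^L (3 ℕ.+ m)) + (y₂ * CT (Λ ^L (2 ℕ.+ m)) + y₁ * CT (Λ ^L (1 ℕ.+ m)))
      ≡⟨ cong₂ _+_ (cong (y₃ *_) (CT-suc (2 ℕ.+ m))) (cong₂ _+_ (cong (y₂ *_) (CT-suc (1 ℕ.+ m))) (cong (y₁ *_) (CT-suc m))) ⟩
    y₃ * ⟨ ψ (2 ℕ.+ m) , Λ ⟩ + (y₂ * ⟨ ψ (1 ℕ.+ m) , Λ ⟩ + y₁ * ⟨ ψ m , Λ ⟩)
      ≡⟨ cong₂ _+_ (pair-* id y₃ _ Λ) (cong₂ _+_ (pair-* id y₂ _ Λ) (pair-* id y₁ _ Λ)) ⟨
    ⟨ (λ a → y₃ * ψ (2 ℕ.+ m) a) , Λ ⟩ + (⟨ (λ a → y₂ * ψ (1 ℕ.+ m) a) , Λ ⟩ + ⟨ (λ a → y₁ * ψ m a) , Λ ⟩)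
      ≡⟨ cong (λ u → ⟨ (λ a → y₃ * ψ (2 ℕ.+ m) a) , Λ ⟩ + u) (pair-+ id _ _ Λ) ⟨
    ⟨ (λ a → y₃ * ψ (2 ℕ.+ m) a) , Λ ⟩ + ⟨ (λ a → y₂ * ψ (1 ℕ.+ m) a + y₁ * ψ m a) , Λ ⟩
      ≡⟨ pair-+ id _ _ Λ ⟨
    ⟨ (λ a → y₃ * ψ (2 ℕ.+ m) a + (y₂ * ψ (1 ℕ.+ m) a + y₁ * ψ m a)) , Λ ⟩
      ≡⟨ pair-cong id main Λ ⟨
    ⟨ (λ a → ⟨ (λ b → ψ m (a ⊞ b)) , normalize quadratic ⟩at (+ m)) , Λ ⟩
      ≡⟨ pair-⊛ (+ m) (ψ m) Λ (normalize quadratic) ⟨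
    ⟨ ψ m , Λ ⊛ normalize quadratic ⟩at (+ m)
      ≡⟨ ℤₚ.+-identityʳ _ ⟨
    ⟨ ψ m , Λ ⊛ normalize quadratic ⟩at (+ m) + + 0
      ≡⟨ cong (λ u → ⟨ ψ m , Λ ⊛ normalize quadratic ⟩at (+ m) + u) (pair-derivatives-0 m cert) ⟨
    ⟨ ψ m , Λ ⊛ normalize quadratic ⟩at (+ m) + ⟨ ψ m , concatMap (derivative Λ) cert ⟩at (+ m)
      ≡⟨ pair-++ (eval (+ m)) (ψ m) (Λ ⊛ normalize quadratic) _ ⟨
    ⟨ ψ m , Λ ⊛ normalize quadratic ++ concatMap (derivative Λ) cert ⟩at (+ m)
      ≡⟨ pair-normalize (+ m) (ψ m) (Λ ⊛ normalize quadratic ++ concatMap (derivative Λ) cert) ⟨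
    ⟨ ψ m , residue p₃ p₂ p₁ Λ cert ⟩at (+ m)
      ≡⟨ cong (λ t → ⟨ ψ m , t ⟩at (+ m)) residue≡[] ⟩
    + 0 ∎
    where
    y₃ = eval (+ m) p₃
    y₂ = eval (+ m) p₂
    y₁ = eval (+ m) p₁
    -- The cubic is Λ times this quadratic, which is normalized before the last multiplication so
    -- that the expansion of Λ³ has fewer terms.
    quadratic = times p₃ (Λ *L Λ) ++ (times p₂ Λ ++ (𝟎 , p₁) ∷ [])
    CT-suc : ∀ n → CT (Λ ^L suc n) ≡ ⟨ ψ n , Λ ⟩
    CT-suc n = trans (coeff-pair (Λ ^L suc n) 𝟎) (E-suc n δ[ 𝟎 ])
    square : ∀ a → ⟨ (λ b → ψ m (a ⊞ b)) , Λ *L Λ ⟩ ≡ ψ (2 ℕ.+ m) a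
    square a = begin
      ⟨ (λ b → ψ m (a ⊞ b)) , Λ *L Λ ⟩
        ≡⟨ pair-*L _ Λ Λ ⟩
      ⟨ (λ b → ⟨ (λ c → ψ m (a ⊞ (b ⊞ c))) , Λ ⟩) , Λ ⟩
        ≡⟨ pair-cong id (λ b → pair-cong id (λ c → cong (ψ m) (sym (⊞-assoc a b c))) Λ) Λ ⟩
      ⟨ (λ b → ⟨ (λ c → ψ m ((a ⊞ b) ⊞ c)) , Λ ⟩) , Λ ⟩
        ≡⟨ pair-cong id (λ b → ψ-suc m (a ⊞ b)) Λ ⟩
      ⟨ (λ b → ψ (suc m) (a ⊞ b)) , Λ ⟩
        ≡⟨ ψ-suc (suc m) a ⟩
      ψ (2 ℕ.+ m) a ∎
    main : ∀ a → ⟨ (λ b → ψ m (a ⊞ b)) , normalize quadratic ⟩at (+ m) ≡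
      y₃ * ψ (2 ℕ.+ m) a + (y₂ * ψ (1 ℕ.+ m) a + y₁ * ψ m a)
    main a = begin
      ⟨ φ , normalize quadratic ⟩at (+ m)
        ≡⟨ pair-normalize (+ m) φ quadratic ⟩
      ⟨ φ , quadratic ⟩at (+ m)
        ≡⟨ pair-++ (eval (+ m)) φ (times p₃ (Λ *L Λ)) _ ⟩
      ⟨ φ , times p₃ (Λ *L Λ) ⟩at (+ m) + ⟨ φ , times p₂ Λ ++ (𝟎 , p₁) ∷ [] ⟩at (+ m)
        ≡⟨ cong₂ _+_ (trans (pair-times (+ m) φ p₃ (Λ *L Λ)) (cong (y₃ *_) (square a)))
             (trans (pair-++ (eval (+ m)) φ (times p₂ Λ) _)
               (cong₂ _+_ (trans (pair-times (+ m) φ p₂ Λ) (cong (y₂ *_) (ψ-suc m a)))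
                 (trans (ℤₚ.+-identityʳ _) (cong (λ u → y₁ * ψ m u) (⊞-identityʳ a))))) ⟩
      y₃ * ψ (2 ℕ.+ m) a + (y₂ * ψ (1 ℕ.+ m) a + y₁ * ψ m a) ∎
      where
      φ = λ b → ψ m (a ⊞ b)

-- The embedding of ℤ into ℚ

-- Rationals are stored in lowest terms, which blocks computation with variables. Over unreduced
-- fractions an equation is its cross-multiplied form, an identity of the ring ℤ.
toℚᵘ-ι : ∀ x → ℚ.toℚᵘ (ιℤ x) ℚᵘ.≃ mkℚᵘ x 0
toℚᵘ-ι x = ℚₚ.toℚᵘ-fromℚᵘ (mkℚᵘ x 0)

module _ where
  open ℚᵘₚ.≃-Reasoning

  ι-+ : ∀ x y → ιℤ (x + y) ≡ ιℤ x ℚ.+ ιℤ y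
  ι-+ x y = ℚₚ.toℚᵘ-injective (begin
    ℚ.toℚᵘ (ιℤ (x + y))               ≈⟨ toℚᵘ-ι (x + y) ⟩
    mkℚᵘ (x + y) 0                    ≈⟨ *≡* (lemma x y) ⟩
    mkℚᵘ x 0 ℚᵘ.+ mkℚᵘ y 0            ≈⟨ ℚᵘₚ.+-cong (toℚᵘ-ι x) (toℚᵘ-ι y) ⟨
    ℚ.toℚᵘ (ιℤ x) ℚᵘ.+ ℚ.toℚᵘ (ιℤ y)  ≈⟨ ℚₚ.toℚᵘ-homo-+ (ιℤ x) (ιℤ y) ⟨
    ℚ.toℚᵘ (ιℤ x ℚ.+ ιℤ y)            ∎)
    where
    lemma : ∀ x y → (x + y) * + 1 ≡ (x * + 1 + y * + 1) * + 1
    lemma = solve-∀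

  ι-* : ∀ x y → ιℤ (x * y) ≡ ιℤ x ℚ.* ιℤ y
  ι-* x y = ℚₚ.toℚᵘ-injective (begin
    ℚ.toℚᵘ (ιℤ (x * y))               ≈⟨ toℚᵘ-ι (x * y) ⟩
    mkℚᵘ (x * y) 0                    ≈⟨ ℚᵘₚ.≃-refl ⟩
    mkℚᵘ x 0 ℚᵘ.* mkℚᵘ y 0            ≈⟨ ℚᵘₚ.*-cong (toℚᵘ-ι x) (toℚᵘ-ι y) ⟨
    ℚ.toℚᵘ (ιℤ x) ℚᵘ.* ℚ.toℚᵘ (ιℤ y)  ≈⟨ ℚₚ.toℚᵘ-homo-* (ιℤ x) (ιℤ y) ⟨
    ℚ.toℚᵘ (ιℤ x ℚ.* ιℤ y)            ∎)

  ι-inverseʳ : ∀ d → ιℤ (+ suc d) ℚ.* (+ 1 ℚ./ suc d) ≡ ℚ.1ℚ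
  ι-inverseʳ d = ℚₚ.toℚᵘ-injective (begin
    ℚ.toℚᵘ (ιℤ (+ suc d) ℚ.* (+ 1 ℚ./ suc d))              ≈⟨ ℚₚ.toℚᵘ-homo-* (ιℤ (+ suc d)) (+ 1 ℚ./ suc d) ⟩
    ℚ.toℚᵘ (ιℤ (+ suc d)) ℚᵘ.* ℚ.toℚᵘ (+ 1 ℚ./ suc d)      ≈⟨ ℚᵘₚ.*-cong (toℚᵘ-ι (+ suc d)) (ℚₚ.toℚᵘ-fromℚᵘ (mkℚᵘ (+ 1) d)) ⟩
    mkℚᵘ (+ suc d) 0 ℚᵘ.* mkℚᵘ (+ 1) d                     ≈⟨ *≡* (lemma (+ suc d)) ⟩
    ℚᵘ.1ℚᵘ                                                 ∎)
    where
    lemma : ∀ x → x * + 1 * + 1 ≡ + 1 * (+ 1 * x)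
    lemma = solve-∀

ι-neg : ∀ x → ιℤ (- x) ≡ ℚ.- ιℤ x
ι-neg x = inverseˡ-unique (ιℤ (- x)) (ιℤ x) (trans (sym (ι-+ (- x) x)) (cong ιℤ (ℤₚ.+-inverseˡ x)))

/suc-unique : ∀ d z q → ιℤ (+ suc d * z) ≡ q → q ℚ.* (+ 1 ℚ./ suc d) ≡ ιℤ z
/suc-unique d z q refl = begin
  ιℤ (+ suc d * z) ℚ.* i             ≡⟨ cong (ℚ._* i) (trans (cong ιℤ (ℤₚ.*-comm (+ suc d) z)) (ι-* z (+ suc d))) ⟩
  ιℤ z ℚ.* ιℤ (+ suc d) ℚ.* i        ≡⟨ ℚₚ.*-assoc (ιℤ z) _ _ ⟩
  ιℤ z ℚ.* (ιℤ (+ suc d) ℚ.* i)      ≡⟨ cong (ιℤ z ℚ.*_) (ι-inverseʳ d) ⟩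
  ιℤ z ℚ.* ℚ.1ℚ                      ≡⟨ ℚₚ.*-identityʳ _ ⟩
  ιℤ z                               ∎
  where
  open ≡-Reasoning
  i = + 1 ℚ./ suc d

-- The sequences are defined with a division in ℚ; this reduces one step of their recursion to the
-- integer equation with the denominator multiplied out.
step-unique : ∀ d f g x y z → + suc d * z ≡ f * x + - (g * y) →
  (ιℤ f ℚ.* ιℤ x ℚ.- ιℤ g ℚ.* ιℤ y) ℚ.* (+ 1 ℚ./ suc d) ≡ ιℤ z
step-unique d f g x y z e = /suc-unique d z _ (begin
  ιℤ (+ suc d * z)                     ≡⟨ cong ιℤ e ⟩
  ιℤ (f * x + - (g * y))               ≡⟨ ι-+ (f * x) (- (g * y)) ⟩
  ιℤ (f * x) ℚ.+ ιℤ (- (g * y))        ≡⟨ cong₂ ℚ._+_ (ι-* f x) (trans (ι-neg (g * y)) (cong ℚ.-_ (ι-* g y))) ⟩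
  ιℤ f ℚ.* ιℤ x ℚ.- ιℤ g ℚ.* ιℤ y      ∎)
  where open ≡-Reasoning

-- A recurrence determines its sequence

-- The predecessor sequence with the convention u₋₁ = 0, matching the first component of the
-- recursively defined pairs.
shift : (ℕ → ℤ) → ℕ → ℤ
shift c zero = + 0
shift c (suc n) = c n

ZagierStep : (A B l : ℤ) → (ℕ → ℤ) → ℕ → Set
ZagierStep A B l c n = + suc (n ℕ.* (n ℕ.+ 2)) * c (suc n) ≡
  (A * + n * + n + A * + n + l) * c n + - (B * + n * + n * shift c n)

-- The recursion runs on pairs of consecutive values, so both components are carried through the
-- induction.
zagierPair-unique : ∀ A B l c → c 0 ≡ + 1 → (∀ n → ZagierStep A B l c n) →
  ∀ n → zagierPair A B l n ≡ (ιℤ (shift c n) , ιℤ (c n))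
zagierPair-unique A B l c c0 step zero rewrite c0 = refl
zagierPair-unique A B l c c0 step (suc n) with zagierPair A B l n | zagierPair-unique A B l c c0 step n
... | _ | refl = cong (ιℤ (c n) ,_) (step-unique (n ℕ.* (n ℕ.+ 2)) (A * + n * + n + A * + n + l) (B * + n * + n) (c n) (shift c n) (c (suc n)) (step n))

CooperStep : (a b c d : ℤ) → (ℕ → ℤ) → ℕ → Set
CooperStep a b c d u n = + suc (n ℕ.* n ℕ.* n ℕ.+ 3 ℕ.* n ℕ.* n ℕ.+ 3 ℕ.* n) * u (suc n) ≡
  + (2 ℕ.* n ℕ.+ 1) * (a * + n * + n + a * + n + b) * u n + - (+ n * (c * + n * + n + d) * shift u n)

cooperPair-unique : ∀ a b c d u → u 0 ≡ + 1 → (∀ n → CooperStep a b c d u n) →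
  ∀ n → cooperPair a b c d n ≡ (ιℤ (shift u n) , ιℤ (u n))
cooperPair-unique a b c d u u0 step zero rewrite u0 = refl
cooperPair-unique a b c d u u0 step (suc n) with cooperPair a b c d n | cooperPair-unique a b c d u u0 step n
... | _ | refl = cong (ιℤ (u n) ,_)
  (step-unique (n ℕ.* n ℕ.* n ℕ.+ 3 ℕ.* n ℕ.* n ℕ.+ 3 ℕ.* n)
    (+ (2 ℕ.* n ℕ.+ 1) * (a * + n * + n + a * + n + b)) (+ n * (c * + n * + n + d)) (u n) (shift u n) (u (suc n)) (step n))

-- D times the coefficients of u₍ₘ₊₃₎, u₍ₘ₊₂₎ and u₍ₘ₊₁₎ in the recurrence for n = m + 2.
zagier-p₃ zagier-p₂ zagier-p₁ : (D : ℕ) (A B l : ℤ) → Poly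
zagier-p₃ D A B l = + D · (+ 9 ∷ + 6 ∷ + 1 ∷ [])
zagier-p₂ D A B l = + D · (- (+ 6 * A + l) ∷ - (+ 5 * A) ∷ - A ∷ [])
zagier-p₁ D A B l = + D · (+ 4 * B ∷ + 4 * B ∷ B ∷ [])

cooper-p₃ cooper-p₂ cooper-p₁ : (D : ℕ) (a b c d : ℤ) → Poly
cooper-p₃ D a b c d = + D · (+ 27 ∷ + 27 ∷ + 9 ∷ + 1 ∷ [])
cooper-p₂ D a b c d = + D · (- (+ 30 * a + + 5 * b) ∷ - (+ 37 * a + + 2 * b) ∷ - (+ 15 * a) ∷ - (+ 2 * a) ∷ [])
cooper-p₁ D a b c d = + D · (+ 8 * c + + 2 * d ∷ + 12 * c + d ∷ + 6 * c ∷ c ∷ [])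

-- For n ≥ 2 the step comes from the certificate, and n = 0 and n = 1 are left as closed equations.
-- The multiplier `D` stands for a common denominator of the Rᵢ: the certificate proves D times the
-- recurrence, and D is cancelled at the end.
zagier-represents : ∀ A B l D .{{_ : ℕ.NonZero D}} (Λ : Laurent k) cert →
  residue (zagier-p₃ D A B l) (zagier-p₂ D A B l) (zagier-p₁ D A B l) Λ cert ≡ [] →
  let c = λ n → CT (Λ ^L n) in
  c 0 ≡ + 1 → ZagierStep A B l c 0 → ZagierStep A B l c 1 →
  ∀ n → ιℤ (c n) ≡ zagier A B l n
zagier-represents {k} A B l D@(suc _) Λ cert r≡[] c0 step0 step1 n =
  sym (cong proj₂ (zagierPair-unique A B l c c0 step n))
  where
  open ≡-Reasoning
  c : ℕ → ℤ
  c n = CT (Λ ^L n)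
  -- The nested form is what `eval` of the three coefficient lists unfolds to, so the bracket is by
  -- definition the expression that `Powers.recurrence` shows to be 0. The square (n + 1)² appears
  -- as 1 + n (n + 2) with n = m + 2.
  ring : ∀ D A B l x c₃ c₂ c₁ →
    D * ((+ 1 + (+ 2 + x) * (+ 4 + x)) * c₃) ≡
    ((D * + 9 + x * (D * + 6 + x * (D * + 1 + x * + 0))) * c₃
      + ((D * - (+ 6 * A + l) + x * (D * - (+ 5 * A) + x * (D * - A + x * + 0))) * c₂
        + (D * (+ 4 * B) + x * (D * (+ 4 * B) + x * (D * B + x * + 0))) * c₁))
    + D * ((A * (+ 2 + x) * (+ 2 + x) + A * (+ 2 + x) + l) * c₂ + - (B * (+ 2 + x) * (+ 2 + x) * c₁))
  ring = solve-∀
  step : ∀ n → ZagierStep A B l c n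
  step zero = step0
  step (suc zero) = step1
  step (suc (suc m)) = ℤₚ.*-cancelˡ-≡ (+ D) _ _ (begin
    + D * (+ suc ((2 ℕ.+ m) ℕ.* (2 ℕ.+ m ℕ.+ 2)) * c (3 ℕ.+ m))
      ≡⟨ cong (λ u → + D * ((+ 1 + u) * c (3 ℕ.+ m))) (trans (ℤₚ.pos-* (2 ℕ.+ m) (2 ℕ.+ m ℕ.+ 2)) (cong (λ u → + (2 ℕ.+ m) * + u) (ℕₚ.+-comm (2 ℕ.+ m) 2))) ⟩
    + D * ((+ 1 + + (2 ℕ.+ m) * + (4 ℕ.+ m)) * c (3 ℕ.+ m))
      ≡⟨ ring (+ D) A B l (+ m) (c (3 ℕ.+ m)) (c (2 ℕ.+ m)) (c (1 ℕ.+ m)) ⟩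
    _
      ≡⟨ cong (_+ R) (Powers.recurrence Λ _ _ _ cert r≡[] m) ⟩
    + 0 + R
      ≡⟨ ℤₚ.+-identityˡ R ⟩
    R ∎)
    where
    R = + D * ((A * + (2 ℕ.+ m) * + (2 ℕ.+ m) + A * + (2 ℕ.+ m) + l) * c (2 ℕ.+ m)
      + - (B * + (2 ℕ.+ m) * + (2 ℕ.+ m) * c (1 ℕ.+ m)))

cooper-represents : ∀ a b c d D .{{_ : ℕ.NonZero D}} (Λ : Laurent k) cert →
  residue (cooper-p₃ D a b c d) (cooper-p₂ D a b c d) (cooper-p₁ D a b c d) Λ cert ≡ [] →
  let u = λ n → CT (Λ ^L n) in
  u 0 ≡ + 1 → CooperStep a b c d u 0 → CooperStep a b c d u 1 →
  ∀ n → ιℤ (u n) ≡ cooper a b c d n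
cooper-represents {k} a b c d D@(suc _) Λ cert r≡[] u0 step0 step1 n =
  sym (cong proj₂ (cooperPair-unique a b c d u u0 step n))
  where
  open ≡-Reasoning
  u : ℕ → ℤ
  u n = CT (Λ ^L n)
  -- Again the unfolded `eval`; the cube (n + 1)³ appears as 1 + (n³ + 3n² + 3n) with n = m + 2.
  ring : ∀ D a b c d x c₃ c₂ c₁ →
    D * ((+ 1 + ((+ 2 + x) * (+ 2 + x) * (+ 2 + x) + + 3 * (+ 2 + x) * (+ 2 + x) + + 3 * (+ 2 + x))) * c₃) ≡
    ((D * + 27 + x * (D * + 27 + x * (D * + 9 + x * (D * + 1 + x * + 0)))) * c₃
      + ((D * - (+ 30 * a + + 5 * b) + x * (D * - (+ 37 * a + + 2 * b) + x * (D * - (+ 15 * a) + x * (D * - (+ 2 * a) + x * + 0)))) * c₂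
        + (D * (+ 8 * c + + 2 * d) + x * (D * (+ 12 * c + d) + x * (D * (+ 6 * c) + x * (D * c + x * + 0)))) * c₁))
    + D * ((+ 2 * (+ 2 + x) + + 1) * (a * (+ 2 + x) * (+ 2 + x) + a * (+ 2 + x) + b) * c₂
      + - ((+ 2 + x) * (c * (+ 2 + x) * (+ 2 + x) + d) * c₁))
  ring = solve-∀
  step : ∀ n → CooperStep a b c d u n
  step zero = step0
  step (suc zero) = step1
  step (suc (suc m)) = ℤₚ.*-cancelˡ-≡ (+ D) _ _ (begin
    + D * (+ suc (n′ ℕ.* n′ ℕ.* n′ ℕ.+ 3 ℕ.* n′ ℕ.* n′ ℕ.+ 3 ℕ.* n′) * u (3 ℕ.+ m))
      ≡⟨ cong (λ v → + D * ((+ 1 + v) * u (3 ℕ.+ m)))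
           (cong₂ _+_ (cong₂ _+_ (pos-*₃ n′ n′ n′) (pos-*₃ 3 n′ n′)) (ℤₚ.pos-* 3 n′)) ⟩
    + D * ((+ 1 + (+ n′ * + n′ * + n′ + + 3 * + n′ * + n′ + + 3 * + n′)) * u (3 ℕ.+ m))
      ≡⟨ ring (+ D) a b c d (+ m) (u (3 ℕ.+ m)) (u (2 ℕ.+ m)) (u (1 ℕ.+ m)) ⟩
    _
      ≡⟨ cong (_+ R) (Powers.recurrence Λ _ _ _ cert r≡[] m) ⟩
    + 0 + R
      ≡⟨ ℤₚ.+-identityˡ R ⟩
    R
      ≡⟨ cong (λ v → + D * ((v + + 1) * (a * + n′ * + n′ + a * + n′ + b) * u (2 ℕ.+ m) + - (+ n′ * (c * + n′ * + n′ + d) * u (1 ℕ.+ m)))) (sym (ℤₚ.pos-* 2 n′)) ⟩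
    _ ∎)
    where
    n′ = 2 ℕ.+ m
    pos-*₃ : ∀ x y z → + (x ℕ.* y ℕ.* z) ≡ + x * + y * + z
    pos-*₃ x y z = trans (ℤₚ.pos-* (x ℕ.* y) z) (cong (_* + z) (ℤₚ.pos-* x y))
    R = + D * ((+ 2 * + n′ + + 1) * (a * + n′ * + n′ + a * + n′ + b) * u (2 ℕ.+ m)
      + - (+ n′ * (c * + n′ * + n′ + d) * u (1 ℕ.+ m)))

-- Finite sums and order in ℚ

open +-*-Solver using (solve; _:=_; _:+_; _:*_; _:-_; :-_; con)

sumFin-cong : ∀ n {f g : Fin n → ℚ} → (∀ i → f i ≡ g i) → sumFin n f ≡ sumFin n g
sumFin-cong zero e = refl
sumFin-cong (suc n) e = cong₂ ℚ._+_ (e zero) (sumFin-cong n (e ∘ suc))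

sumFin-0 : ∀ n → sumFin n (λ _ → 0ℚ) ≡ 0ℚ
sumFin-0 zero = refl
sumFin-0 (suc n) = trans (ℚₚ.+-identityˡ _) (sumFin-0 n)

sumFin-+ : ∀ n (f g : Fin n → ℚ) → sumFin n (λ i → f i ℚ.+ g i) ≡ sumFin n f ℚ.+ sumFin n g
sumFin-+ zero f g = refl
sumFin-+ (suc n) f g = trans (cong (λ u → f zero ℚ.+ g zero ℚ.+ u) (sumFin-+ n (f ∘ suc) (g ∘ suc)))
  (solve 4 (λ a b c d → (a :+ b) :+ (c :+ d) := (a :+ c) :+ (b :+ d)) refl (f zero) (g zero) _ _)

sumFin-* : ∀ n x (f : Fin n → ℚ) → sumFin n (λ i → x ℚ.* f i) ≡ x ℚ.* sumFin n f
sumFin-* zero x f = sym (ℚₚ.*-zeroʳ x)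
sumFin-* (suc n) x f = trans (cong (λ u → x ℚ.* f zero ℚ.+ u) (sumFin-* n x (f ∘ suc))) (sym (ℚₚ.*-distribˡ-+ x (f zero) _))

sumFin-swap : ∀ m n (f : Fin m → Fin n → ℚ) →
  sumFin m (λ i → sumFin n (f i)) ≡ sumFin n (λ j → sumFin m (λ i → f i j))
sumFin-swap zero n f = sym (sumFin-0 n)
sumFin-swap (suc m) n f = trans (cong (λ u → sumFin n (f zero) ℚ.+ u) (sumFin-swap m n (f ∘ suc))) (sym (sumFin-+ n (f zero) _))

sumFin-mono : ∀ n {f g : Fin n → ℚ} → (∀ i → f i ℚ.≤ g i) → sumFin n f ℚ.≤ sumFin n g
sumFin-mono zero h = ℚₚ.≤-refl
sumFin-mono (suc n) h = ℚₚ.+-mono-≤ (h zero) (sumFin-mono n (h ∘ suc))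

-- Both ways of bracketing a row vector, a matrix and a column vector. This exchange underlies the
-- moments of the weights, the bound on the hull and the cone argument.
sumFin-bilinear : ∀ m n (x : Fin m → ℚ) (a : Fin m → Fin n → ℚ) (y : Fin n → ℚ) →
  sumFin m (λ i → x i ℚ.* sumFin n (λ j → a i j ℚ.* y j)) ≡ sumFin n (λ j → sumFin m (λ i → x i ℚ.* a i j) ℚ.* y j)
sumFin-bilinear m n x a y = begin
  sumFin m (λ i → x i ℚ.* sumFin n (λ j → a i j ℚ.* y j))
    ≡⟨ sumFin-cong m (λ i → sym (sumFin-* n (x i) _)) ⟩
  sumFin m (λ i → sumFin n (λ j → x i ℚ.* (a i j ℚ.* y j)))
    ≡⟨ sumFin-swap m n _ ⟩
  sumFin n (λ j → sumFin m (λ i → x i ℚ.* (a i j ℚ.* y j)))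
    ≡⟨ sumFin-cong n (λ j → sumFin-cong m (λ i → solve 3 (λ x a y → x :* (a :* y) := y :* (x :* a)) refl (x i) (a i j) (y j))) ⟩
  sumFin n (λ j → sumFin m (λ i → y j ℚ.* (x i ℚ.* a i j)))
    ≡⟨ sumFin-cong n (λ j → trans (sumFin-* m (y j) _) (ℚₚ.*-comm (y j) _)) ⟩
  sumFin n (λ j → sumFin m (λ i → x i ℚ.* a i j) ℚ.* y j) ∎
  where open ≡-Reasoning

Σℤ : ∀ n → (Fin n → ℤ) → ℤ
Σℤ zero f = + 0
Σℤ (suc n) f = f zero + Σℤ n (f ∘ suc)

ι-Σ : ∀ n (f : Fin n → ℤ) → ιℤ (Σℤ n f) ≡ sumFin n (ιℤ ∘ f)
ι-Σ zero f = refl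
ι-Σ (suc n) f = trans (ι-+ (f zero) _) (cong (λ u → ιℤ (f zero) ℚ.+ u) (ι-Σ n (f ∘ suc)))

ι-Σ-* : ∀ n (f g : Fin n → ℤ) → sumFin n (λ i → ιℤ (f i) ℚ.* ιℤ (g i)) ≡ ιℤ (Σℤ n (λ i → f i * g i))
ι-Σ-* n f g = trans (sumFin-cong n (λ i → sym (ι-* (f i) (g i)))) (sym (ι-Σ n _))

ι-mono-≤ : ∀ {x y} → x ℤ.≤ y → ιℤ x ℚ.≤ ιℤ y
ι-mono-≤ {x} {y} x≤y = ℚₚ.toℚᵘ-cancel-≤ (begin
  ℚ.toℚᵘ (ιℤ x) ≃⟨ toℚᵘ-ι x ⟩
  mkℚᵘ x 0      ≤⟨ *≤* (ℤₚ.*-monoʳ-≤-nonNeg (+ 1) x≤y) ⟩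
  mkℚᵘ y 0      ≃⟨ toℚᵘ-ι y ⟨
  ℚ.toℚᵘ (ιℤ y) ∎)
  where open ℚᵘₚ.≤-Reasoning

ι-cancel-< : ∀ {x y} → ιℤ x ℚ.< ιℤ y → x ℤ.< y
ι-cancel-< {x} {y} x<y = ℤₚ.≰⇒> (λ y≤x → ℚₚ.<-irrefl refl (ℚₚ.<-≤-trans x<y (ι-mono-≤ y≤x)))

ι-cancel-≤ : ∀ {x y} → ιℤ x ℚ.≤ ιℤ y → x ℤ.≤ y
ι-cancel-≤ {x} {y} ιx≤ιy with toℚᵘ-≤
  where
  toℚᵘ-≤ : mkℚᵘ x 0 ℚᵘ.≤ mkℚᵘ y 0
  toℚᵘ-≤ = ℚᵘₚ.≤-respʳ-≃ (toℚᵘ-ι y) (ℚᵘₚ.≤-respˡ-≃ (toℚᵘ-ι x) (ℚₚ.toℚᵘ-mono-≤ ιx≤ιy))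
... | *≤* x1≤y1 = subst₂ ℤ._≤_ (ℤₚ.*-identityʳ x) (ℤₚ.*-identityʳ y) x1≤y1

0≤ι : ∀ n → 0ℚ ℚ.≤ ιℤ (+ n)
0≤ι n = ι-mono-≤ {+ 0} {+ n} (ℤ.+≤+ ℕ.z≤n)

0≤* : ∀ x y → 0ℚ ℚ.≤ x → 0ℚ ℚ.≤ y → 0ℚ ℚ.≤ x ℚ.* y
0≤* x y 0≤x 0≤y = ℚₚ.nonNegative⁻¹ (x ℚ.* y) {{ℚₚ.nonNeg*nonNeg⇒nonNeg x {{ℚ.nonNegative 0≤x}} y {{ℚ.nonNegative 0≤y}}}}

0≤1/ : ∀ d → 0ℚ ℚ.< + 1 ℚ./ suc d
0≤1/ d = ℚₚ.positive⁻¹ (+ 1 ℚ./ suc d) {{ℚₚ.normalize-pos 1 (suc d)}}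

0≤∣x∣+x : ∀ x → 0ℚ ℚ.≤ ℚ.∣ x ∣ ℚ.+ x
0≤∣x∣+x x with ℚₚ.∣p∣≡p∨∣p∣≡-p x
... | inj₁ e = subst (λ u → 0ℚ ℚ.≤ ℚ.∣ x ∣ ℚ.+ u) e (ℚₚ.+-mono-≤ 0≤∣x∣ 0≤∣x∣)
  where 0≤∣x∣ = ℚₚ.nonNegative⁻¹ ℚ.∣ x ∣ {{ℚₚ.∣-∣-nonNeg x}}
... | inj₂ e = ℚₚ.≤-reflexive (sym (trans (cong (ℚ._+ x) e) (ℚₚ.+-inverseˡ x)))

0≤r+x : ∀ {r} x → ℚ.∣ x ∣ ℚ.≤ r → 0ℚ ℚ.≤ r ℚ.+ x
0≤r+x x h = ℚₚ.≤-trans (0≤∣x∣+x x) (ℚₚ.+-mono-≤ h ℚₚ.≤-refl)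

-- According to the sign of a, the sum is |a| times r + x or r - x.
0≤∣a∣r+ax : ∀ a {r} x → ℚ.∣ x ∣ ℚ.≤ r → 0ℚ ℚ.≤ ιℤ (+ ℤ.∣ a ∣) ℚ.* r ℚ.+ ιℤ a ℚ.* x
0≤∣a∣r+ax (+ n) {r} x h = ℚₚ.≤-trans (0≤* (ιℤ (+ n)) (r ℚ.+ x) (0≤ι n) (0≤r+x x h))
  (ℚₚ.≤-reflexive (ℚₚ.*-distribˡ-+ (ιℤ (+ n)) r x))
0≤∣a∣r+ax -[1+ n ] {r} x h = ℚₚ.≤-trans
  (0≤* (ιℤ (+ suc n)) (r ℚ.- x) (0≤ι (suc n)) (0≤r+x (ℚ.- x) (subst (ℚ._≤ r) (sym (ℚₚ.∣-p∣≡∣p∣ x)) h)))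
  (ℚₚ.≤-reflexive (trans (solve 3 (λ a r x → a :* (r :- x) := a :* r :+ (:- a) :* x) refl (ιℤ (+ suc n)) r x)
    (cong (λ u → ιℤ (+ suc n) ℚ.* r ℚ.+ u ℚ.* x) (sym (ι-neg (+ suc n))))))

-- The scalar matrix c. The scalar is M + 1 where the denominators of barycentric coordinates are
-- cleared, and 1 or -1 for the directions ± xₗ.
kron : ℤ → Fin k → Fin k → ℤ
kron c zero zero = c
kron c zero (suc j) = + 0
kron c (suc i) zero = + 0
kron c (suc i) (suc j) = kron c i j

sumFin-kron : ∀ c (l : Fin k) (q : Fin k → ℚ) → sumFin k (λ j → ιℤ (kron c l j) ℚ.* q j) ≡ ιℤ c ℚ.* q l
sumFin-kron {suc k} c zero q = trans (cong (λ u → ιℤ c ℚ.* q zero ℚ.+ u)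
  (trans (sumFin-cong k (λ j → ℚₚ.*-zeroˡ (q (suc j)))) (sumFin-0 k))) (ℚₚ.+-identityʳ _)
sumFin-kron {suc k} c (suc l) q = trans (cong₂ ℚ._+_ (ℚₚ.*-zeroˡ (q zero)) (sumFin-kron c l (q ∘ suc))) (ℚₚ.+-identityˡ _)

-- Interior integral points of a convex hull

module _ (S : List (Vec ℤ k)) where

  private
    N = length S
    v : Fin N → Fin k → ℤ
    v i = lookup (listLookup S i)

  -- The point q has the barycentric coordinates (cᵢ + Σⱼ aᵢⱼ qⱼ) / (M + 1), which stay
  -- nonnegative as long as |qⱼ| ≤ 1 / (R + 1).
  record AffineWeights (M R : ℕ) (c : Vec ℤ N) (a : Vec (Vec ℤ k) N) : Set where
    field
      Σc : Σℤ N (λ i → lookup c i * + 1) ≡ + suc M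
      Σa : ∀ j → Σℤ N (λ i → lookup (lookup a i) j * + 1) ≡ + 0
      Σcv : ∀ l → Σℤ N (λ i → lookup c i * v i l) ≡ + 0
      Σav : ∀ l j → Σℤ N (λ i → lookup (lookup a i) j * v i l) ≡ kron (+ suc M) l j
      bound : ∀ i → Σℤ k (λ j → + ℤ.∣ lookup (lookup a i) j ∣) ℤ.≤ + suc R * lookup c i

  affineWeights? : ∀ M R c a → Dec (AffineWeights M R c a)
  affineWeights? M R c a = map′
    (λ (p , q , r , s , t) → record { Σc = p ; Σa = q ; Σcv = r ; Σav = s ; bound = t })
    (λ W → let open AffineWeights W in Σc , Σa , Σcv , Σav , bound)
    ((_ ℤ.≟ _) ×-dec all? (λ _ → _ ℤ.≟ _) ×-dec all? (λ _ → _ ℤ.≟ _)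
      ×-dec all? (λ _ → all? (λ _ → _ ℤ.≟ _)) ×-dec all? (λ _ → _ ℤ.≤? _))

  origin-interior : ∀ {M R c a} → AffineWeights M R c a → InteriorPoint S (𝟎)
  origin-interior {M} {R} {c} {a} W = r , 0≤1/ R , λ q close → weight q , nonneg q close , total q , coordinate q
    where
    open AffineWeights W
    open ≡-Reasoning
    r = + 1 ℚ./ suc R
    s = + 1 ℚ./ suc M
    A : Fin N → Fin k → ℤ
    A i = lookup (lookup a i)
    affine : Vec ℚ k → Fin N → ℚ
    affine q i = ιℤ (lookup c i) ℚ.+ sumFin k (λ j → ιℤ (A i j) ℚ.* lookup q j)
    weight : Vec ℚ k → Fin N → ℚ
    weight q i = s ℚ.* affine q i

    -- The total weight (f = 1) and each coordinate (f = `v i l`) are both moments of the weights.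
    -- As the weights are affine in q, so is every moment, with the integer sums of the record as
    -- coefficients.
    moment : ∀ q (f : Fin N → ℤ) x (y : Fin k → ℤ) → Σℤ N (λ i → lookup c i * f i) ≡ x →
      (∀ j → Σℤ N (λ i → A i j * f i) ≡ y j) →
      sumFin N (λ i → weight q i ℚ.* ιℤ (f i)) ≡ s ℚ.* (ιℤ x ℚ.+ sumFin k (λ j → ιℤ (y j) ℚ.* lookup q j))
    moment q f x y ex ey = begin
      sumFin N (λ i → weight q i ℚ.* ιℤ (f i))
        ≡⟨ sumFin-cong N (λ i → solve 4 (λ s c b f → s :* (c :+ b) :* f := s :* (c :* f :+ f :* b)) refl s (ιℤ (lookup c i)) _ (ιℤ (f i))) ⟩
      sumFin N (λ i → s ℚ.* (ιℤ (lookup c i) ℚ.* ιℤ (f i) ℚ.+ ιℤ (f i) ℚ.* sumFin k (λ j → ιℤ (A i j) ℚ.* lookup q j)))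
        ≡⟨ sumFin-* N s _ ⟩
      s ℚ.* sumFin N (λ i → ιℤ (lookup c i) ℚ.* ιℤ (f i) ℚ.+ ιℤ (f i) ℚ.* sumFin k (λ j → ιℤ (A i j) ℚ.* lookup q j))
        ≡⟨ cong (s ℚ.*_) (sumFin-+ N _ _) ⟩
      s ℚ.* (sumFin N (λ i → ιℤ (lookup c i) ℚ.* ιℤ (f i)) ℚ.+ sumFin N (λ i → ιℤ (f i) ℚ.* sumFin k (λ j → ιℤ (A i j) ℚ.* lookup q j)))
        ≡⟨ cong (s ℚ.*_) (cong₂ ℚ._+_ (trans (ι-Σ-* N (lookup c) f) (cong ιℤ ex)) (sumFin-bilinear N k (ιℤ ∘ f) (λ i j → ιℤ (A i j)) (lookup q))) ⟩
      s ℚ.* (ιℤ x ℚ.+ sumFin k (λ j → sumFin N (λ i → ιℤ (f i) ℚ.* ιℤ (A i j)) ℚ.* lookup q j))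
        ≡⟨ cong (λ u → s ℚ.* (ιℤ x ℚ.+ u)) (sumFin-cong k (λ j → cong (ℚ._* lookup q j)
             (trans (sumFin-cong N (λ i → ℚₚ.*-comm (ιℤ (f i)) (ιℤ (A i j)))) (trans (ι-Σ-* N (λ i → A i j) f) (cong ιℤ (ey j)))))) ⟩
      s ℚ.* (ιℤ x ℚ.+ sumFin k (λ j → ιℤ (y j) ℚ.* lookup q j)) ∎

    s*M : s ℚ.* ιℤ (+ suc M) ≡ 1ℚ
    s*M = trans (ℚₚ.*-comm s _) (ι-inverseʳ M)

    total : ∀ q → sumFin N (weight q) ≡ 1ℚ
    total q = begin
      sumFin N (weight q)
        ≡⟨ sumFin-cong N (λ i → sym (ℚₚ.*-identityʳ (weight q i))) ⟩
      sumFin N (λ i → weight q i ℚ.* 1ℚ)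
        ≡⟨ moment q (λ _ → + 1) (+ suc M) (λ _ → + 0) Σc Σa ⟩
      s ℚ.* (ιℤ (+ suc M) ℚ.+ sumFin k (λ j → 0ℚ ℚ.* lookup q j))
        ≡⟨ cong (λ u → s ℚ.* (ιℤ (+ suc M) ℚ.+ u)) (trans (sumFin-cong k (λ j → ℚₚ.*-zeroˡ (lookup q j))) (sumFin-0 k)) ⟩
      s ℚ.* (ιℤ (+ suc M) ℚ.+ 0ℚ)
        ≡⟨ cong (s ℚ.*_) (ℚₚ.+-identityʳ _) ⟩
      s ℚ.* ιℤ (+ suc M)
        ≡⟨ s*M ⟩
      1ℚ ∎

    coordinate : ∀ q l → sumFin N (λ i → weight q i ℚ.* ιℤ (v i l)) ≡ lookup q l
    coordinate q l = begin
      sumFin N (λ i → weight q i ℚ.* ιℤ (v i l))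
        ≡⟨ moment q (λ i → v i l) (+ 0) (kron (+ suc M) l) (Σcv l) (Σav l) ⟩
      s ℚ.* (0ℚ ℚ.+ sumFin k (λ j → ιℤ (kron (+ suc M) l j) ℚ.* lookup q j))
        ≡⟨ cong (s ℚ.*_) (trans (ℚₚ.+-identityˡ _) (sumFin-kron (+ suc M) l (lookup q))) ⟩
      s ℚ.* (ιℤ (+ suc M) ℚ.* lookup q l)
        ≡⟨ ℚₚ.*-assoc s _ _ ⟨
      s ℚ.* ιℤ (+ suc M) ℚ.* lookup q l
        ≡⟨ cong (ℚ._* lookup q l) s*M ⟩
      1ℚ ℚ.* lookup q l
        ≡⟨ ℚₚ.*-identityˡ _ ⟩
      lookup q l ∎

    -- For |qⱼ| ≤ r each |aᵢⱼ| r + aᵢⱼ qⱼ is nonnegative. Summing over j and using Σⱼ |aᵢⱼ| r ≤ cᵢ,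
    -- which is `bound` for r = 1 / (R + 1), shows that cᵢ + Σⱼ aᵢⱼ qⱼ is nonnegative.
    nonneg : ∀ q → (∀ j → ℚ.∣ lookup q j ℚ.- ιℤ (lookup (𝟎) j) ∣ ℚ.≤ r) → ∀ i → 0ℚ ℚ.≤ weight q i
    nonneg q close i = 0≤* s (affine q i) (ℚₚ.<⇒≤ (0≤1/ M)) (ℚₚ.≤-trans
      (ℚₚ.≤-trans (ℚₚ.≤-reflexive (sym (sumFin-0 k))) (sumFin-mono k (λ j → 0≤∣a∣r+ax (A i j) (lookup q j) (small j))))
      (ℚₚ.≤-trans (ℚₚ.≤-reflexive split) (ℚₚ.+-mono-≤ dominated ℚₚ.≤-refl)))
      where
      ‖A‖ = Σℤ k (λ j → + ℤ.∣ A i j ∣)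
      small : ∀ j → ℚ.∣ lookup q j ∣ ℚ.≤ r
      small j = subst (λ u → ℚ.∣ u ∣ ℚ.≤ r) (trans (cong (λ u → lookup q j ℚ.- ιℤ u) (lookup-replicate j (+ 0))) (ℚₚ.+-identityʳ _)) (close j)
      split : sumFin k (λ j → ιℤ (+ ℤ.∣ A i j ∣) ℚ.* r ℚ.+ ιℤ (A i j) ℚ.* lookup q j) ≡
        ιℤ ‖A‖ ℚ.* r ℚ.+ sumFin k (λ j → ιℤ (A i j) ℚ.* lookup q j)
      split = trans (sumFin-+ k _ _) (cong (ℚ._+ sumFin k (λ j → ιℤ (A i j) ℚ.* lookup q j))
        (trans (sumFin-cong k (λ j → ℚₚ.*-comm _ r)) (trans (sumFin-* k r _)
          (trans (ℚₚ.*-comm r _) (cong (ℚ._* r) (sym (ι-Σ k _)))))))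
      dominated : ιℤ ‖A‖ ℚ.* r ℚ.≤ ιℤ (lookup c i)
      dominated = ℚₚ.≤-trans (ℚₚ.*-monoʳ-≤-nonNeg r {{ℚ.nonNegative (ℚₚ.<⇒≤ (0≤1/ R))}} (ι-mono-≤ (bound i)))
        (ℚₚ.≤-reflexive (/suc-unique R (lookup c i) _ refl))

  -- Nonnegative combinations of functionals that are at most 1 on S give all ± xₗ, so that
  -- an interior integral point, where these functionals are < 1 and hence ≤ 0, vanishes.
  record DualPoints {m} (ℓ : Vec (Vec ℤ k) m) (y⁺ y⁻ : Vec (Vec ℕ m) k) : Set where
    field
      ℓ≢0 : ∀ f → + 0 ℤ.< Σℤ k (λ j → + ℤ.∣ lookup (lookup ℓ f) j ∣)
      ℓ≤1 : ∀ f i → Σℤ k (λ j → lookup (lookup ℓ f) j * v i j) ℤ.≤ + 1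
      cone⁺ : ∀ l j → Σℤ m (λ f → + lookup (lookup y⁺ l) f * lookup (lookup ℓ f) j) ≡ kron (+ 1) l j
      cone⁻ : ∀ l j → Σℤ m (λ f → + lookup (lookup y⁻ l) f * lookup (lookup ℓ f) j) ≡ kron -[1+ 0 ] l j

  dualPoints? : ∀ {m} (ℓ : Vec (Vec ℤ k) m) y⁺ y⁻ → Dec (DualPoints ℓ y⁺ y⁻)
  dualPoints? ℓ y⁺ y⁻ = map′
    (λ (p , q , r , s) → record { ℓ≢0 = p ; ℓ≤1 = q ; cone⁺ = r ; cone⁻ = s })
    (λ W → let open DualPoints W in ℓ≢0 , ℓ≤1 , cone⁺ , cone⁻)
    (all? (λ _ → _ ℤ.<? _) ×-dec all? (λ _ → all? (λ _ → _ ℤ.≤? _))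
      ×-dec all? (λ _ → all? (λ _ → _ ℤ.≟ _)) ×-dec all? (λ _ → all? (λ _ → _ ℤ.≟ _)))

  -- At a point of the hull a linear functional is the weighted mean of its values on S.
  hull-bound : ∀ (ℓ : Fin k → ℤ) h → (∀ i → Σℤ k (λ j → ℓ j * v i j) ℤ.≤ h) →
    ∀ q → InConvexHull S q → sumFin k (λ j → ιℤ (ℓ j) ℚ.* lookup q j) ℚ.≤ ιℤ h
  hull-bound ℓ h ℓ≤h q (w , 0≤w , Σw , Σwv) = begin
    sumFin k (λ j → ιℤ (ℓ j) ℚ.* lookup q j)
      ≡⟨ sumFin-cong k (λ j → cong (ιℤ (ℓ j) ℚ.*_) (trans (sym (Σwv j)) (sumFin-cong N (λ i → ℚₚ.*-comm (w i) _)))) ⟩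
    sumFin k (λ j → ιℤ (ℓ j) ℚ.* sumFin N (λ i → ιℤ (v i j) ℚ.* w i))
      ≡⟨ sumFin-bilinear k N (ιℤ ∘ ℓ) (λ j i → ιℤ (v i j)) w ⟩
    sumFin N (λ i → sumFin k (λ j → ιℤ (ℓ j) ℚ.* ιℤ (v i j)) ℚ.* w i)
      ≡⟨ sumFin-cong N (λ i → cong (ℚ._* w i) (ι-Σ-* k ℓ (v i))) ⟩
    sumFin N (λ i → ιℤ (Σℤ k (λ j → ℓ j * v i j)) ℚ.* w i)
      ≤⟨ sumFin-mono N (λ i → ℚₚ.*-monoʳ-≤-nonNeg (w i) {{ℚ.nonNegative (0≤w i)}} (ι-mono-≤ (ℓ≤h i))) ⟩
    sumFin N (λ i → ιℤ h ℚ.* w i)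
      ≡⟨ sumFin-* N (ιℤ h) w ⟩
    ιℤ h ℚ.* sumFin N w
      ≡⟨ cong (ιℤ h ℚ.*_) Σw ⟩
    ιℤ h ℚ.* 1ℚ
      ≡⟨ ℚₚ.*-identityʳ _ ⟩
    ιℤ h ∎
    where open ℚₚ.≤-Reasoning

  signℤ : ℤ → ℤ
  signℤ (+ 0) = + 0
  signℤ (+ suc _) = + 1
  signℤ -[1+ _ ] = -[1+ 0 ]

  ℓ*sign : ∀ x → x * signℤ x ≡ + ℤ.∣ x ∣
  ℓ*sign (+ 0) = refl
  ℓ*sign (+ suc x) = ℤₚ.*-identityʳ _
  ℓ*sign -[1+ x ] = cong (λ u → + suc u) (ℕₚ.*-identityʳ x)

  -- Moving p by r along the sign vector of ℓ stays in the sup-norm neighbourhood and raises ℓ by r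
  -- times the sum of the |ℓⱼ|. This is positive since ℓ is nonzero, so ℓ is below its bound already
  -- at p.
  interior-bound : ∀ (ℓ : Fin k → ℤ) h → (∀ i → Σℤ k (λ j → ℓ j * v i j) ℤ.≤ h) →
    + 0 ℤ.< Σℤ k (λ j → + ℤ.∣ ℓ j ∣) →
    ∀ p → InteriorPoint S p → Σℤ k (λ j → ℓ j * lookup p j) ℤ.< h
  interior-bound ℓ h ℓ≤h ℓ≢0 p (r , 0<r , inHull) = ι-cancel-< (begin-strict
    ιℤ (Σℤ k (λ j → ℓ j * lookup p j))
      ≡⟨ ℚₚ.+-identityʳ _ ⟨
    ιℤ (Σℤ k (λ j → ℓ j * lookup p j)) ℚ.+ 0ℚ
      <⟨ ℚₚ.+-monoʳ-< (ιℤ (Σℤ k (λ j → ℓ j * lookup p j))) 0<r‖ℓ‖ ⟩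
    ιℤ (Σℤ k (λ j → ℓ j * lookup p j)) ℚ.+ r ℚ.* ιℤ ‖ℓ‖
      ≡⟨ moved ⟨
    sumFin k (λ j → ιℤ (ℓ j) ℚ.* lookup q j)
      ≤⟨ hull-bound ℓ h ℓ≤h q (inHull q close) ⟩
    ιℤ h ∎)
    where
    open ℚₚ.≤-Reasoning
    ‖ℓ‖ = Σℤ k (λ j → + ℤ.∣ ℓ j ∣)
    q : Vec ℚ k
    q = tabulate (λ j → ιℤ (lookup p j) ℚ.+ r ℚ.* ιℤ (signℤ (ℓ j)))
    q≡ : ∀ j → lookup q j ≡ ιℤ (lookup p j) ℚ.+ r ℚ.* ιℤ (signℤ (ℓ j))
    q≡ = lookup∘tabulate _
    0<r‖ℓ‖ : 0ℚ ℚ.< r ℚ.* ιℤ ‖ℓ‖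
    0<r‖ℓ‖ = ℚₚ.positive⁻¹ (r ℚ.* ιℤ ‖ℓ‖) {{ℚₚ.pos*pos⇒pos r {{ℚ.positive 0<r}} (ιℤ ‖ℓ‖)
      {{ℚ.positive (ℚₚ.≰⇒> (λ ι≤0 → ℤₚ.<⇒≱ ℓ≢0 (ι-cancel-≤ {‖ℓ‖} {+ 0} ι≤0)))}}}}
    0≤r = ℚₚ.<⇒≤ 0<r
    sign-small : ∀ x → ℚ.∣ r ℚ.* ιℤ (signℤ x) ∣ ℚ.≤ r
    sign-small (+ 0) = subst (λ u → ℚ.∣ u ∣ ℚ.≤ r) (sym (ℚₚ.*-zeroʳ r)) 0≤r
    sign-small (+ suc _) = subst (λ u → ℚ.∣ u ∣ ℚ.≤ r) (sym (ℚₚ.*-identityʳ r)) (ℚₚ.≤-reflexive (ℚₚ.0≤p⇒∣p∣≡p 0≤r))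
    sign-small -[1+ _ ] = subst (λ u → ℚ.∣ u ∣ ℚ.≤ r)
      (trans (cong ℚ.-_ (sym (ℚₚ.*-identityʳ r))) (ℚₚ.neg-distribʳ-* r 1ℚ))
      (ℚₚ.≤-reflexive (trans (ℚₚ.∣-p∣≡∣p∣ r) (ℚₚ.0≤p⇒∣p∣≡p 0≤r)))
    close : ∀ j → ℚ.∣ lookup q j ℚ.- ιℤ (lookup p j) ∣ ℚ.≤ r
    close j = subst (λ u → ℚ.∣ u ∣ ℚ.≤ r)
      (sym (trans (cong (ℚ._- ιℤ (lookup p j)) (q≡ j)) (solve 2 (λ p x → p :+ x :- p := x) refl (ιℤ (lookup p j)) _)))
      (sign-small (ℓ j))
    moved : sumFin k (λ j → ιℤ (ℓ j) ℚ.* lookup q j) ≡ ιℤ (Σℤ k (λ j → ℓ j * lookup p j)) ℚ.+ r ℚ.* ιℤ ‖ℓ‖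
    moved = begin-equality
      sumFin k (λ j → ιℤ (ℓ j) ℚ.* lookup q j)
        ≡⟨ sumFin-cong k (λ j → trans (cong (ιℤ (ℓ j) ℚ.*_) (q≡ j))
             (solve 4 (λ l p r s → l :* (p :+ r :* s) := l :* p :+ r :* (l :* s)) refl (ιℤ (ℓ j)) (ιℤ (lookup p j)) r (ιℤ (signℤ (ℓ j))))) ⟩
      sumFin k (λ j → ιℤ (ℓ j) ℚ.* ιℤ (lookup p j) ℚ.+ r ℚ.* (ιℤ (ℓ j) ℚ.* ιℤ (signℤ (ℓ j))))
        ≡⟨ sumFin-+ k _ _ ⟩
      sumFin k (λ j → ιℤ (ℓ j) ℚ.* ιℤ (lookup p j)) ℚ.+ sumFin k (λ j → r ℚ.* (ιℤ (ℓ j) ℚ.* ιℤ (signℤ (ℓ j))))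
        ≡⟨ cong₂ ℚ._+_ (ι-Σ-* k ℓ (lookup p)) (trans (sumFin-* k r _) (cong (r ℚ.*_)
             (trans (sumFin-cong k (λ j → trans (sym (ι-* (ℓ j) (signℤ (ℓ j)))) (cong ιℤ (ℓ*sign (ℓ j))))) (sym (ι-Σ k _))))) ⟩
      ιℤ (Σℤ k (λ j → ℓ j * lookup p j)) ℚ.+ r ℚ.* ιℤ ‖ℓ‖ ∎

  interior-unique : ∀ {m} {ℓ : Vec (Vec ℤ k) m} {y⁺ y⁻} → DualPoints ℓ y⁺ y⁻ →
    ∀ p → InteriorPoint S p → p ≡ 𝟎
  interior-unique {m} {ℓ} {y⁺} {y⁻} W p p-interior = trans (sym (tabulate∘lookup p))
    (trans (tabulate-cong (λ l → trans (ℤₚ.≤-antisym (p≤0 l) (0≤p l)) (sym (lookup-replicate l (+ 0)))))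
      (tabulate∘lookup (𝟎)))
    where
    open DualPoints W
    L : Fin m → Fin k → ℤ
    L f = lookup (lookup ℓ f)
    Lp≤0 : ∀ f → Σℤ k (λ j → L f j * lookup p j) ℤ.≤ + 0
    -- Integrality of p enters here: an integer below 1 is at most 0.
    Lp≤0 f = ℤₚ.i<j⇒i≤pred[j] (interior-bound (L f) (+ 1) (ℓ≤1 f) (ℓ≢0 f) p p-interior)
    cone : ∀ (y : Fin m → ℕ) c l → (∀ j → Σℤ m (λ f → + y f * L f j) ≡ kron c l j) → c * lookup p l ℤ.≤ + 0
    cone y c l e = ι-cancel-≤ (begin
      ιℤ (c * lookup p l)
        ≡⟨ ι-* c (lookup p l) ⟩
      ιℤ c ℚ.* ιℤ (lookup p l)
        ≡⟨ sumFin-kron c l (ιℤ ∘ lookup p) ⟨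
      sumFin k (λ j → ιℤ (kron c l j) ℚ.* ιℤ (lookup p j))
        ≡⟨ sumFin-cong k (λ j → cong (ℚ._* ιℤ (lookup p j)) (trans (ι-Σ-* m (λ f → + y f) (λ f → L f j)) (cong ιℤ (e j)))) ⟨
      sumFin k (λ j → sumFin m (λ f → ιℤ (+ y f) ℚ.* ιℤ (L f j)) ℚ.* ιℤ (lookup p j))
        ≡⟨ sumFin-bilinear m k (λ f → ιℤ (+ y f)) (λ f j → ιℤ (L f j)) (ιℤ ∘ lookup p) ⟨
      sumFin m (λ f → ιℤ (+ y f) ℚ.* sumFin k (λ j → ιℤ (L f j) ℚ.* ιℤ (lookup p j)))
        ≤⟨ sumFin-mono m (λ f → ℚₚ.*-monoˡ-≤-nonNeg (ιℤ (+ y f)) {{ℚ.nonNegative (0≤ι (y f))}}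
             (ℚₚ.≤-trans (ℚₚ.≤-reflexive (ι-Σ-* k (L f) (lookup p))) (ι-mono-≤ (Lp≤0 f)))) ⟩
      sumFin m (λ f → ιℤ (+ y f) ℚ.* 0ℚ)
        ≡⟨ trans (sumFin-cong m (λ f → ℚₚ.*-zeroʳ (ιℤ (+ y f)))) (sumFin-0 m) ⟩
      0ℚ ∎)
      where open ℚₚ.≤-Reasoning
    p≤0 : ∀ l → lookup p l ℤ.≤ + 0
    p≤0 l = subst (ℤ._≤ + 0) (ℤₚ.*-identityˡ (lookup p l)) (cone (lookup (lookup y⁺ l)) (+ 1) l (cone⁺ l))
    0≤p : ∀ l → + 0 ℤ.≤ lookup p l
    0≤p l = ℤₚ.neg-cancel-≤ (subst (ℤ._≤ + 0) (ℤₚ.-1*i≡-i (lookup p l)) (cone (lookup (lookup y⁻ l)) -[1+ 0 ] l (cone⁻ l)))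

-- Deciding the conditions on factors and on the polytope

coeff-absent : ∀ {f : Laurent k} {a} → All (λ t → a ≢ proj₁ t) f → coeff f a ≡ + 0
coeff-absent [] = refl
coeff-absent {f = (b , c) ∷ f} {a} (a≢b ∷ absent) with ≡-dec ℤ._≟_ b a
... | yes b≡a = contradiction (sym b≡a) a≢b
... | no _ = coeff-absent absent

Unit : ℤ → Set
Unit c = (c ≡ - (+ 1)) ⊎ (c ≡ + 0) ⊎ (c ≡ + 1)

-- `Coeffs01` ranges over infinitely many exponents. If the listed exponents are distinct, no
-- coefficients are added up, and a finite, decidable inspection of the list implies it.
UnitTerms : Laurent k → Set
UnitTerms f = All (Unit ∘ proj₂) f × AllPairs (λ s t → proj₁ s ≢ proj₁ t) f

unitTerms? : (f : Laurent k) → Dec (UnitTerms f)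
unitTerms? f = All.all? (λ t → (proj₂ t ℤ.≟ _) ⊎-dec ((proj₂ t ℤ.≟ _) ⊎-dec (proj₂ t ℤ.≟ _))) f
  ×-dec allPairs? (λ s t → ¬? (≡-dec ℤ._≟_ (proj₁ s) (proj₁ t))) f

unitTerms⇒coeffs01 : ∀ {f : Laurent k} → UnitTerms f → Coeffs01 f
unitTerms⇒coeffs01 {f = []} _ a = inj₂ (inj₁ refl)
unitTerms⇒coeffs01 {f = (b , c) ∷ f} (u ∷ us , b≢ ∷ ≢s) a with ≡-dec ℤ._≟_ b a
... | yes refl = subst Unit (sym (trans (cong (λ x → c + x) (coeff-absent b≢)) (ℤₚ.+-identityʳ c))) u
... | no _ = unitTerms⇒coeffs01 (us , ≢s) a

-- The difference f - g is collected by the same trie as the residues. Its coefficients become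
-- constant polynomials, so the evaluation point + 0 is arbitrary.
≈L-normalize : ∀ (f g : Laurent k) → normalize (times (+ 1 ∷ []) f ++ times (- (+ 1) ∷ []) g) ≡ [] → f ≈L g
≈L-normalize f g e a = ℤₚ.i-j≡0⇒i≡j (coeff f a) (coeff g a) (begin
  coeff f a + - coeff g a
    ≡⟨ cong₂ (λ x y → x + - y) (coeff-pair f a) (coeff-pair g a) ⟩
  ⟨ δ[ a ] , f ⟩ + - ⟨ δ[ a ] , g ⟩
    ≡⟨ lemma ⟨ δ[ a ] , f ⟩ ⟨ δ[ a ] , g ⟩ ⟩
  + 1 * ⟨ δ[ a ] , f ⟩ + - (+ 1) * ⟨ δ[ a ] , g ⟩
    ≡⟨ cong₂ _+_ (pair-times (+ 0) δ[ a ] (+ 1 ∷ []) f) (pair-times (+ 0) δ[ a ] (- (+ 1) ∷ []) g) ⟨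
  ⟨ δ[ a ] , times (+ 1 ∷ []) f ⟩at (+ 0) + ⟨ δ[ a ] , times (- (+ 1) ∷ []) g ⟩at (+ 0)
    ≡⟨ pair-++ (eval (+ 0)) δ[ a ] (times (+ 1 ∷ []) f) _ ⟨
  ⟨ δ[ a ] , times (+ 1 ∷ []) f ++ times (- (+ 1) ∷ []) g ⟩at (+ 0)
    ≡⟨ pair-normalize (+ 0) δ[ a ] (times (+ 1 ∷ []) f ++ times (- (+ 1) ∷ []) g) ⟨
  ⟨ δ[ a ] , normalize (times (+ 1 ∷ []) f ++ times (- (+ 1) ∷ []) g) ⟩at (+ 0)
    ≡⟨ cong (λ t → ⟨ δ[ a ] , t ⟩at (+ 0)) e ⟩
  + 0 ∎)
  where
  open ≡-Reasoning
  lemma : ∀ x y → x + - y ≡ + 1 * x + - (+ 1) * y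
  lemma = solve-∀

Factorization : Laurent k → Set
Factorization {k} Λ = Σ (List (Laurent k)) λ fs → All Coeffs01 fs × (Λ ≈L productL fs)

factorization : (Λ : Laurent k) (fs : List (Laurent k)) → {True (All.all? unitTerms? fs)} →
  normalize (times (+ 1 ∷ []) Λ ++ times (- (+ 1) ∷ []) (productL fs)) ≡ [] → Factorization Λ
factorization Λ fs {units} e = fs , All.map unitTerms⇒coeffs01 (toWitness units) , ≈L-normalize Λ (productL fs) e

-- The equation says that no listed coefficient is zero or cancels. It is checked once, after which
-- both decision procedures run on the literal exponents instead of on the filtered list
-- `support Λ`.
originUniqueInteriorPoint : (Λ : Laurent k) → support Λ ≡ map proj₁ Λ →
  ∀ M R c a → {True (affineWeights? (map proj₁ Λ) M R c a)} →
  ∀ {m} (ℓ : Vec (Vec ℤ k) m) y⁺ y⁻ → {True (dualPoints? (map proj₁ Λ) ℓ y⁺ y⁻)} →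
  OriginUniqueInteriorPoint Λ
originUniqueInteriorPoint Λ e M R c a {W} ℓ y⁺ y⁻ {D} rewrite e =
  origin-interior (map proj₁ Λ) (toWitness W) , interior-unique (map proj₁ Λ) (toWitness D)

-- In the certificates the exponents i, j, l stand for i - 6, j - 6, l - 6.
at2 : (i j : ℕ) (a₀ a₁ b₀ b₁ : ℤ) → Vec ℤ 2 × Vec Poly 2
at2 i j a₀ a₁ b₀ b₁ = (i ⊖ 6) ∷ (j ⊖ 6) ∷ [] , (a₀ ∷ a₁ ∷ []) ∷ (b₀ ∷ b₁ ∷ []) ∷ []

at3 : (i j l : ℕ) (a₀ a₁ a₂ b₀ b₁ b₂ c₀ c₁ c₂ : ℤ) → Vec ℤ 3 × Vec Poly 3
at3 i j l a₀ a₁ a₂ b₀ b₁ b₂ c₀ c₁ c₂ = (i ⊖ 6) ∷ (j ⊖ 6) ∷ (l ⊖ 6) ∷ [] ,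
  (a₀ ∷ a₁ ∷ a₂ ∷ []) ∷ (b₀ ∷ b₁ ∷ b₂ ∷ []) ∷ (c₀ ∷ c₁ ∷ c₂ ∷ []) ∷ []

-- The certificates

o : ℤ
o = + 0

~_ : ℕ → ℤ
~ n = - (+ n)

-- The recurrence has degree 2 in m and the Rᵢ enter with the factor m + 1, hence coefficients of
-- degree 1. For the third-order recurrences the degrees are 3 and 2.
certificate-𝐀 : Cert 2
certificate-𝐀 =
  at2 4 6 (+ 3) (+ 1) o o ∷ at2 4 7 (+ 6) (+ 2) o o ∷ at2 4 8 (+ 3) (+ 1) o o ∷
  at2 5 5 (+ 8) (+ 3) (+ 5) (+ 2) ∷ at2 5 6 (+ 12) (+ 4) (+ 12) (+ 5) ∷
  at2 5 7 (+ 14) (+ 5) (+ 2) (+ 1) ∷ at2 5 8 (+ 3) (+ 1) (~ 5) (~ 2) ∷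
  at2 6 4 (+ 3) (+ 1) (+ 3) (+ 1) ∷ at2 6 5 (+ 1) o (+ 14) (+ 6) ∷ at2 6 6 (~ 1) (~ 1) o o ∷
  at2 6 7 (+ 1) o (~ 14) (~ 6) ∷ at2 6 8 o o (~ 3) (~ 1) ∷ at2 7 4 o o (+ 7) (+ 3) ∷
  at2 7 5 (~ 13) (~ 5) o o ∷ at2 7 6 (~ 13) (~ 5) (~ 14) (~ 6) ∷
  at2 7 7 (~ 7) (~ 3) (~ 7) (~ 3) ∷ at2 8 4 (~ 3) (~ 1) o o ∷ at2 8 5 (~ 6) (~ 2) o o ∷
  at2 8 6 (~ 3) (~ 1) o o ∷ []

-- All exponents lie in the sublattice of index 3 where both coordinates agree modulo 3. It is
-- spanned by the support of Λ, and this keeps the list short.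
certificate-𝐁 : Cert 2
certificate-𝐁 =
  at2 4 4 o o (+ 3) (+ 1) ∷ at2 4 7 (+ 9) (+ 4) (+ 3) (+ 1) ∷ at2 4 10 (+ 3) (+ 1) o o ∷
  at2 5 5 o o (~ 3) o ∷ at2 5 8 (~ 3) o o o ∷ at2 7 4 o o (+ 6) (+ 2) ∷
  at2 7 7 (~ 9) (~ 5) (~ 9) (~ 5) ∷ at2 8 5 o o (~ 3) o ∷ at2 10 4 o o (+ 3) (+ 1) ∷ []

certificate-𝐂 : Cert 2
certificate-𝐂 =
  at2 4 6 (+ 3) (+ 1) (+ 3) (+ 1) ∷ at2 4 7 (+ 7) (+ 3) o o ∷ at2 4 8 o o (~ 3) (~ 1) ∷
  at2 5 5 (+ 5) (+ 2) (+ 8) (+ 3) ∷ at2 5 6 (+ 15) (+ 6) (+ 2) o ∷ at2 5 7 o o (~ 14) (~ 5) ∷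
  at2 5 8 o o (~ 6) (~ 2) ∷ at2 6 4 o o (+ 3) (+ 1) ∷ at2 6 5 (+ 12) (+ 5) (+ 13) (+ 4) ∷
  at2 6 7 (~ 12) (~ 5) (~ 13) (~ 4) ∷ at2 6 8 o o (~ 3) (~ 1) ∷ at2 7 4 o o (+ 6) (+ 2) ∷
  at2 7 5 o o (+ 14) (+ 5) ∷ at2 7 6 (~ 15) (~ 6) (~ 2) o ∷ at2 7 7 (~ 5) (~ 2) (~ 8) (~ 3) ∷
  at2 8 4 o o (+ 3) (+ 1) ∷ at2 8 5 (~ 7) (~ 3) o o ∷ at2 8 6 (~ 3) (~ 1) (~ 3) (~ 1) ∷ []

certificate-𝐃 : Cert 2
certificate-𝐃 =
  at2 4 4 o o (+ 3) (+ 1) ∷ at2 4 5 (+ 10) (+ 4) (+ 6) (+ 2) ∷ at2 4 6 (+ 20) (+ 8) o o ∷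
  at2 4 7 (+ 10) (+ 4) (~ 6) (~ 2) ∷ at2 4 8 o o (~ 3) (~ 1) ∷ at2 5 4 o o (+ 12) (+ 4) ∷
  at2 5 5 o o (+ 49) (+ 18) ∷ at2 5 6 (+ 36) (+ 14) (+ 56) (+ 22) ∷
  at2 5 7 (+ 36) (+ 14) (+ 13) (+ 6) ∷ at2 5 8 o o (~ 6) (~ 2) ∷
  at2 6 4 (+ 3) (+ 1) (+ 17) (+ 5) ∷ at2 6 5 (~ 29) (~ 12) (+ 29) (+ 7) ∷
  at2 6 6 (+ 6) (+ 1) (+ 2) (~ 3) ∷ at2 6 7 (+ 15) (+ 5) (~ 13) (~ 6) ∷
  at2 6 8 o o (~ 3) (~ 1) ∷ at2 7 4 (+ 6) (+ 2) (+ 14) (+ 4) ∷ at2 7 5 (~ 19) (~ 8) o (~ 4) ∷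
  at2 7 6 (~ 13) (~ 6) (~ 19) (~ 11) ∷ at2 7 7 (~ 11) (~ 5) (~ 5) (~ 3) ∷
  at2 8 4 (+ 3) (+ 1) (+ 6) (+ 2) ∷ at2 8 5 o o (+ 12) (+ 4) ∷
  at2 8 6 (~ 3) (~ 1) (+ 6) (+ 2) ∷ []

-- Here the exponents stay in the sublattice where both coordinates have the same parity, as those
-- of Λ do.
certificate-𝐄 : Cert 2
certificate-𝐄 =
  at2 4 4 o o (+ 3) (+ 1) ∷ at2 4 6 (~ 8) (~ 4) o o ∷ at2 4 8 o o (~ 3) (~ 1) ∷
  at2 5 5 (~ 4) o (+ 8) o ∷ at2 5 7 (~ 4) o o o ∷ at2 6 4 o o (~ 6) (~ 2) ∷
  at2 6 8 o o (+ 6) (+ 2) ∷ at2 7 5 (+ 4) o o o ∷ at2 7 7 (+ 4) o (~ 8) o ∷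
  at2 8 4 o o (+ 3) (+ 1) ∷ at2 8 6 (+ 8) (+ 4) o o ∷ at2 8 8 o o (~ 3) (~ 1) ∷ []

certificate-𝐅 : Cert 2
certificate-𝐅 =
  at2 4 6 (+ 3) (+ 1) (+ 15) (+ 5) ∷ at2 4 7 (+ 6) (+ 7) (~ 15) (~ 5) ∷
  at2 4 8 (~ 27) (~ 9) (~ 30) (~ 10) ∷ at2 5 5 (~ 3) (~ 2) (+ 12) (+ 3) ∷
  at2 5 6 (+ 15) (+ 15) (~ 111) (~ 4) ∷ at2 5 8 o o (+ 3) (+ 7) ∷ at2 6 4 o o (+ 3) (+ 1) ∷
  at2 6 5 (+ 75) (+ 5) o o ∷ at2 6 6 o o (+ 5) (+ 5) ∷ at2 6 7 (~ 146) (~ 9) (+ 5) (+ 5) ∷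
  at2 6 8 (+ 27) (+ 9) (~ 3) (~ 1) ∷ at2 7 4 o o (+ 6) (+ 2) ∷
  at2 7 5 (+ 71) (+ 4) (+ 76) (+ 9) ∷ at2 7 6 (~ 15) (~ 15) (+ 60) (~ 5) ∷
  at2 7 7 (+ 4) (~ 2) (~ 26) (~ 12) ∷ at2 8 4 o o (+ 3) (+ 1) ∷ at2 8 5 (~ 7) (~ 3) o o ∷
  at2 8 6 (~ 3) (~ 1) (~ 3) (~ 1) ∷ []

-- Only even powers of y occur, as in Λ. The variable is not renamed because the factors of Λ
-- involve y itself.
certificate-𝐅-factored : Cert 2
certificate-𝐅-factored =
  at2 2 2 (+ 48) (+ 16) (~ 42) (~ 14) ∷ at2 2 4 (~ 72) (~ 18) (+ 114) (+ 38) ∷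
  at2 2 6 (+ 8) (~ 16) (~ 60) (~ 20) ∷ at2 2 8 (~ 32) (+ 2) (~ 54) (~ 18) ∷
  at2 2 10 (+ 48) (+ 16) (+ 42) (+ 14) ∷ at2 3 2 o o (~ 20) (~ 12) ∷
  at2 3 4 o (+ 14) (+ 92) (+ 39) ∷ at2 3 6 o o (~ 184) (~ 64) ∷
  at2 3 8 (+ 40) (+ 6) (+ 132) (+ 49) ∷ at2 3 10 o o (~ 20) (~ 12) ∷
  at2 4 2 (~ 72) (~ 24) (+ 18) (~ 2) ∷ at2 4 4 (~ 120) (+ 26) (+ 182) (+ 20) ∷
  at2 4 6 (~ 64) (~ 48) (~ 196) o ∷ at2 4 8 (~ 24) (+ 6) (~ 66) (~ 20) ∷
  at2 4 10 (~ 72) (~ 24) (~ 18) (+ 2) ∷ at2 5 2 (~ 36) (~ 12) (+ 46) (+ 24) ∷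
  at2 5 4 (~ 64) (~ 18) (~ 18) (~ 25) ∷ at2 5 6 o o (+ 4) (~ 8) ∷
  at2 5 8 (+ 160) (~ 2) (+ 50) (~ 15) ∷ at2 5 10 (+ 36) (+ 12) (+ 46) (+ 24) ∷
  at2 6 2 (+ 36) (+ 12) o (+ 4) ∷ at2 6 4 o (~ 8) (+ 16) o ∷ at2 6 6 (+ 32) (+ 56) o o ∷
  at2 6 8 (~ 136) (~ 8) (~ 16) o ∷ at2 6 10 (+ 36) (+ 12) o (~ 4) ∷
  at2 7 2 (+ 36) (+ 12) (~ 2) o ∷ at2 7 4 (~ 32) (+ 4) (~ 34) o ∷ at2 7 6 o o (+ 4) o ∷
  at2 7 8 (~ 104) (~ 4) (+ 34) o ∷ at2 7 10 (~ 36) (~ 12) (~ 2) o ∷ at2 8 2 (~ 12) (~ 4) o o ∷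
  at2 8 6 (+ 24) (+ 8) o o ∷ at2 8 10 (~ 12) (~ 4) o o ∷ []

certificate-δ : Cert 3
certificate-δ =
  at3 4 4 6 (~ 648) (~ 100) o (+ 720) (+ 148) (+ 8) (~ 216) (~ 96) (~ 8) ∷
  at3 4 4 7 o (~ 280) o o (+ 280) o o o o ∷ at3 4 4 8 o (+ 9260) o o (~ 9196) o o o o ∷
  at3 4 4 10 (~ 432) (~ 192) (~ 16) (+ 936) (+ 432) (+ 40) (+ 216) (+ 96) (+ 8) ∷
  at3 4 5 5 (+ 120) (+ 68) (+ 24) (+ 792) (+ 248) (+ 8) (~ 576) o o ∷
  at3 4 5 6 o (~ 280) o o (+ 560) o o (+ 280) o ∷
  at3 4 5 7 (+ 3780) (+ 8000) (+ 496) (~ 4572) (~ 17744) (~ 512) (+ 972) (~ 4360) (+ 8) ∷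
  at3 4 5 8 (+ 2856) (+ 956) (~ 136) (~ 3528) (~ 1008) (+ 144) (+ 396) (~ 108) (+ 8) ∷
  at3 4 5 10 (~ 456) (~ 9432) (~ 16) o (~ 120) (~ 40) o (~ 4532) o ∷
  at3 4 6 4 (+ 504) (+ 52) (+ 8) o o (~ 8) (~ 432) (~ 4) o ∷
  at3 4 6 6 o o o (~ 5904) (~ 4228) (~ 528) (~ 11808) (~ 3960) (~ 136) ∷
  at3 4 6 7 (~ 3696) (~ 2384) (~ 188) (+ 1584) (+ 2136) (+ 340) (~ 4428) (~ 1480) (~ 180) ∷
  at3 4 6 8 (+ 9672) (+ 3648) (~ 112) (+ 4320) (+ 1044) (~ 144) (+ 7812) (+ 1868) (~ 32) ∷
  at3 4 6 9 o (~ 768) o o (~ 256) o o (~ 512) o ∷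
  at3 4 6 10 (+ 72) (+ 256) (~ 16) (~ 936) (~ 312) o o (+ 104) (~ 12) ∷
  at3 4 7 5 (+ 6792) (+ 3746) (+ 104) (~ 792) (~ 518) (~ 16) (~ 11376) (~ 4818) (~ 160) ∷
  at3 4 7 6 (+ 2544) (+ 932) (+ 355) (+ 5184) (+ 1111) (~ 11) (~ 4752) (~ 5061) (~ 561) ∷
  at3 4 7 7 (+ 5196) (+ 18150) (+ 205) (+ 2988) (+ 16787) (+ 395) (+ 3744) (+ 16150) (+ 184) ∷
  at3 4 7 8 (~ 3648) (+ 22692) (+ 844) (~ 2160) (+ 11470) (+ 398) (~ 2880) (+ 16649) (+ 585) ∷
  at3 4 7 9 o (+ 512) o o (+ 256) o o (+ 256) o ∷
  at3 4 8 4 (~ 1008) (+ 284) o o o (+ 16) (+ 864) (~ 380) o ∷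
  at3 4 8 5 o (+ 1020) (+ 158) o (+ 370) (+ 8) o (~ 1030) (~ 158) ∷
  at3 4 8 6 (+ 528) (+ 2926) (+ 672) o (+ 2257) (+ 531) (~ 1584) (+ 1544) (+ 248) ∷
  at3 4 8 7 (~ 240) (~ 1530) (~ 44) o (~ 1459) (~ 223) (~ 720) (~ 864) (+ 4) ∷
  at3 4 8 8 (+ 1392) (~ 5324) (~ 844) (+ 1368) (~ 2310) (~ 398) o (~ 3058) (~ 402) ∷
  at3 4 9 4 o (~ 256) o o o o o (+ 256) o ∷ at3 4 9 5 o (~ 256) o o o o o (+ 512) o ∷
  at3 4 9 6 o o o o o o o (+ 256) o ∷
  at3 4 10 4 (+ 504) (~ 52) (+ 8) o o (~ 8) (~ 432) (+ 100) (~ 16) ∷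
  at3 4 10 5 o (~ 556) o o (~ 100) o o (+ 584) o ∷
  at3 4 10 6 (+ 72) (+ 352) (+ 8) o (+ 152) o (+ 432) (+ 484) (+ 16) ∷
  at3 5 4 5 o o o o (~ 84) (~ 24) o (+ 256) (+ 8) ∷
  at3 5 4 6 o (+ 560) o o (~ 280) o o (+ 460) o ∷
  at3 5 4 7 o (~ 15544) (~ 56) o (+ 6040) (+ 64) (~ 1296) (~ 4688) (+ 16) ∷
  at3 5 4 8 o (~ 1512) (~ 96) (~ 864) (+ 564) (+ 96) (~ 972) (~ 308) (~ 24) ∷
  at3 5 4 9 (+ 2820) (+ 184) o (+ 1900) (~ 184) o (+ 2268) o o ∷
  at3 5 4 10 o o o o (+ 8624) o o (+ 4280) o ∷
  at3 5 5 4 o (+ 32) (~ 28) o (~ 272) (~ 20) (~ 312) (~ 156) (~ 4) ∷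
  at3 5 5 5 o (+ 3179) o o (~ 3359) o o (+ 180) o ∷
  at3 5 5 6 o (~ 5452) (~ 624) o (+ 5012) (+ 208) (+ 10648) (~ 1712) (~ 248) ∷
  at3 5 5 7 (~ 28396) (~ 5419) (+ 176) (+ 26064) (+ 5691) (+ 104) (~ 1280) (+ 1472) (+ 428) ∷
  at3 5 5 8 (~ 24616) (+ 2898) o o (~ 458) o (~ 11660) (+ 1856) o ∷
  at3 5 5 9 (+ 2876) (+ 2570) (~ 248) (~ 2856) (+ 270) (+ 248) (+ 388) (+ 1328) o ∷
  at3 5 5 10 (+ 312) (+ 992) o (~ 1056) o (+ 8) (~ 312) (+ 152) o ∷
  at3 5 6 4 o o o o (~ 3359) o o o o ∷
  at3 5 6 5 (~ 11924) (~ 974) (+ 40) (~ 11252) (+ 678) (+ 248) (+ 7820) (~ 2994) (+ 120) ∷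
  at3 5 6 6 (+ 900) (+ 796) (~ 104) (+ 21464) o (~ 336) (+ 12036) (+ 1946) (+ 136) ∷
  at3 5 6 7 (+ 19148) (+ 3344) (~ 168) (~ 4132) (~ 1017) (~ 40) (+ 17324) (+ 1704) (+ 16) ∷
  at3 5 6 8 (+ 10952) (~ 7440) o (~ 5088) (~ 1802) o (+ 6136) (~ 3048) o ∷
  at3 5 6 9 o (+ 768) o (+ 956) (+ 426) (~ 248) o (+ 256) o ∷
  at3 5 7 4 o o (~ 204) o (~ 832) (+ 12) (+ 312) o (+ 276) ∷
  at3 5 7 5 (~ 11388) (~ 1738) (~ 265) (~ 4160) (~ 2750) (~ 291) (+ 8412) (+ 317) (+ 119) ∷
  at3 5 7 6 (~ 14600) (~ 1562) (~ 77) (~ 16148) (~ 3185) (~ 152) (~ 4304) (~ 3144) (~ 37) ∷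
  at3 5 7 7 (~ 36532) (+ 6504) (~ 132) (~ 17752) o (~ 247) (~ 20192) (+ 4850) (~ 127) ∷
  at3 5 7 8 o (~ 7092) (~ 836) (~ 216) (~ 3286) (~ 390) o (~ 2035) (~ 183) ∷
  at3 5 8 4 o (+ 7570) o (+ 264) (+ 3345) (~ 8) (~ 136) (~ 776) (~ 8) ∷
  at3 5 8 5 (+ 29904) o (~ 248) (+ 6916) (~ 23) (~ 227) (~ 16128) o (~ 128) ∷
  at3 5 8 6 (~ 8456) (+ 8) (+ 864) (~ 4068) o (+ 280) (~ 14560) (+ 1948) (+ 224) ∷
  at3 5 8 7 (~ 3024) (~ 4926) (~ 212) (~ 1660) (~ 1617) (+ 111) (~ 728) (~ 2746) (~ 336) ∷
  at3 5 9 4 o (+ 458) (~ 40) o (+ 1090) o o (+ 1426) (+ 40) ∷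
  at3 5 9 5 (+ 1008) (+ 1952) o o (+ 1090) o (~ 1008) (+ 1358) (+ 40) ∷
  at3 5 9 6 o o o o o o (~ 1008) (~ 68) o ∷
  at3 5 10 4 o (~ 368) (+ 40) (~ 264) o o (~ 216) (+ 436) (~ 16) ∷
  at3 5 10 5 o (~ 12) (+ 8) o o o (+ 72) (~ 36) o ∷
  at3 6 4 4 o (~ 24) o (+ 504) (+ 332) (+ 8) (~ 432) (~ 284) o ∷
  at3 6 4 5 o (~ 356) o o (+ 536) o o (~ 1072) o ∷
  at3 6 4 6 o (+ 1556) (~ 24) (+ 288) (+ 376) (+ 88) (~ 2472) (~ 964) (~ 136) ∷
  at3 6 4 7 (~ 1884) (+ 2600) (+ 160) (+ 536) (+ 608) (~ 96) (+ 2640) (+ 2888) (+ 40) ∷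
  at3 6 4 8 (+ 2472) (+ 1672) (+ 112) (+ 5272) (+ 3124) (+ 224) (+ 4248) (+ 1972) (+ 96) ∷
  at3 6 4 9 (~ 2820) (~ 720) o (~ 6640) (~ 4264) o (~ 3984) (~ 2400) o ∷
  at3 6 4 10 (+ 432) (+ 192) (+ 16) (+ 72) (~ 232) (+ 8) o (~ 140) o ∷
  at3 6 5 4 o (~ 2823) o o (+ 1072) o o (~ 536) o ∷
  at3 6 5 5 (+ 1192) (~ 552) (+ 40) (+ 10736) (+ 2244) o (~ 9832) (~ 1316) o ∷
  at3 6 5 6 (+ 22768) (~ 356) o (+ 60) (+ 380) (+ 320) (+ 13344) o (~ 152) ∷
  at3 6 5 7 (+ 19056) (+ 4505) (+ 40) (~ 3880) o (~ 128) (~ 3076) (+ 1084) (+ 152) ∷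
  at3 6 5 8 (+ 19264) (~ 5106) o (~ 1656) (~ 776) o (~ 452) o o ∷
  at3 6 5 9 (~ 956) (+ 1158) (+ 248) o (+ 1608) o o (+ 536) o ∷
  at3 6 6 4 (~ 84) (~ 1336) (+ 248) (~ 684) (+ 576) o (~ 308) (~ 308) o ∷
  at3 6 6 5 (+ 9600) (+ 130) (+ 80) (~ 9540) (+ 1956) (~ 128) (~ 1832) (~ 2040) (~ 208) ∷
  at3 6 6 6 (~ 16) (~ 112) (~ 96) (~ 696) (~ 376) (+ 320) (+ 1248) (+ 1208) (~ 40) ∷
  at3 6 6 7 (~ 16892) (~ 2116) (+ 160) (+ 5912) (~ 692) (+ 160) (~ 620) (~ 292) (+ 328) ∷
  at3 6 6 8 (+ 1096) (+ 432) o (~ 272) (~ 916) (~ 80) (+ 328) (+ 328) o ∷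
  at3 6 7 4 (~ 996) (~ 2574) (~ 128) (~ 264) (~ 436) (+ 148) (+ 140) (+ 112) (+ 196) ∷
  at3 6 7 5 (~ 22376) (~ 4338) (~ 128) (~ 9920) (~ 2166) (~ 69) (~ 12328) (~ 4732) (~ 227) ∷
  at3 6 7 6 (~ 19736) (~ 4642) (~ 515) (~ 1308) (~ 1655) (~ 347) (~ 8784) (~ 2272) (~ 456) ∷
  at3 6 7 7 (~ 2856) (~ 6190) (~ 473) (~ 432) (~ 823) (+ 86) (~ 552) (~ 140) (+ 63) ∷
  at3 6 8 4 (~ 408) (+ 5846) (~ 16) (+ 348) (~ 12) (+ 136) (+ 488) (+ 296) (+ 304) ∷
  at3 6 8 5 (+ 29496) (~ 6326) o (+ 9764) (~ 2290) (+ 59) (+ 19408) (~ 4794) o ∷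
  at3 6 8 6 (~ 2816) (~ 222) (+ 336) (+ 56) (~ 43) (~ 99) (+ 8) (~ 778) (~ 160) ∷
  at3 6 9 4 o (+ 714) (~ 40) o o o o o o ∷ at3 6 9 5 (+ 1008) (+ 68) o o o o o o o ∷
  at3 6 10 4 (~ 504) (~ 316) (+ 32) (~ 432) (~ 260) (+ 4) (~ 792) (~ 472) (+ 16) ∷
  at3 7 4 4 o o o o (~ 536) o o (+ 536) o ∷
  at3 7 4 5 o (+ 436) (~ 144) (~ 2080) (~ 936) (+ 120) (+ 3336) (+ 1368) (~ 372) ∷
  at3 7 4 6 (+ 1236) (+ 240) (+ 28) (+ 752) (+ 220) (~ 84) (~ 2316) (~ 1252) (+ 500) ∷
  at3 7 4 7 (+ 1884) (+ 14420) (+ 584) (+ 1076) (+ 13516) (+ 408) (+ 2532) (+ 15064) (+ 548) ∷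
  at3 7 4 8 (~ 3012) (~ 11304) (~ 476) (~ 5560) (~ 22448) (~ 892) (~ 3552) (~ 16252) (~ 676) ∷
  at3 7 4 9 o (+ 536) o o (+ 1072) o o (+ 536) o ∷
  at3 7 5 4 o (+ 84) (+ 176) (+ 168) (~ 592) (+ 468) (+ 56) (+ 432) (~ 128) ∷
  at3 7 5 5 (+ 912) (+ 624) (~ 312) (+ 13220) (~ 196) (~ 104) (~ 13028) (+ 36) (~ 272) ∷
  at3 7 5 6 (~ 2172) (+ 2544) (+ 544) o (+ 4868) (+ 696) (+ 8716) (+ 748) (+ 432) ∷
  at3 7 5 7 (+ 4144) (+ 2088) (~ 580) (+ 10468) (+ 10080) (~ 700) (+ 6352) (+ 7944) (~ 196) ∷
  at3 7 5 8 (+ 60) (+ 544) (+ 384) o (+ 640) (+ 708) o o (+ 148) ∷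
  at3 7 6 4 (+ 60) (~ 176) (+ 28) (~ 504) (~ 1132) (+ 268) (+ 140) (+ 260) (+ 316) ∷
  at3 7 6 5 (~ 340) (+ 2776) (~ 72) (+ 10084) (+ 1456) (~ 152) (+ 1960) (+ 4980) (~ 168) ∷
  at3 7 6 6 (~ 1704) (~ 1680) (+ 24) (~ 7280) (+ 4) (+ 392) o (~ 3344) (+ 304) ∷
  at3 7 6 7 (~ 180) (~ 16) (~ 20) (+ 552) (~ 740) (~ 612) (+ 552) (+ 484) (~ 12) ∷
  at3 7 7 4 (~ 996) (+ 530) (~ 200) (~ 672) (~ 102) (~ 276) (~ 1148) (~ 110) (~ 312) ∷
  at3 7 7 5 (~ 5832) (+ 944) (~ 39) (~ 5496) (+ 222) (+ 102) (~ 10548) (+ 1863) (~ 20) ∷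
  at3 7 7 6 (~ 504) (~ 416) (~ 51) o (~ 85) (~ 74) o (~ 2297) (~ 68) ∷
  at3 7 8 4 (~ 576) (+ 592) (~ 60) o (+ 974) (~ 76) (~ 672) (+ 876) (~ 180) ∷
  at3 7 8 5 (+ 120) (+ 1592) (+ 30) o (+ 686) (+ 46) o (+ 2850) o ∷
  at3 8 4 4 o (+ 36) (~ 4) (~ 576) (~ 84) (~ 280) (+ 432) (+ 28) (+ 264) ∷
  at3 8 4 5 o o (+ 144) o (~ 52) (+ 296) o o (~ 280) ∷
  at3 8 4 6 (~ 912) (~ 2340) o o (~ 1428) o (~ 3432) (~ 3344) o ∷
  at3 8 4 7 o (~ 1196) (~ 688) (+ 1360) (~ 220) (~ 832) (+ 1704) (+ 912) (~ 440) ∷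
  at3 8 4 8 (+ 540) (+ 1884) (+ 460) (+ 1656) (+ 4120) (+ 864) (+ 1296) (+ 2404) (+ 456) ∷
  at3 8 5 4 (~ 240) (+ 2939) (+ 148) (~ 672) (+ 5726) (~ 360) (~ 24) (+ 28) (+ 336) ∷
  at3 8 5 5 o (~ 2323) o o (~ 8730) o o (+ 4060) o ∷
  at3 8 5 6 (~ 21072) (~ 172) (+ 80) (~ 42712) (~ 856) (+ 192) (+ 344) (~ 5388) (~ 112) ∷
  at3 8 5 7 (+ 328) (~ 1266) (~ 412) o (~ 4048) (~ 1240) (~ 1312) (~ 2028) (~ 400) ∷
  at3 8 6 4 (~ 360) (+ 1132) (~ 224) (~ 1008) (+ 6846) (~ 304) (~ 384) (+ 1140) (~ 192) ∷
  at3 8 6 5 (~ 21268) o (~ 112) (~ 240) (~ 4492) o (~ 42224) (+ 512) o ∷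
  at3 8 6 6 (~ 220) (~ 220) o (~ 2912) o (+ 416) (+ 1280) o o ∷
  at3 8 7 4 o (+ 3104) (~ 276) (~ 72) (+ 2860) (~ 260) (~ 312) (+ 4220) (~ 508) ∷
  at3 8 7 5 (~ 1968) (~ 1438) o (~ 504) (~ 1816) (+ 8) (~ 3768) (~ 4056) (+ 100) ∷
  at3 8 8 4 (+ 840) (+ 2032) (~ 44) (+ 840) (+ 1824) (~ 36) (+ 1584) (+ 3760) (~ 144) ∷
  at3 10 4 4 o (~ 12) (+ 4) (+ 72) (+ 80) (~ 16) o (~ 56) (+ 32) ∷
  at3 10 4 5 o (~ 80) o (~ 144) (~ 344) o o (+ 160) (~ 48) ∷
  at3 10 4 6 (+ 324) (+ 84) (~ 4) (+ 720) (+ 216) o o (~ 104) (+ 16) ∷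
  at3 10 5 4 (+ 240) o o o (+ 208) o (+ 648) o o ∷ at3 10 5 5 o o o (~ 576) (~ 448) o o o o ∷
  at3 10 6 4 o (~ 24) (~ 4) (~ 72) (+ 128) (+ 16) (+ 72) o o ∷ []

certificate-η : Cert 3
certificate-η =
  at3 4 4 4 (+ 15552) (+ 5184) o (+ 15552) (+ 5184) o (~ 28512) (~ 8640) (+ 288) ∷
  at3 4 4 5 o (~ 5688) o (+ 14688) (+ 8856) (+ 576) (~ 28512) (~ 8640) (+ 288) ∷
  at3 4 4 6 (+ 2592) (+ 1728) (+ 288) o o o o o o ∷
  at3 4 5 4 o o o (+ 15552) (+ 5184) o o (+ 3456) (+ 576) ∷
  at3 4 5 5 o (~ 504) o (+ 19872) (+ 15768) (+ 205) (+ 1728) (+ 3672) (+ 1235) ∷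
  at3 4 5 6 (~ 4032) (~ 2016) o (+ 6048) (+ 2016) o (~ 25920) (~ 12096) (+ 371) ∷
  at3 4 6 4 (+ 2592) (+ 1728) (+ 288) o o o o o o ∷ at3 4 6 5 o o o (~ 7776) o (~ 659) o o o ∷
  at3 4 6 6 (+ 9216) (+ 10080) (+ 864) (~ 1728) (~ 1440) (~ 288) (+ 13824) (+ 3744) (~ 288) ∷
  at3 4 6 7 o (+ 6696) (~ 1152) (+ 12960) (~ 15768) (~ 1152) (+ 864) (+ 12240) (+ 288) ∷
  at3 4 6 8 (~ 5184) (+ 3168) (~ 576) o (~ 6624) o o (+ 6624) o ∷
  at3 4 7 6 (~ 10368) (~ 14760) (~ 1152) o (~ 11088) o (~ 15552) (+ 9720) (~ 576) ∷
  at3 4 7 7 (~ 28512) (~ 23256) (~ 1440) (~ 28512) (~ 18864) (~ 288) o (~ 2016) (~ 864) ∷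
  at3 4 7 8 (+ 18432) (+ 4608) (+ 1152) (+ 19872) (+ 18432) (~ 1318) o (~ 11664) (+ 947) ∷
  at3 4 8 6 (~ 5184) (~ 18000) (~ 576) o (~ 14544) o o (+ 14544) o ∷
  at3 4 8 7 (+ 24768) (+ 28944) (+ 1152) (+ 21600) (+ 33336) (~ 83) (~ 13824) (~ 26064) (+ 742) ∷
  at3 4 8 8 (~ 8064) (~ 1728) (+ 1152) (~ 19872) (~ 11808) (+ 1318) (+ 13824) (+ 11520) (~ 742) ∷
  at3 4 8 10 (+ 2592) (+ 1728) (+ 288) o o o o o o ∷
  at3 4 9 9 (+ 5184) (+ 3456) (+ 576) o o o o o o ∷
  at3 4 9 10 (~ 5184) (~ 3456) (~ 576) o o o o o o ∷
  at3 4 10 8 (+ 2592) (+ 1728) (+ 288) o o o o o o ∷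
  at3 4 10 9 (~ 5184) (~ 3456) (~ 576) o o o o o o ∷
  at3 4 10 10 (+ 2592) (+ 1728) (+ 288) o o o o o o ∷
  at3 5 4 4 (+ 15552) (+ 5184) o o o o o (+ 3456) (+ 576) ∷
  at3 5 4 5 (+ 12960) (+ 1224) (+ 15814) o (~ 24356) (~ 14950) (+ 1296) (+ 43050) o ∷
  at3 5 4 6 (+ 20736) (+ 52626) (~ 698) (~ 13824) (~ 37388) (~ 7270) (~ 9072) (+ 43554) (+ 7968) ∷
  at3 5 4 7 o o (~ 7968) o o (+ 7968) o o (+ 7968) ∷
  at3 5 5 4 (~ 33696) (~ 11232) o (~ 33696) (~ 12096) (~ 288) (+ 39744) (+ 16128) (+ 864) ∷
  at3 5 5 5 (~ 74160) (~ 88634) (+ 576) (+ 95040) (+ 33892) (~ 6201) o (+ 62112) (~ 7597) ∷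
  at3 5 5 6 (~ 145980) (~ 64242) (~ 11232) (+ 142236) (+ 62226) (+ 13248) (~ 41616) (+ 17550) o ∷
  at3 5 5 7 (+ 25920) (~ 42336) o (~ 55296) (+ 16848) (+ 2880) o (+ 10224) o ∷
  at3 5 5 8 (+ 18144) o o o (+ 10944) (+ 1728) o (+ 144) o ∷
  at3 5 6 5 (+ 190188) (+ 66564) (+ 7296) o o (+ 9696) (~ 135180) (~ 9828) (~ 5280) ∷
  at3 5 6 6 o (~ 4608) o o o o o o o ∷
  at3 5 6 7 (+ 43164) (+ 39348) o (~ 3960) (+ 3348) (+ 4896) (+ 39600) (+ 40392) o ∷
  at3 5 6 8 (+ 54648) (~ 77126) (+ 14374) (~ 75312) (~ 5452) (+ 16722) (+ 52992) (~ 22962) (~ 576) ∷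
  at3 5 6 9 o o (~ 23904) o o (~ 7968) o o (~ 7968) ∷
  at3 5 7 5 o (~ 61920) (+ 1728) (~ 88128) (~ 49104) o o (+ 93456) o ∷
  at3 5 7 6 (~ 74844) (+ 46404) (+ 2016) (~ 134640) (~ 11664) (~ 864) (+ 346680) (+ 142452) (+ 2304) ∷
  at3 5 7 7 (+ 59616) (~ 68328) (+ 28460) (+ 504) (~ 37600) (+ 10425) (+ 74808) (~ 32286) (+ 5389) ∷
  at3 5 7 8 (~ 158652) (+ 34824) (~ 48524) (~ 89604) (~ 141698) (~ 24716) (~ 44064) (+ 86340) (~ 4141) ∷
  at3 5 7 9 o (~ 27216) (+ 29568) o (~ 18576) (+ 9120) o (~ 3456) (+ 6240) ∷
  at3 5 7 10 (~ 18144) (~ 4320) (~ 2304) o o (~ 2880) o (+ 2160) (+ 1152) ∷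
  at3 5 8 5 (~ 32832) (~ 21312) (+ 1728) o (+ 144) o (+ 50976) (+ 32256) o ∷
  at3 5 8 6 (~ 332712) (~ 128952) (~ 3744) (~ 212400) (~ 112680) (~ 1728) (+ 191376) (+ 122904) (+ 244) ∷
  at3 5 8 7 (+ 2124) o (~ 12480) o o (~ 3827) (+ 52596) (+ 56808) (+ 1798) ∷
  at3 5 8 8 (+ 338256) (+ 42732) (+ 4896) (+ 160596) (+ 139230) (+ 5952) (+ 8028) (~ 119232) (~ 4512) ∷
  at3 5 8 9 (~ 95904) o (~ 12960) (~ 11232) o (~ 5184) (~ 20736) o o ∷
  at3 5 8 10 (+ 10368) (+ 11232) (+ 8352) (~ 11232) (~ 20016) (+ 2880) o (+ 7416) o ∷
  at3 5 9 7 (+ 162432) o o o o o (+ 162432) o o ∷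
  at3 5 9 8 (~ 557712) (~ 201888) (~ 2592) o (~ 10800) o (~ 265248) (~ 76752) o ∷
  at3 5 9 9 (+ 27216) (~ 4752) (+ 2592) o (~ 3672) o o (~ 3240) o ∷
  at3 5 9 10 (+ 19008) (+ 20016) (~ 864) (+ 11232) (+ 20016) o o (~ 7272) o ∷
  at3 5 10 7 (~ 17280) (~ 59616) (~ 1728) (+ 25920) (+ 12816) o (~ 76896) (~ 74304) o ∷
  at3 5 10 8 (+ 181008) (+ 165456) (+ 2592) o (+ 216) o (+ 76896) (+ 74304) o ∷
  at3 5 10 9 (~ 9072) (~ 5616) (~ 864) o (~ 72) o o o o ∷
  at3 6 4 4 o o o (+ 2592) (+ 1728) (+ 288) o o o ∷ at3 6 4 5 o o (+ 15526) o o o o o o ∷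
  at3 6 4 6 (~ 19440) (~ 9072) (~ 16800) (+ 432) (+ 432) o (+ 47952) (+ 17712) (+ 576) ∷
  at3 6 4 7 (+ 47952) (+ 21168) o (+ 3024) (+ 5616) (~ 576) (~ 7776) (~ 6048) o ∷
  at3 6 4 8 (+ 15552) (~ 3600) (~ 288) (~ 24192) (~ 2736) (~ 864) (~ 18144) (+ 1872) o ∷
  at3 6 5 4 o (+ 864) (+ 288) o o o o o o ∷
  at3 6 5 5 (~ 176976) (~ 123390) o (~ 31572) (+ 56106) (+ 8160) (+ 86580) (+ 630) (~ 6144) ∷
  at3 6 5 6 o (~ 135158) o (+ 37476) (+ 32868) o o (+ 22824) o ∷
  at3 6 5 7 (+ 102384) (~ 1440) o (~ 46980) (+ 12672) (+ 576) (~ 64728) (~ 1044) o ∷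
  at3 6 5 8 (~ 27504) (+ 208940) (+ 4320) (+ 22104) (+ 18504) (~ 6214) o (~ 2808) (~ 1811) ∷
  at3 6 5 9 o o (+ 31872) o o o o o o ∷
  at3 6 6 4 (+ 108864) (+ 25056) (~ 3744) (~ 5184) (+ 6048) (+ 2592) (~ 34560) (~ 33696) (+ 864) ∷
  at3 6 6 5 (~ 381600) (~ 315720) (+ 9504) (+ 492120) (+ 426348) (~ 2304) (+ 25704) (+ 21672) (+ 576) ∷
  at3 6 6 6 (~ 336912) (~ 320304) (+ 16608) (+ 126576) (+ 124944) (~ 1632) (+ 153996) (+ 135276) (~ 18720) ∷
  at3 6 6 7 (+ 94956) (+ 164456) (~ 24550) (+ 120420) (+ 39072) (~ 7309) (+ 19068) (+ 20220) (+ 1152) ∷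
  at3 6 6 8 (~ 560484) (~ 288914) (+ 26470) (~ 2340) (+ 263916) (~ 20710) (~ 125604) (~ 112932) (+ 12384) ∷
  at3 6 6 9 (+ 64800) (+ 27648) (~ 22176) (+ 64800) (+ 19008) (~ 1728) o (~ 1728) (~ 1728) ∷
  at3 6 6 10 (+ 76896) (+ 2592) (+ 2016) (+ 50976) (+ 864) (+ 4320) (~ 8640) (~ 6336) (~ 1152) ∷
  at3 6 7 4 (+ 82944) (+ 11232) (~ 5472) (~ 57024) (~ 12096) (+ 2304) (~ 60480) (~ 31392) (+ 5472) ∷
  at3 6 7 5 (~ 248544) (~ 163344) (+ 20640) (+ 429552) (+ 268128) (~ 15552) (+ 278568) (+ 117816) (~ 10272) ∷
  at3 6 7 6 (~ 134352) (~ 158292) (~ 39928) (~ 245772) (~ 253836) (~ 8064) (+ 253296) (+ 291156) (~ 16307) ∷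
  at3 6 7 7 (~ 51180) (+ 278538) (+ 70028) (~ 107424) (~ 17430) (~ 38330) (+ 112152) (+ 15438) (+ 31322) ∷
  at3 6 7 8 (~ 146088) (~ 48342) (~ 14688) (~ 164088) (~ 166548) (+ 11232) (+ 112932) (+ 109938) (~ 9696) ∷
  at3 6 7 9 (+ 243396) (+ 14184) (+ 7488) (+ 67572) (+ 16200) (~ 6048) (~ 11700) (+ 2448) (~ 4032) ∷
  at3 6 7 10 (+ 36288) (+ 3456) (~ 4608) (+ 142128) (+ 65520) (+ 6048) (~ 25200) (~ 5688) (+ 1152) ∷
  at3 6 8 4 (+ 23328) (+ 4320) (~ 1152) o o o (~ 14688) (~ 12384) o ∷
  at3 6 8 5 (+ 256608) (+ 105600) (~ 3936) (~ 107136) (~ 68472) (~ 8557) (~ 238032) (~ 134880) (+ 4102) ∷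
  at3 6 8 6 (~ 354312) (+ 3408) (+ 41760) (~ 292212) (~ 292404) (~ 480) (+ 148032) (+ 231120) (+ 10342) ∷
  at3 6 8 7 (+ 368436) (~ 172560) (~ 50880) (~ 54588) (+ 318438) o (+ 512832) (~ 261060) (~ 27552) ∷
  at3 6 8 8 (~ 1122372) (~ 365844) (+ 56736) (+ 1386408) (+ 241776) (~ 18048) (~ 1640412) (~ 475524) (+ 32544) ∷
  at3 6 8 9 (+ 277644) (+ 110352) (+ 19968) (~ 118596) (+ 67776) (+ 24768) (+ 104316) (~ 20796) (~ 12768) ∷
  at3 6 8 10 (~ 199584) (~ 72864) (~ 11808) (~ 193104) (~ 73296) (~ 12672) (+ 99360) (+ 39456) (+ 6912) ∷
  at3 6 9 6 (~ 164160) (~ 78528) (~ 7104) o (+ 96) (+ 96) (~ 164160) (~ 79008) (~ 7296) ∷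
  at3 6 9 7 (~ 661320) (~ 115752) (+ 46272) (+ 254520) (~ 9552) (+ 3264) (~ 1295280) (~ 455064) (+ 28992) ∷
  at3 6 9 8 (+ 1641984) (+ 673128) (~ 24768) (~ 1073472) (~ 288528) (+ 13152) (+ 1869000) (+ 682032) (~ 22368) ∷
  at3 6 9 9 (~ 152016) (~ 81456) (+ 576) (+ 216624) (~ 15360) o (~ 255408) (~ 20544) (~ 1728) ∷
  at3 6 10 6 (+ 14688) (+ 51840) (+ 4608) o (+ 3456) o (+ 92448) (+ 63936) o ∷
  at3 6 10 7 (~ 405648) (~ 193968) (+ 192) (+ 39816) (~ 264) (+ 1824) (~ 170208) (~ 11808) o ∷
  at3 6 10 8 (~ 6480) (~ 77616) (+ 864) o (+ 39024) (+ 576) o (~ 78048) o ∷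
  at3 7 4 6 (~ 7776) (+ 864) o (~ 15552) (~ 8928) o (~ 7776) (~ 12960) (~ 1728) ∷
  at3 7 4 7 (~ 14256) (~ 22536) (~ 2880) (~ 11664) (~ 5544) (~ 864) (+ 7776) (+ 23976) (+ 1440) ∷
  at3 7 4 8 o (~ 134406) (~ 16390) o (~ 36380) (~ 12646) o (+ 39018) (+ 1440) ∷
  at3 7 4 9 o o (~ 7968) o o (+ 7968) o o (+ 7968) ∷
  at3 7 5 5 (~ 88128) (~ 49104) o o (+ 87408) (~ 5952) o (~ 55872) (+ 7680) ∷
  at3 7 5 6 (+ 63000) (~ 60660) (+ 6624) (+ 50112) (~ 75852) (+ 8928) (~ 34344) (+ 54900) (~ 5568) ∷
  at3 7 5 7 (+ 16992) (+ 157864) (~ 4032) (~ 9180) (+ 72308) (+ 9107) (+ 11592) (~ 71670) (~ 6131) ∷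
  at3 7 5 8 (+ 568332) (+ 131636) (+ 7104) (~ 23436) (~ 145442) o (~ 314568) (~ 146724) (+ 7091) ∷
  at3 7 5 9 (~ 64800) (~ 3888) (~ 15360) (~ 64800) (~ 3888) (+ 8544) o o (+ 7968) ∷
  at3 7 5 10 (~ 61344) o o (~ 53568) (~ 2592) (~ 1728) (+ 8640) (+ 4176) o ∷
  at3 7 6 4 o o (~ 4032) (+ 15552) o (+ 4320) o o (~ 4320) ∷
  at3 7 6 5 (~ 457128) (~ 289116) (~ 1728) (+ 503352) (+ 335700) (~ 3360) (~ 553680) (~ 387396) (+ 1152) ∷
  at3 7 6 6 (~ 116196) (~ 134794) (~ 18598) (+ 72156) (+ 21272) (+ 19846) (~ 82440) (~ 210342) (+ 24288) ∷
  at3 7 6 7 (~ 235152) (~ 266600) (~ 46316) (~ 160464) (+ 38152) (+ 31929) (+ 189528) (+ 190404) (+ 15456) ∷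
  at3 7 6 8 (+ 479592) (+ 214080) (+ 24672) (+ 265032) (~ 120594) (~ 1920) (~ 94392) (+ 31260) (~ 19296) ∷
  at3 7 6 9 (~ 147492) (~ 13896) (+ 5472) (~ 23940) (~ 12744) (+ 8640) (+ 32436) (~ 2592) (+ 4608) ∷
  at3 7 6 10 (~ 102816) (~ 11232) (~ 3168) (~ 275616) (~ 58896) (~ 10944) (+ 25200) (~ 1944) (~ 1152) ∷
  at3 7 7 4 (~ 80352) (~ 25056) (+ 4608) (+ 152928) (+ 36288) (~ 4896) (+ 65664) (+ 36576) (~ 864) ∷
  at3 7 7 5 (+ 605736) (+ 513648) (+ 13580) (~ 519840) (~ 301940) (+ 16333) (+ 28440) (+ 143718) (+ 14771) ∷
  at3 7 7 6 (~ 474720) o (+ 27788) (+ 566412) (+ 98098) (~ 21670) (~ 234360) (+ 612) (+ 18227) ∷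
  at3 7 7 7 (~ 822996) (+ 256008) (~ 1632) (+ 31020) (~ 182844) (~ 384) (+ 703452) (~ 165048) (~ 1920) ∷
  at3 7 7 8 (+ 2836740) (+ 671568) (~ 61728) (~ 2235972) (~ 864600) (+ 12960) (~ 591156) (~ 181584) (+ 37056) ∷
  at3 7 7 9 (~ 443424) (~ 30936) (~ 16800) (+ 426816) (+ 69624) (~ 12576) (+ 43584) (+ 21312) (+ 2880) ∷
  at3 7 7 10 (+ 177984) (+ 51120) (+ 11232) (+ 194832) (+ 56736) (+ 11232) (~ 99360) (~ 32112) (~ 6912) ∷
  at3 7 8 4 (~ 80352) (~ 19008) (+ 6624) (+ 121824) (+ 41472) (~ 5760) (+ 88992) (+ 34272) (~ 5184) ∷
  at3 7 8 5 (+ 92412) (+ 16848) (~ 24480) (~ 245880) (~ 119004) (+ 9517) (~ 390852) (~ 217560) (~ 10630) ∷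
  at3 7 8 6 (+ 77304) (+ 131172) (+ 6816) (+ 29832) (+ 6162) o (~ 543732) (+ 303696) (+ 4512) ∷
  at3 7 8 7 (~ 64344) (+ 64968) (+ 24864) (~ 1523052) (~ 499872) (+ 3264) (+ 2596728) (+ 460608) (+ 8160) ∷
  at3 7 8 8 (~ 77940) (~ 105588) (~ 67968) (+ 2186508) (+ 865104) (~ 12864) (~ 1358340) (~ 69960) o ∷
  at3 7 8 9 (+ 52800) (~ 19920) (+ 1248) (~ 489936) (~ 167880) (~ 12864) (+ 255408) (+ 58704) (+ 4992) ∷
  at3 7 9 5 (+ 1728) (+ 69216) (+ 3936) o (+ 192) (+ 96) (+ 1728) (+ 69696) (+ 4128) ∷
  at3 7 9 6 (+ 1290312) (+ 425136) (~ 36384) (~ 254520) (+ 21360) (~ 3456) (+ 1724040) (+ 767040) (~ 6528) ∷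
  at3 7 9 7 (~ 1198368) (~ 744624) (~ 35232) (+ 731808) (+ 292368) (+ 10176) (~ 1584792) (~ 745752) (~ 30048) ∷
  at3 7 9 8 (+ 83136) (+ 79152) (~ 3744) (+ 21360) (+ 94416) o (+ 26040) (~ 88032) o ∷
  at3 7 10 5 o o (~ 5184) o (~ 4176) (+ 1152) (+ 33696) (+ 26784) o ∷
  at3 7 10 6 (+ 229824) (+ 36288) (~ 7104) (~ 39816) (+ 7368) (+ 2880) (+ 45360) (~ 83952) (~ 2688) ∷
  at3 7 10 7 (+ 248400) (+ 194544) (~ 1824) (~ 126144) (~ 100152) (+ 192) (+ 231552) (+ 187200) (~ 2400) ∷
  at3 8 4 6 o o o (~ 5184) (~ 3456) (~ 576) o o o ∷
  at3 8 4 7 (+ 7776) (~ 90564) (~ 15526) (+ 10368) (~ 56056) (~ 30476) (~ 7776) (+ 90564) o ∷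
  at3 8 4 8 (~ 15552) (+ 134550) (+ 15526) (~ 10368) (+ 53464) (+ 45836) (+ 7776) (~ 94020) (+ 14784) ∷
  at3 8 4 9 o o (+ 7968) o o (~ 15936) o o (~ 15936) ∷
  at3 8 4 10 o o o (+ 2592) (+ 1728) (+ 288) o o o ∷
  at3 8 5 5 o (+ 144) o (+ 18144) (+ 13248) (+ 2112) o (~ 2304) (~ 384) ∷
  at3 8 5 6 (+ 21312) (+ 35156) (~ 3744) (+ 16416) (+ 115136) (+ 58936) (~ 8352) (~ 189624) (+ 1728) ∷
  at3 8 5 7 (+ 321264) (+ 85010) (+ 6816) (+ 303948) (+ 104882) (~ 44492) (~ 352548) (~ 48054) (~ 26784) ∷
  at3 8 5 8 (~ 541692) (~ 216630) (~ 14304) (~ 106992) (+ 130536) (~ 15840) (+ 485316) (+ 277290) (+ 4512) ∷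
  at3 8 5 9 (~ 5184) (~ 288) (~ 576) (~ 37584) (~ 3456) (+ 2016) o (+ 5328) (+ 2880) ∷
  at3 8 5 10 (+ 61344) o o (+ 149904) (+ 16848) (+ 2592) o (+ 216) o ∷
  at3 8 6 4 (~ 57024) (~ 6912) o (+ 54432) (+ 5184) (~ 288) (~ 63072) (~ 11520) (~ 864) ∷
  at3 8 6 5 o (+ 59224) (+ 18406) (~ 155520) (~ 104152) (~ 22412) (+ 67392) (+ 144996) (~ 8640) ∷
  at3 8 6 6 (+ 245160) (+ 226606) (~ 18842) (~ 101088) (~ 354136) (~ 53324) (+ 318960) (+ 111180) (+ 58176) ∷
  at3 8 6 7 (+ 181560) (~ 40704) (+ 21504) (~ 534108) (~ 273426) (+ 36192) (~ 728148) (~ 250884) (~ 9984) ∷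
  at3 8 6 8 (~ 831036) (~ 150252) (+ 11616) (+ 1638432) (+ 844248) (~ 3456) (+ 1020852) (+ 342948) (~ 14496) ∷
  at3 8 6 9 (+ 143748) (~ 60768) (~ 5184) (~ 330252) (~ 136752) (~ 14208) (~ 147900) (~ 16644) (+ 2976) ∷
  at3 8 6 10 o o (+ 1152) (~ 6480) (+ 432) (+ 2016) o o o ∷
  at3 8 7 4 (~ 23328) (~ 11232) (+ 4896) (+ 54432) (+ 15552) (~ 4896) (~ 7776) (~ 14112) (+ 5760) ∷
  at3 8 7 5 o (~ 154998) (~ 59276) (+ 120420) (+ 167470) (+ 43628) (+ 304740) (+ 70542) (~ 46464) ∷
  at3 8 7 6 (~ 31200) (~ 60114) (+ 4992) (+ 70332) (+ 154272) (+ 16416) (~ 355332) (~ 120762) (~ 10368) ∷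
  at3 8 7 7 (+ 1221336) (+ 237264) (~ 60480) (~ 379068) (~ 245712) (~ 50016) (~ 1610220) (+ 134424) (+ 80832) ∷
  at3 8 7 8 (~ 2741808) (~ 915096) (+ 69696) (~ 133056) (+ 1128) (+ 19872) (+ 2411316) (+ 533112) (~ 64032) ∷
  at3 8 7 9 (+ 65808) (+ 43704) (+ 3648) o (+ 82512) (+ 18912) o o (+ 7104) ∷
  at3 8 8 4 (+ 5184) (~ 16416) (~ 6048) (~ 108864) (~ 14688) (+ 7200) (~ 138240) (~ 67680) (~ 864) ∷
  at3 8 8 5 (~ 210780) (+ 36672) (+ 39072) (+ 455004) (+ 16938) (~ 21984) (+ 496800) (+ 108564) (+ 27456) ∷
  at3 8 8 6 (+ 2011236) (+ 455484) (~ 68928) (~ 2081760) (~ 543096) (+ 46080) (+ 661284) (~ 22932) (~ 39936) ∷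
  at3 8 8 7 (+ 308292) (+ 215640) (+ 37632) (+ 842760) (+ 253392) (+ 16800) (~ 2306916) (~ 824604) (+ 9408) ∷
  at3 8 8 8 o (+ 52416) (+ 10944) o (~ 142992) (~ 14976) (~ 201096) (~ 116856) (~ 13824) ∷
  at3 8 9 4 o (+ 9504) (+ 3168) o o o o (+ 9504) (+ 3168) ∷
  at3 8 9 5 (~ 102384) (~ 125832) (~ 7872) o (~ 7344) o (~ 211896) (~ 274296) (~ 23040) ∷
  at3 8 9 6 (~ 465648) (+ 86904) (+ 57984) (+ 341664) (~ 15600) (~ 22944) (~ 296088) (+ 34416) (+ 46944) ∷
  at3 8 9 7 (+ 227760) (+ 68904) (+ 4032) (~ 340392) (~ 96624) (~ 576) (+ 747168) (+ 331560) (+ 864) ∷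
  at3 8 10 4 o (+ 6048) (+ 2016) (~ 25920) (~ 12096) (~ 1152) (~ 49248) (~ 16416) o ∷
  at3 8 10 5 o o (+ 6336) o (~ 3000) (~ 5280) (+ 53136) (+ 41328) (+ 5568) ∷
  at3 8 10 6 (~ 287280) (~ 141552) (+ 2112) (+ 146448) (+ 73296) (~ 768) (~ 293760) (~ 139392) (+ 3552) ∷
  at3 9 4 8 o (+ 3456) (+ 1152) o (+ 5760) (+ 2304) o o o ∷
  at3 9 4 9 o o o (+ 5184) (+ 3456) (+ 576) o o o ∷
  at3 9 4 10 o o o (~ 5184) (~ 3456) (~ 576) o o o ∷
  at3 9 5 7 o o (+ 1152) (+ 111456) (+ 112608) (~ 9792) (+ 111456) (+ 118368) (~ 7488) ∷
  at3 9 5 8 o o o (~ 250128) (~ 269424) (+ 3936) (~ 111456) (~ 126720) (+ 3264) ∷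
  at3 9 5 9 o (~ 72) o (+ 27216) (+ 16848) (+ 2592) o (+ 360) o ∷
  at3 9 5 10 o o o (~ 9072) (~ 5616) (~ 864) o (~ 72) o ∷
  at3 9 6 6 o o o (~ 341280) (~ 116064) (+ 7488) (~ 341280) (~ 116064) (+ 7488) ∷
  at3 9 6 7 (~ 288072) (~ 6336) (~ 3456) (+ 2053368) (+ 888696) (+ 4224) (+ 1423296) (+ 582984) (+ 6048) ∷
  at3 9 6 8 (+ 541788) (+ 164172) (+ 2304) (~ 1238676) (~ 536160) (~ 2688) (~ 965520) (~ 404280) (~ 1728) ∷
  at3 9 6 9 (+ 42480) (+ 56448) (~ 4608) (+ 282384) (+ 99504) (~ 5184) o (~ 13968) o ∷
  at3 9 7 5 o o o (+ 229824) o o (+ 229824) o o ∷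
  at3 9 7 6 (+ 262152) (~ 11808) (+ 1152) (~ 1396728) (~ 574560) (~ 12384) (~ 483480) (~ 336528) (~ 8832) ∷
  at3 9 7 7 (+ 638832) (+ 210744) o (~ 818700) (~ 284544) (+ 96) (~ 1297404) (~ 539808) (~ 1824) ∷
  at3 9 7 8 (+ 68208) (~ 17568) (~ 2304) (~ 89472) (~ 22752) (+ 6048) (~ 8832) (+ 81432) o ∷
  at3 9 8 5 o o o (~ 411696) (~ 56520) (+ 3648) (~ 876744) (~ 160920) (~ 1056) ∷
  at3 9 8 6 (~ 1180620) (~ 350076) (+ 3744) (+ 2035344) (+ 788232) o (+ 2251044) (+ 921264) (+ 384) ∷
  at3 9 8 7 (+ 15360) (+ 4296) o (~ 243480) (~ 50640) o (+ 486024) (+ 124032) (~ 288) ∷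
  at3 9 9 4 (+ 25920) (+ 14688) o o (+ 6048) o (+ 48384) (+ 38880) (+ 576) ∷
  at3 9 9 5 o (~ 7776) o o (+ 16488) o (+ 17064) (+ 35424) (+ 6048) ∷
  at3 9 9 6 (~ 177888) (~ 89544) o (+ 79944) (~ 3792) o (~ 536808) (~ 218784) (+ 576) ∷
  at3 9 10 4 o (~ 4320) (~ 1440) o (~ 4320) (+ 576) (~ 5184) (~ 19872) (~ 2880) ∷
  at3 9 10 5 (+ 51840) (+ 30240) o (~ 20304) (~ 12096) o (+ 59616) (+ 31968) (~ 288) ∷
  at3 10 4 8 o o o (+ 2592) (+ 1728) (+ 288) o o o ∷
  at3 10 4 9 o o o (~ 5184) (~ 3456) (~ 576) o o o ∷
  at3 10 4 10 o o o (+ 2592) (+ 1728) (+ 288) o o o ∷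
  at3 10 5 7 o (+ 2160) (+ 1152) (~ 18144) (~ 4320) (~ 192) o o (~ 768) ∷
  at3 10 5 8 o (+ 216) o (+ 27216) (+ 16848) (+ 4128) o o (+ 768) ∷
  at3 10 5 9 o (~ 72) o (~ 9072) (~ 5616) (~ 864) o o o ∷
  at3 10 6 6 (~ 8640) (~ 6336) (~ 1152) (+ 154656) (+ 33408) (+ 2016) (+ 128736) (+ 31680) (+ 4320) ∷
  at3 10 6 7 (+ 20880) (+ 3456) (+ 3456) (~ 317952) (~ 101088) (~ 5952) (~ 128736) (~ 56448) (~ 2016) ∷
  at3 10 6 8 o (~ 8928) (+ 2880) (~ 6480) (+ 18288) (~ 3744) o (+ 17856) (~ 4608) ∷
  at3 10 7 5 (+ 8640) (+ 4176) o (~ 139104) (~ 30816) (~ 2112) (~ 131328) (~ 33408) (~ 3840) ∷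
  at3 10 7 6 (~ 20880) (+ 4104) (~ 1152) (+ 168048) (+ 53424) (~ 864) (~ 154656) (~ 2592) (~ 1536) ∷
  at3 10 7 7 (~ 177120) (~ 40824) (~ 2304) (+ 350352) (+ 77616) (+ 4320) (+ 333504) (+ 68544) (+ 3168) ∷
  at3 10 8 4 o o o o o o (+ 2592) (+ 1728) (+ 288) ∷
  at3 10 8 5 o (~ 7776) (~ 2304) (+ 127872) (+ 34272) (+ 3264) (+ 288576) (+ 62496) (+ 3360) ∷
  at3 10 8 6 (+ 177120) (+ 48240) o (~ 348624) (~ 92016) o (~ 355104) (~ 88128) (+ 2016) ∷
  at3 10 9 4 o o o o o o (~ 5184) (~ 3456) (~ 576) ∷
  at3 10 9 5 o (+ 3312) o (+ 11232) o o (+ 19008) (+ 3456) (+ 288) ∷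
  at3 10 10 4 o (~ 1728) (~ 576) o o o (+ 2592) (~ 1728) (~ 864) ∷ []

certificate-α : Cert 3
certificate-α =
  at3 4 6 6 (+ 9) (+ 6) (+ 1) (+ 63) (+ 38) (+ 3) (+ 63) (+ 17) (~ 2) ∷
  at3 4 6 7 o (+ 31) o o (+ 43) (~ 16) (~ 117) (~ 41) (~ 2) ∷
  at3 4 6 8 (~ 171) (~ 52) (+ 1) (~ 117) (~ 51) (~ 2) (~ 180) (~ 58) o ∷
  at3 4 7 6 o (+ 44) (+ 5) (~ 117) (~ 23) o (+ 108) (+ 82) (+ 15) ∷
  at3 4 7 7 (~ 42) (+ 81) o (~ 81) (+ 32) (~ 5) (~ 81) (+ 63) o ∷
  at3 4 8 6 (~ 171) (~ 55) (~ 2) (~ 180) (~ 61) (~ 3) (~ 117) (~ 23) o ∷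
  at3 5 5 6 o (~ 21) o o (+ 10) (+ 5) (+ 162) o o ∷
  at3 5 5 7 (+ 216) o (+ 20) o (+ 42) o (+ 162) o o ∷
  at3 5 5 8 o (+ 5) (+ 5) o (~ 11) (+ 5) o o o ∷ at3 5 6 5 o o (+ 5) o o (+ 6) o (~ 11) o ∷
  at3 5 6 6 (+ 128) (+ 110) (+ 6) (+ 31) (+ 12) (~ 3) (~ 28) (~ 34) (+ 8) ∷
  at3 5 6 7 (~ 463) (+ 60) (+ 2) (~ 245) (~ 87) (~ 6) (~ 716) (~ 178) (~ 7) ∷
  at3 5 6 8 (~ 726) (~ 244) (~ 2) (~ 214) (~ 95) (~ 15) (~ 445) (~ 200) (~ 5) ∷
  at3 5 7 5 o o o o o (+ 6) o (~ 38) o ∷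
  at3 5 7 6 o o (~ 15) (~ 11) (+ 4) (~ 24) (+ 197) (~ 74) (~ 15) ∷
  at3 5 7 7 o (~ 23) (~ 6) (~ 297) (~ 35) o o (~ 247) o ∷
  at3 5 8 5 o (~ 21) o o o o o (+ 10) (+ 5) ∷
  at3 5 8 6 o (+ 1) (~ 5) (+ 39) (+ 45) (~ 5) (+ 567) (~ 62) (~ 15) ∷
  at3 6 4 6 (+ 63) (+ 7) (~ 2) (+ 9) (+ 6) (+ 1) (+ 63) (+ 26) (~ 3) ∷
  at3 6 4 7 (+ 216) (+ 10) (+ 3) o (+ 40) (~ 1) (~ 117) (~ 23) (~ 4) ∷
  at3 6 4 8 (~ 117) (~ 26) (~ 3) (~ 171) (~ 43) o (~ 180) (~ 49) (~ 1) ∷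
  at3 6 5 5 o (+ 32) o o (~ 10) (+ 6) o o o ∷
  at3 6 5 6 (~ 114) (~ 75) o (+ 89) (+ 67) (+ 2) (+ 99) (~ 66) (+ 22) ∷
  at3 6 5 7 o o (+ 43) (+ 44) o (+ 40) (~ 45) (~ 73) (+ 32) ∷
  at3 6 5 8 (~ 350) (~ 107) (+ 11) (~ 234) (~ 59) (~ 3) (~ 117) (~ 25) (~ 5) ∷
  at3 6 6 4 (+ 63) (+ 28) (+ 3) (+ 63) (+ 16) (+ 3) (+ 9) (+ 6) (+ 1) ∷
  at3 6 6 5 (+ 77) o o (~ 11) (~ 25) (~ 19) (+ 11) (~ 3) (+ 10) ∷
  at3 6 6 6 (+ 242) (+ 257) (+ 15) (+ 117) (+ 117) o (+ 238) (+ 244) (+ 6) ∷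
  at3 6 6 7 (~ 291) (+ 11) (~ 14) (+ 105) (~ 8) (~ 2) (+ 188) (+ 208) (~ 4) ∷
  at3 6 6 8 (~ 555) (~ 192) (~ 3) (~ 63) (~ 16) (~ 3) (~ 9) (~ 6) (~ 1) ∷
  at3 6 7 4 (+ 168) (+ 101) (+ 15) (+ 63) (+ 2) (+ 3) (+ 60) (+ 25) (+ 5) ∷
  at3 6 7 5 (~ 191) o (~ 37) (~ 89) (~ 49) (~ 41) o (+ 25) (~ 32) ∷
  at3 6 7 6 (+ 117) (+ 41) (~ 31) (+ 7) (+ 29) (~ 2) (~ 149) o o ∷
  at3 6 7 7 (+ 42) (~ 104) (~ 6) o (+ 22) o o (~ 6) o ∷
  at3 6 8 4 (+ 63) (~ 7) (~ 2) o (~ 14) o (+ 9) (~ 8) (+ 1) ∷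
  at3 6 8 5 (~ 405) (+ 85) (+ 11) (~ 57) (~ 52) (~ 5) (~ 54) (~ 52) (~ 2) ∷
  at3 6 8 6 (+ 171) (+ 56) (~ 3) (~ 9) (~ 6) (~ 1) (~ 63) (~ 44) (~ 3) ∷
  at3 7 4 6 o (~ 31) (~ 5) (+ 39) (+ 18) o (+ 147) (+ 48) (~ 10) ∷
  at3 7 4 7 (+ 174) (+ 3) (~ 5) (+ 213) (+ 36) o (+ 174) (+ 2) o ∷
  at3 7 5 5 o (+ 32) o o o (+ 14) o (+ 34) (+ 20) ∷
  at3 7 5 6 (~ 156) (~ 37) (+ 20) (~ 106) (~ 17) (+ 14) (~ 42) (~ 176) (+ 15) ∷
  at3 7 5 7 o o (+ 33) (+ 277) o o (+ 233) (+ 1) (~ 20) ∷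
  at3 7 6 4 (+ 54) (+ 20) (+ 2) (+ 165) (+ 32) (~ 11) (+ 57) (+ 36) (+ 5) ∷
  at3 7 6 5 (~ 171) (~ 139) (+ 3) (~ 94) (+ 94) o o (+ 7) (+ 2) ∷
  at3 7 6 6 (+ 96) (+ 124) (+ 4) (~ 188) o (+ 34) (~ 467) (+ 159) (+ 17) ∷
  at3 7 6 7 o (+ 82) (~ 5) (+ 64) (~ 36) o (+ 246) (+ 175) o ∷
  at3 7 7 4 (+ 144) (+ 51) (~ 5) (+ 144) (+ 82) o (+ 183) (+ 100) o ∷
  at3 7 7 5 (~ 371) (+ 10) (~ 47) o o (~ 20) (~ 214) (+ 202) o ∷
  at3 7 7 6 o (~ 33) (~ 5) (~ 117) (~ 73) o (~ 397) (+ 102) o ∷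
  at3 8 4 6 (~ 63) (~ 38) (~ 3) (~ 54) (~ 32) (~ 2) o (~ 16) o ∷
  at3 8 5 5 o o o o o o o (~ 16) o ∷ at3 8 5 6 o o o o (~ 16) o o (~ 81) (~ 37) ∷
  at3 8 6 4 (~ 9) (~ 8) (~ 1) (+ 54) (+ 30) (+ 2) o (~ 2) o ∷
  at3 8 6 5 (~ 224) (~ 113) o (~ 201) (+ 14) (+ 43) (~ 309) (~ 101) (+ 2) ∷
  at3 8 6 6 (~ 9) (~ 6) (~ 1) (+ 54) (+ 16) (+ 2) (~ 309) (~ 99) (+ 2) ∷ []

certificate-ε : Cert 3
certificate-ε =
  at3 4 4 4 (~ 72) (~ 69) (+ 1) (+ 135) (+ 70) o (~ 54) (+ 5) o ∷
  at3 4 4 5 o (~ 33) o o o o o (+ 52) (+ 2) ∷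
  at3 4 4 6 (+ 63) (~ 15) (+ 1) (~ 54) (+ 21) o (+ 54) (+ 47) (+ 2) ∷
  at3 4 5 4 (+ 63) (~ 47) o o (+ 56) (+ 2) o (+ 75) o ∷
  at3 4 5 5 o (~ 77) o o (+ 105) (+ 15) (+ 54) (+ 75) (~ 11) ∷
  at3 4 5 6 o (~ 3) (+ 23) o (+ 15) (~ 21) (+ 54) o (~ 11) ∷
  at3 4 6 4 (+ 63) (+ 72) (+ 20) (~ 135) (~ 14) (+ 2) (~ 54) (~ 66) (~ 19) ∷
  at3 4 6 5 o o o o (+ 105) (+ 15) o (~ 33) (~ 17) ∷
  at3 4 6 6 (+ 9) (+ 6) (+ 1) (+ 54) (~ 6) (~ 21) (+ 54) (+ 33) (+ 2) ∷
  at3 5 4 4 (~ 534) (~ 376) (~ 2) (~ 124) (+ 104) (+ 8) (+ 468) (+ 152) o ∷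
  at3 5 4 5 (+ 160) (~ 270) (+ 8) (+ 36) (+ 162) o (+ 128) (+ 250) o ∷
  at3 5 4 6 (~ 48) (+ 48) (+ 32) (+ 110) (+ 54) o (~ 466) (~ 77) (~ 23) ∷
  at3 5 4 7 (+ 81) (+ 20) (+ 5) o o o (~ 9) (~ 82) (~ 23) ∷
  at3 5 5 4 (+ 44) (~ 666) (+ 6) (+ 119) (+ 640) (~ 23) (~ 36) (+ 51) (+ 33) ∷
  at3 5 5 5 (~ 476) (~ 562) (+ 31) (+ 450) (+ 432) o (+ 115) (+ 174) o ∷
  at3 5 5 6 (+ 279) (+ 254) (+ 49) o o (~ 14) (~ 83) o (~ 25) ∷
  at3 5 5 7 o (+ 51) (+ 21) o o o (~ 279) (~ 227) (~ 26) ∷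
  at3 5 6 4 (+ 148) (~ 434) (+ 30) (+ 433) (+ 921) (~ 14) o (+ 282) o ∷
  at3 5 6 5 (~ 733) (+ 185) (+ 12) (+ 36) (+ 402) (~ 15) (+ 966) o o ∷
  at3 5 6 6 (+ 291) (+ 215) (~ 16) (~ 244) (+ 54) (~ 14) (+ 687) (~ 513) o ∷
  at3 5 6 7 o o o o (+ 99) o (~ 279) (~ 231) o ∷
  at3 5 7 4 (~ 13) (~ 160) (+ 24) (~ 8) (+ 251) (~ 2) o (+ 208) o ∷
  at3 5 7 5 (~ 126) (+ 356) (+ 24) (~ 288) (+ 191) o o (~ 27) o ∷
  at3 5 7 6 (~ 55) (+ 123) (~ 16) (~ 134) (+ 108) o (+ 201) (~ 222) o ∷
  at3 5 7 7 (+ 186) (+ 65) (~ 16) o (+ 99) o (+ 201) (+ 13) o ∷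
  at3 6 4 4 (~ 969) (~ 635) (~ 8) (~ 507) (~ 122) (+ 8) (+ 576) (+ 175) o ∷
  at3 6 4 5 (+ 428) (~ 363) (+ 30) o (+ 64) (~ 36) (+ 396) (+ 134) (+ 34) ∷
  at3 6 4 6 (+ 126) (+ 53) (+ 36) (+ 197) (+ 168) (+ 11) (+ 57) (+ 106) (+ 53) ∷
  at3 6 4 7 (~ 559) (~ 105) (~ 19) o (+ 61) (+ 32) (~ 63) (+ 53) (+ 26) ∷
  at3 6 4 8 (~ 36) (~ 87) (~ 20) o (~ 1) o (~ 9) (~ 7) (~ 1) ∷
  at3 6 5 4 (~ 209) (~ 1297) (~ 2) (~ 6) (~ 75) (~ 13) o (+ 27) (+ 47) ∷
  at3 6 5 5 (~ 1512) (~ 1051) (+ 87) o (~ 155) (~ 26) (+ 268) (+ 309) o ∷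
  at3 6 5 6 (~ 206) o (+ 101) (+ 477) (+ 426) (+ 37) (+ 235) (~ 39) (~ 60) ∷
  at3 6 5 7 (~ 461) (+ 99) (+ 15) o (+ 122) (+ 40) (~ 26) (+ 68) (~ 32) ∷
  at3 6 5 8 (~ 441) (~ 303) (~ 33) (+ 54) (+ 2) (~ 4) o (~ 16) (~ 8) ∷
  at3 6 6 4 (+ 378) (~ 843) (+ 2) (~ 471) (~ 261) (~ 12) o (~ 11) (+ 29) ∷
  at3 6 6 5 (~ 469) (+ 209) (~ 24) (~ 299) (+ 58) (+ 43) (~ 77) (~ 115) (+ 50) ∷
  at3 6 6 6 (+ 216) (+ 195) (~ 21) (+ 408) (+ 401) (+ 41) (~ 94) (~ 134) (+ 8) ∷
  at3 6 6 7 (+ 758) (~ 304) (+ 8) o (+ 61) (~ 16) (~ 1) (+ 1) (~ 22) ∷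
  at3 6 6 8 (~ 789) (~ 471) (~ 3) (+ 99) o (~ 9) (~ 57) (~ 40) (~ 7) ∷
  at3 6 7 4 (+ 568) (+ 218) (+ 1) (~ 63) (~ 35) (~ 6) o (+ 1) o ∷
  at3 6 7 5 (~ 269) (+ 1397) (~ 51) (~ 58) (~ 40) (+ 24) (+ 40) (+ 22) (+ 32) ∷
  at3 6 7 6 o (+ 871) (~ 79) (~ 31) (+ 5) (+ 12) (+ 14) (+ 11) (+ 64) ∷
  at3 6 7 7 (+ 732) (~ 413) (~ 14) o o (~ 24) (~ 92) (~ 40) (+ 32) ∷
  at3 6 7 8 (~ 105) (~ 105) (+ 13) (+ 36) (~ 10) (~ 6) (~ 66) (~ 30) o ∷
  at3 6 8 4 (+ 60) (+ 38) (+ 1) (~ 9) (~ 5) (~ 1) o (+ 1) o ∷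
  at3 6 8 5 (~ 165) (+ 738) (+ 14) (~ 72) (~ 48) (~ 8) (~ 54) (~ 26) (~ 4) ∷
  at3 6 8 6 (~ 432) (+ 645) (+ 22) (~ 54) (~ 36) (~ 6) (~ 108) (~ 54) (~ 8) ∷
  at3 6 8 7 (+ 72) (+ 95) (+ 12) o o o (~ 54) (~ 26) (~ 4) ∷
  at3 6 8 8 (+ 279) (+ 150) (+ 3) (~ 9) (~ 7) (~ 1) o (+ 1) o ∷
  at3 7 4 4 (~ 624) (~ 418) (~ 6) (~ 302) (~ 212) o o o o ∷
  at3 7 4 5 (+ 268) (~ 126) (+ 22) o (~ 48) (~ 22) (+ 376) o (+ 52) ∷
  at3 7 4 6 (~ 93) (~ 23) (+ 22) o o o (+ 487) (+ 93) (+ 55) ∷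
  at3 7 4 7 (~ 105) (~ 61) (+ 9) o (+ 1) o (+ 39) (+ 39) (+ 17) ∷
  at3 7 5 4 (~ 190) (~ 706) (~ 8) (~ 233) (~ 807) o o (+ 1) o ∷
  at3 7 5 5 (~ 650) (~ 478) (+ 32) (~ 813) (~ 693) (+ 43) o o (+ 13) ∷
  at3 7 5 6 (~ 299) (+ 354) (+ 43) (~ 311) (+ 292) (+ 53) (+ 175) (+ 61) o ∷
  at3 7 5 7 (~ 590) (~ 273) (+ 2) (+ 123) (~ 118) o (+ 544) (+ 36) o ∷
  at3 7 6 4 (+ 631) (~ 328) (+ 1) (+ 116) (~ 884) (~ 18) (+ 504) o o ∷
  at3 7 6 5 (~ 71) (~ 49) (~ 77) (~ 300) (~ 778) (+ 24) o o (~ 39) ∷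
  at3 7 6 6 o (~ 15) (~ 75) (~ 311) (+ 164) (+ 29) (~ 209) (+ 36) (~ 59) ∷
  at3 7 6 7 (~ 674) (~ 401) (~ 14) (~ 48) (~ 416) o (+ 295) (+ 36) (~ 20) ∷
  at3 7 7 4 (~ 73) (~ 264) (+ 9) (~ 25) (~ 315) (~ 4) o (~ 251) o ∷
  at3 7 7 5 o (+ 284) o o (~ 215) (~ 26) o (+ 47) o ∷
  at3 7 7 6 o (+ 130) (~ 22) o (~ 128) (~ 24) o (+ 436) (~ 6) ∷
  at3 7 7 7 o (~ 9) (~ 7) (~ 171) (~ 297) o o (+ 138) (~ 6) ∷
  at3 8 4 4 (~ 117) (~ 90) (~ 1) (~ 54) (~ 56) o (~ 54) (~ 28) o ∷
  at3 8 4 5 o o o o o o o (~ 14) (+ 2) ∷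
  at3 8 4 6 (~ 63) (~ 6) (+ 13) (~ 54) o (+ 14) (+ 54) (+ 14) (+ 2) ∷
  at3 8 5 4 o (~ 28) o o (~ 70) (+ 2) o o o ∷
  at3 8 5 5 (+ 252) (+ 80) (~ 24) (~ 225) o (~ 9) (+ 657) (+ 84) (~ 11) ∷
  at3 8 5 6 o o o o o (+ 16) (+ 657) (+ 84) (~ 11) ∷
  at3 8 6 4 (~ 63) (~ 6) (+ 13) (+ 54) (~ 14) (+ 2) (~ 54) o (+ 14) ∷
  at3 8 6 5 o o o (~ 225) o (~ 9) o o (+ 16) ∷
  at3 8 6 6 (~ 9) (~ 6) (~ 1) (+ 54) o (+ 2) (+ 54) o (+ 2) ∷ []

certificate-ζ : Cert 3
certificate-ζ =
  at3 4 4 4 (~ 198) (~ 204) (~ 14) (+ 108) (+ 126) (~ 4) (+ 108) (+ 90) (+ 20) ∷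
  at3 4 4 5 o o o o (+ 50) (+ 24) (+ 108) (+ 24) o ∷
  at3 4 4 6 (+ 18) (+ 28) (+ 14) o (~ 16) (~ 12) o (~ 66) (~ 20) ∷
  at3 4 5 4 o (+ 32) o (+ 108) (+ 240) o o (~ 114) o ∷
  at3 4 5 5 (+ 252) (+ 312) o (~ 216) (~ 242) (+ 12) (~ 216) (~ 330) o ∷
  at3 4 6 4 (+ 18) (~ 64) (+ 2) o (+ 114) (+ 4) o (+ 76) o ∷
  at3 5 4 4 (~ 90) (~ 522) (~ 36) o (+ 182) (~ 4) o o (+ 20) ∷
  at3 5 4 5 (~ 2803) (~ 267) (~ 28) o (+ 215) (+ 52) (+ 3028) o (+ 22) ∷
  at3 5 4 6 (~ 792) (~ 140) (+ 2) (+ 800) (+ 467) (+ 56) (+ 2788) (~ 233) (~ 12) ∷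
  at3 5 4 7 (~ 57) (+ 34) (~ 2) o (~ 52) o (~ 240) (~ 233) (~ 14) ∷
  at3 5 5 4 (+ 2037) (~ 434) o (~ 1812) (+ 1031) (~ 2) o (~ 267) o ∷
  at3 5 5 5 (~ 746) (+ 570) (~ 82) (~ 1452) (+ 289) (~ 14) (+ 2660) (~ 497) (+ 158) ∷
  at3 5 5 6 (~ 2505) (+ 197) (+ 150) (+ 2706) o (~ 120) (+ 162) (~ 29) (+ 156) ∷
  at3 5 5 7 (+ 111) (~ 14) (~ 14) (~ 63) o o (~ 30) (~ 52) (~ 6) ∷
  at3 5 6 4 (+ 408) (~ 216) (~ 12) (~ 2052) (+ 855) (~ 50) o (+ 326) (+ 84) ∷
  at3 5 6 5 (+ 2565) (+ 227) (~ 160) (+ 6) (~ 79) (+ 12) (~ 2322) o (+ 178) ∷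
  at3 5 6 6 (+ 42) (+ 4) (+ 26) (~ 81) (~ 174) o (~ 375) (~ 256) (~ 156) ∷
  at3 5 7 4 (~ 57) (~ 53) (+ 52) (~ 240) (+ 6) (~ 52) o (+ 115) (~ 42) ∷
  at3 5 7 5 (+ 447) (+ 138) (+ 170) (~ 114) (+ 30) (~ 10) (~ 441) o (~ 160) ∷
  at3 6 4 4 (+ 180) (~ 612) (~ 32) (+ 999) (+ 805) o (~ 879) (~ 733) o ∷
  at3 6 4 5 (~ 4112) (~ 277) (~ 28) (~ 893) (~ 430) o (+ 738) (~ 476) o ∷
  at3 6 4 6 (~ 2472) (~ 836) (~ 82) (+ 750) (+ 680) (+ 82) (+ 1452) (+ 40) (+ 2) ∷
  at3 6 4 7 (+ 2005) (+ 1) o o (~ 70) o (~ 327) (~ 343) (~ 4) ∷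
  at3 6 4 8 (~ 153) (~ 35) (~ 4) (~ 144) (~ 114) (~ 4) (~ 162) (~ 126) (~ 6) ∷
  at3 6 5 4 (+ 3564) (~ 1399) (~ 20) (+ 738) (+ 1548) (+ 28) (+ 401) (~ 114) (+ 20) ∷
  at3 6 5 5 (~ 1208) (+ 141) (~ 158) (~ 3477) (+ 453) (~ 72) (+ 3147) (~ 1201) (+ 106) ∷
  at3 6 5 6 (~ 4279) (~ 232) (+ 320) (+ 759) (+ 587) (+ 58) (+ 2664) (~ 225) (+ 166) ∷
  at3 6 5 7 (+ 111) (+ 26) (+ 296) (+ 153) (+ 186) (+ 4) (~ 81) (+ 40) (~ 6) ∷
  at3 6 5 8 (~ 108) (~ 79) (~ 8) (~ 18) (~ 114) o o (~ 32) o ∷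
  at3 6 6 4 (+ 522) (~ 928) (~ 68) (~ 300) (+ 1258) (~ 20) (+ 510) (+ 500) (+ 142) ∷
  at3 6 6 5 (+ 2113) (~ 199) (~ 522) (~ 1974) (+ 1173) (~ 80) (+ 603) (+ 595) (+ 222) ∷
  at3 6 6 6 (~ 66) (~ 36) (~ 48) (+ 114) (+ 50) (+ 20) (+ 408) (+ 418) (+ 94) ∷
  at3 6 6 7 o (~ 18) (+ 4) o o o (+ 60) (+ 72) (+ 10) ∷
  at3 6 6 8 (~ 108) o (~ 4) (+ 126) o (+ 4) (~ 18) (~ 12) (~ 2) ∷
  at3 6 7 4 (~ 1509) (+ 43) (+ 52) (+ 51) (+ 593) (~ 50) o (+ 232) o ∷
  at3 6 7 5 (+ 447) (+ 119) (+ 170) (+ 141) (+ 82) (~ 60) (+ 669) (+ 596) (+ 24) ∷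
  at3 6 7 6 o (~ 18) (+ 4) (~ 66) (~ 62) (+ 2) (+ 138) (+ 50) (+ 16) ∷
  at3 6 7 7 (~ 108) (~ 56) (~ 126) o (~ 82) (~ 6) (~ 126) (~ 28) (~ 10) ∷
  at3 6 8 4 (~ 405) (~ 175) (~ 4) (+ 90) (+ 78) (~ 2) (+ 108) (+ 90) o ∷
  at3 6 8 5 (~ 108) (~ 60) (+ 110) o (+ 30) (~ 4) (+ 108) (+ 144) o ∷
  at3 6 8 6 (~ 108) o (~ 4) (~ 18) (~ 12) (~ 2) o (+ 54) o ∷
  at3 7 4 4 (~ 162) (~ 474) (~ 12) (+ 999) (+ 693) o (~ 879) (~ 755) o ∷
  at3 7 4 5 (~ 1309) (~ 466) o o (~ 294) o (~ 1873) (~ 640) (+ 26) ∷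
  at3 7 4 6 (~ 1626) (~ 1100) (~ 110) (~ 311) (~ 115) (+ 22) (~ 3389) (+ 23) (+ 30) ∷
  at3 7 4 7 (+ 2062) (~ 17) (~ 14) o (+ 37) o (~ 2395) (~ 92) (+ 4) ∷
  at3 7 4 8 (+ 45) (+ 137) (+ 22) o (+ 19) o o o o ∷
  at3 7 5 4 (+ 1527) (~ 933) (~ 20) (+ 2841) (+ 871) (+ 6) o (~ 344) o ∷
  at3 7 5 5 (+ 910) (~ 147) (~ 64) o o o (+ 588) (~ 989) (~ 38) ∷
  at3 7 5 6 (~ 1774) (~ 1239) (+ 118) (~ 268) (~ 67) (+ 268) (~ 1304) (~ 1259) (~ 118) ∷
  at3 7 5 7 o (+ 114) (+ 332) o (~ 311) (+ 236) (~ 300) (~ 483) (~ 80) ∷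
  at3 7 5 8 (~ 108) (~ 79) (~ 8) o (+ 19) o o (+ 23) o ∷
  at3 7 6 4 o (~ 976) (~ 78) (+ 2793) (~ 8) (+ 12) (+ 715) (+ 122) o ∷
  at3 7 6 5 (+ 64) (~ 510) (~ 398) (~ 506) (+ 582) (~ 124) (+ 842) o (~ 182) ∷
  at3 7 6 6 (~ 1162) (~ 1018) (~ 150) (~ 257) (+ 8) (+ 246) (~ 257) (~ 124) (~ 182) ∷
  at3 7 6 7 o (~ 17) o (~ 72) (~ 324) (+ 236) (~ 147) o o ∷ at3 7 6 8 o o (~ 32) o o o o o o ∷
  at3 7 7 4 (~ 1116) o o (+ 951) (~ 65) (+ 6) o (~ 33) o ∷
  at3 7 7 5 o (~ 161) o (~ 450) (+ 340) (~ 124) (~ 150) (+ 259) (~ 118) ∷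
  at3 7 7 6 o (~ 17) o (~ 147) o o (~ 222) (+ 316) o ∷
  at3 7 7 7 (~ 108) (~ 52) (~ 126) o o o o o (+ 118) ∷
  at3 7 8 4 (+ 297) (+ 109) (+ 22) o (+ 121) o o o o ∷
  at3 7 8 5 (~ 108) (~ 60) (+ 110) o (+ 4) o o o (+ 118) ∷
  at3 7 8 6 o o (~ 32) o o o o o (+ 118) ∷
  at3 8 4 4 (~ 234) (~ 180) (~ 2) (~ 108) (~ 56) o (~ 108) (~ 112) o ∷
  at3 8 4 5 o (~ 456) o o (~ 344) o o (~ 280) (+ 8) ∷
  at3 8 4 6 (+ 36) (~ 432) (~ 40) (+ 216) (~ 288) (~ 28) o (~ 408) (+ 16) ∷
  at3 8 4 7 o (+ 16) (~ 16) o o o (~ 432) (~ 424) (+ 8) ∷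
  at3 8 4 8 (+ 198) (+ 172) (+ 26) (~ 108) o (+ 28) (~ 324) (~ 184) o ∷
  at3 8 5 4 o o o o (~ 56) (+ 8) o o o ∷
  at3 8 5 5 (+ 1120) (~ 30) (+ 12) (~ 168) (~ 522) o (+ 2334) (+ 180) (+ 40) ∷
  at3 8 5 6 o (~ 810) (~ 52) (+ 1896) (+ 98) (+ 6) (+ 1956) (~ 602) (~ 6) ∷
  at3 8 5 7 o (+ 74) (+ 22) o (~ 390) (+ 24) (~ 378) (~ 782) (~ 46) ∷
  at3 8 5 8 o o o o o (+ 32) o o o ∷
  at3 8 6 4 (~ 132) (~ 200) (~ 24) (~ 504) (~ 240) (+ 16) (+ 216) (+ 112) (~ 12) ∷
  at3 8 6 5 (+ 516) (~ 84) (~ 36) (~ 996) (~ 428) (~ 48) (+ 1644) (+ 244) (+ 16) ∷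
  at3 8 6 6 (~ 1054) (~ 978) (~ 76) (+ 1407) (+ 143) (+ 34) (+ 1155) (~ 111) (+ 28) ∷
  at3 8 6 7 o (+ 1) (~ 4) (~ 114) (~ 474) (+ 42) (~ 399) (~ 255) (+ 26) ∷
  at3 8 6 8 (+ 108) o (~ 28) (+ 108) o (+ 4) (~ 126) (~ 12) (+ 26) ∷
  at3 8 7 4 (+ 336) (~ 96) o (~ 1440) (~ 536) (+ 8) o o (+ 16) ∷
  at3 8 7 5 o (~ 142) o (~ 828) (~ 250) (~ 48) (~ 198) o (+ 16) ∷
  at3 8 7 6 o (+ 1) (~ 4) (~ 399) (~ 255) (+ 26) (~ 312) (~ 84) (+ 18) ∷
  at3 8 7 7 o (+ 4) o (~ 114) (~ 84) (+ 18) (~ 114) (~ 84) (+ 18) ∷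
  at3 8 8 4 (+ 702) (+ 284) (+ 26) (~ 828) (~ 296) o (~ 108) o (+ 28) ∷
  at3 8 8 5 o o o o o o o o (+ 32) ∷
  at3 8 8 6 (+ 108) o (~ 28) (~ 126) (~ 12) (+ 26) (+ 108) o (+ 4) ∷ []

certificate-γ : Cert 3
certificate-γ =
  at3 4 4 4 (+ 468) (+ 72) (~ 28) (~ 216) (~ 528) (~ 208) (~ 216) (+ 480) (+ 240) ∷
  at3 4 4 5 o o o o (~ 112) o o (+ 408) (+ 248) ∷
  at3 4 4 6 (+ 252) (+ 24) (~ 52) (~ 216) o (+ 56) (+ 216) (~ 72) (+ 8) ∷
  at3 4 5 4 o o o o (~ 264) (~ 200) o o o ∷
  at3 4 5 5 (+ 144) (+ 176) o o (~ 176) (+ 16) o o o ∷ at3 4 5 6 o o o o o (+ 64) o o o ∷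
  at3 4 6 4 (+ 252) (+ 24) (~ 52) (+ 216) (+ 264) (+ 8) (~ 216) o (+ 56) ∷
  at3 4 6 5 o o o o (~ 64) (+ 16) o o (+ 64) ∷
  at3 4 6 6 (+ 36) (+ 24) (+ 4) (+ 216) o (+ 8) (+ 216) o (+ 8) ∷
  at3 5 4 4 (+ 756) (+ 36) (~ 72) (+ 168) o (~ 208) (~ 216) (+ 244) (+ 240) ∷
  at3 5 4 5 (~ 2525) (+ 677) (+ 313) o o (~ 53) (+ 3083) o (+ 232) ∷
  at3 5 4 6 (+ 726) (+ 882) (+ 180) o (~ 116) o (+ 3215) (~ 478) (~ 12) ∷
  at3 5 4 7 (+ 300) (~ 6) (~ 52) o (+ 38) (+ 16) (~ 84) (~ 234) (~ 4) ∷
  at3 5 5 4 (+ 5832) (+ 462) (~ 100) (~ 5082) o (~ 320) o (~ 210) (+ 16) ∷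
  at3 5 5 5 (~ 363) (~ 583) (~ 414) o (+ 194) (+ 514) (+ 859) (+ 456) (~ 165) ∷
  at3 5 5 6 (+ 574) (+ 2599) (+ 513) o (~ 1997) (~ 249) (+ 127) o (~ 241) ∷
  at3 5 5 7 (+ 84) (~ 3197) (+ 36) o (+ 3267) (+ 16) (~ 732) (~ 666) (~ 60) ∷
  at3 5 6 4 (+ 714) (+ 498) (~ 164) (~ 5310) (+ 84) (~ 128) o (~ 194) (~ 92) ∷
  at3 5 6 5 (+ 180) (~ 517) (~ 475) o o (+ 443) (+ 28) (+ 293) (+ 279) ∷
  at3 5 6 6 (+ 118) (+ 126) (+ 180) o (~ 2189) (~ 249) (+ 28) (+ 293) (+ 287) ∷
  at3 5 6 7 (+ 450) (+ 248) (+ 100) o (+ 3013) o o (~ 194) (~ 84) ∷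
  at3 5 7 4 (+ 312) (+ 372) (~ 36) (~ 60) (+ 84) (~ 16) o o o ∷
  at3 5 7 5 (+ 450) (+ 580) (+ 132) o (~ 194) (~ 124) o (~ 340) (~ 80) ∷
  at3 5 7 6 (+ 420) (+ 36) (+ 116) o (~ 308) o (+ 60) (~ 340) (~ 80) ∷
  at3 5 7 7 (+ 372) (+ 60) (+ 28) o (~ 216) o (+ 60) o o ∷
  at3 6 4 4 (+ 72) (~ 168) (~ 64) (+ 384) o o o (+ 288) o ∷
  at3 6 4 5 (~ 3286) (~ 2424) (~ 728) o (+ 700) (+ 1377) o (+ 811) (+ 33) ∷
  at3 6 4 6 (+ 3888) (+ 1588) (+ 256) o (+ 61) (+ 365) (~ 582) (+ 185) (+ 37) ∷
  at3 6 4 7 (+ 4103) (+ 288) (~ 52) o o o (~ 618) (~ 362) o ∷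
  at3 6 4 8 (~ 216) (~ 168) (~ 8) o o o (~ 36) (~ 24) (~ 4) ∷
  at3 6 5 4 (+ 9084) (+ 2004) (~ 68) (+ 1260) (~ 2124) o (+ 864) (+ 2192) (~ 76) ∷
  at3 6 5 5 (~ 507) (~ 115) (+ 143) (+ 854) (+ 261) (+ 1377) (+ 1712) (+ 1915) (~ 911) ∷
  at3 6 5 6 (+ 1520) (+ 1597) (~ 320) (+ 760) (+ 1112) (+ 932) (+ 148) (+ 421) (~ 787) ∷
  at3 6 5 7 (+ 4142) (~ 5185) (+ 36) o (+ 1290) o (~ 1420) (+ 346) (+ 48) ∷
  at3 6 5 8 (~ 432) (~ 3617) (~ 32) (~ 864) (~ 240) (+ 16) (~ 720) (~ 352) o ∷
  at3 6 6 4 (~ 1590) (+ 1538) (~ 100) (+ 10107) (+ 769) (~ 32) (~ 1389) (~ 1693) o ∷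
  at3 6 6 5 (+ 180) (+ 2936) (~ 475) (+ 198) (~ 4093) o (~ 20) (~ 1131) (~ 531) ∷
  at3 6 6 6 (~ 1645) (~ 1246) (+ 123) (+ 504) (+ 1321) (+ 973) (+ 1244) (~ 221) (~ 1309) ∷
  at3 6 6 7 (+ 450) (+ 891) (+ 780) o o (~ 596) (~ 125) (~ 745) (~ 836) ∷
  at3 6 6 8 (+ 162) (~ 316) (~ 38) (~ 1080) (~ 366) (~ 2) o (+ 38) (~ 58) ∷
  at3 6 7 4 (~ 14235) (~ 1763) (~ 36) (+ 9231) (+ 2893) (~ 32) (+ 6546) (+ 3265) o ∷
  at3 6 7 5 (~ 10762) (+ 1268) (+ 132) (~ 1376) (~ 4010) o (+ 6590) (+ 3632) (+ 104) ∷
  at3 6 7 6 (+ 420) (~ 3399) (~ 304) (~ 256) (+ 310) (+ 350) (~ 272) (+ 1517) (+ 710) ∷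
  at3 6 7 7 (+ 372) (+ 1035) (+ 24) o (~ 1290) (~ 600) (~ 316) (+ 1150) (+ 604) ∷
  at3 6 7 8 (+ 378) (+ 3205) (~ 32) (~ 252) (~ 150) (~ 22) o o (~ 2) ∷
  at3 6 8 4 (~ 216) (+ 168) (~ 8) o o o (+ 36) (+ 24) (+ 4) ∷
  at3 6 8 5 (+ 666) (+ 662) (~ 32) (~ 720) (~ 356) o (~ 828) (~ 204) (+ 24) ∷
  at3 6 8 6 (+ 1230) (~ 222) (~ 40) o (+ 40) (~ 56) (~ 1080) (~ 336) (+ 8) ∷
  at3 6 8 7 (+ 348) (~ 644) (~ 32) o o (~ 4) (~ 216) (~ 108) (~ 12) ∷
  at3 6 8 8 o (~ 156) (+ 12) (~ 36) (~ 24) (~ 4) o o o ∷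
  at3 7 4 4 (~ 252) (~ 156) (~ 24) o (~ 528) o o (+ 524) o ∷
  at3 7 4 5 (~ 761) (~ 6727) (~ 2247) (~ 696) (~ 1290) (+ 1282) (+ 1021) (~ 459) (~ 1065) ∷
  at3 7 4 6 (+ 678) (~ 50) o (+ 2656) (+ 1091) (~ 913) (+ 938) (+ 175) (~ 1109) ∷
  at3 7 4 7 (+ 3803) (+ 434) o (+ 2636) (+ 1492) o (~ 83) (+ 1274) (~ 44) ∷
  at3 7 4 8 o (~ 180) (~ 12) o o o o (+ 116) o ∷
  at3 7 5 4 (+ 3252) (+ 2610) o (+ 3990) (~ 3780) (+ 44) o (+ 3434) (+ 72) ∷
  at3 7 5 5 o (~ 824) (~ 95) (+ 1528) (~ 1199) (+ 2612) o (+ 3613) (+ 135) ∷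
  at3 7 5 6 (~ 2152) o (+ 607) (+ 5046) (+ 3571) (~ 1844) (~ 2380) o (~ 565) ∷
  at3 7 5 7 (+ 3334) (~ 4352) o (+ 4916) o (~ 696) (~ 2380) (+ 1206) (~ 628) ∷
  at3 7 5 8 (~ 432) (~ 4826) (+ 48) o (~ 1928) o o (+ 1385) o ∷
  at3 7 6 4 (~ 1260) (+ 1720) (+ 12) (+ 19131) (~ 1619) o (~ 4497) (~ 3141) (+ 160) ∷
  at3 7 6 5 o (+ 3453) o (+ 12400) (~ 703) (+ 1194) (~ 6491) (~ 2312) (+ 1902) ∷
  at3 7 6 6 (~ 3237) (~ 2038) (+ 191) (+ 1992) (+ 5982) (~ 351) (~ 4392) (~ 537) (+ 1772) ∷
  at3 7 6 7 o (~ 742) (+ 30) (+ 1496) (~ 3451) (~ 696) (~ 3220) (~ 1656) o ∷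
  at3 7 6 8 (+ 198) (~ 604) (~ 62) (~ 810) (~ 4200) (~ 20) (~ 822) (~ 290) (~ 30) ∷
  at3 7 7 4 (~ 16851) (~ 3411) o (+ 15141) (+ 1437) (~ 44) o (~ 270) o ∷
  at3 7 7 5 (~ 12652) o o (+ 9444) (~ 1680) (~ 136) (~ 792) o (~ 124) ∷
  at3 7 7 6 o (~ 3789) (~ 420) (~ 1566) (+ 3167) (+ 572) (~ 792) (+ 846) (~ 124) ∷
  at3 7 7 7 o (+ 975) (~ 20) (~ 1208) (~ 1461) o o (~ 122) o ∷
  at3 7 7 8 (+ 378) (+ 3205) (~ 144) (~ 606) (~ 1965) (~ 40) o (~ 698) o ∷
  at3 7 8 4 o (+ 420) (~ 36) o (~ 196) o o o o ∷
  at3 7 8 5 (+ 666) (+ 1198) (~ 32) (~ 732) (~ 886) o o o o ∷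
  at3 7 8 6 (+ 978) (~ 360) (~ 40) (~ 1168) (~ 335) (~ 8) o (~ 229) o ∷
  at3 7 8 7 (+ 60) (~ 1372) (~ 64) (~ 424) (+ 498) o (~ 192) (~ 412) o ∷
  at3 7 8 8 (~ 252) (~ 444) (+ 8) (+ 204) (+ 307) (~ 20) (~ 192) (~ 183) o ∷
  at3 8 4 4 (~ 36) (~ 24) (~ 4) o o o o o o ∷
  at3 8 4 5 o (~ 3626) (~ 1206) (~ 1152) (~ 1798) o (+ 1944) (~ 2922) (~ 1190) ∷
  at3 8 4 6 (~ 2736) (~ 780) (~ 24) (~ 1800) (~ 1090) (~ 1174) (+ 1728) (~ 3042) (~ 1206) ∷
  at3 8 4 7 o (+ 140) o o o o (+ 180) (+ 12) (~ 16) ∷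
  at3 8 4 8 (+ 216) (~ 12) (~ 4) (+ 648) (+ 144) o (+ 396) (+ 132) o ∷
  at3 8 5 4 o (+ 1068) (~ 32) (+ 216) (+ 24) (~ 16) o (+ 1124) o ∷
  at3 8 5 5 o (~ 1468) (~ 652) (~ 2448) (~ 1684) (+ 442) (+ 2160) (~ 1336) (~ 1030) ∷
  at3 8 5 6 (~ 3098) (+ 1002) (+ 1440) (~ 3964) (~ 1190) (~ 1778) (+ 1946) (+ 518) (~ 1094) ∷
  at3 8 5 7 (~ 724) (~ 2364) o (~ 436) (+ 45) o (~ 214) (+ 3995) (~ 64) ∷
  at3 8 5 8 o (~ 1209) (+ 80) (+ 864) (+ 288) (+ 96) o (+ 1017) o ∷
  at3 8 6 4 (+ 792) (+ 656) o (+ 3456) (+ 1128) (~ 8) o (~ 232) o ∷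
  at3 8 6 5 o o o o o (+ 330) o (~ 118) (+ 650) ∷
  at3 8 6 6 (~ 1510) (~ 690) (+ 244) (~ 3892) (~ 454) (~ 724) (~ 1078) (+ 1432) (+ 1204) ∷
  at3 8 6 7 o (~ 1385) (~ 650) (~ 436) (+ 45) o (~ 1474) (+ 1318) (+ 554) ∷
  at3 8 6 8 (+ 36) (~ 288) (~ 24) o (+ 144) (+ 192) (~ 396) o o ∷
  at3 8 7 4 (~ 2304) (~ 1276) o (+ 2988) (+ 1092) (+ 32) o o o ∷
  at3 8 7 5 (~ 1440) (~ 688) o (+ 1296) (~ 114) (~ 112) o (~ 354) (~ 48) ∷
  at3 8 7 6 o (~ 354) o (~ 1692) (~ 360) (~ 144) (~ 864) (~ 786) (~ 96) ∷
  at3 8 7 7 o o (~ 16) o o o (~ 864) (~ 432) (~ 48) ∷ at3 8 7 8 o o (~ 112) o o (+ 96) o o o ∷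
  at3 8 8 4 (+ 216) (+ 252) (~ 28) (~ 252) (~ 12) (+ 24) o (+ 264) o ∷
  at3 8 8 5 o (+ 536) o o o o (+ 216) (+ 1176) (+ 16) ∷
  at3 8 8 6 (~ 252) (~ 138) o (+ 36) (~ 6) (~ 24) (+ 432) (+ 1824) (+ 32) ∷
  at3 8 8 7 (~ 288) (~ 728) (~ 32) o o o (+ 216) (+ 1176) (+ 16) ∷
  at3 8 8 8 (~ 252) (~ 288) (~ 4) (+ 216) o o o (+ 264) o ∷ []

certificate-s7 : Cert 3
certificate-s7 =
  at3 4 4 4 (+ 234) (+ 60) (+ 6) (~ 108) o o (~ 108) (~ 48) (~ 4) ∷
  at3 4 4 5 o (+ 184) o o (~ 200) o o o o ∷
  at3 4 4 6 (+ 126) (+ 68) (+ 2) (~ 108) (~ 56) o (+ 108) (+ 48) (+ 4) ∷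
  at3 4 5 4 o (~ 288) o o (+ 84) (+ 4) o (+ 232) o ∷
  at3 4 5 5 (+ 72) o o o (~ 144) (+ 8) o (+ 232) o ∷ at3 4 5 6 o o o o (~ 28) (+ 4) o o o ∷
  at3 4 6 4 (+ 126) (+ 12) (~ 26) (+ 108) (+ 84) (+ 4) (~ 108) o (+ 28) ∷
  at3 4 6 5 o o o o (+ 56) (+ 8) o o (+ 32) ∷
  at3 4 6 6 (+ 18) (+ 12) (+ 2) (+ 108) (+ 28) (+ 4) (+ 108) o (+ 4) ∷
  at3 5 4 4 (~ 198) (~ 198) (+ 4) (~ 216) (+ 600) (+ 16) (+ 576) (~ 254) o ∷
  at3 5 4 5 (+ 223) (+ 45) (+ 22) o (+ 219) o (+ 398) o o ∷
  at3 5 4 6 (+ 399) (+ 707) (+ 26) o (~ 205) o (~ 292) (+ 174) (~ 6) ∷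
  at3 5 4 7 (+ 114) (+ 132) (+ 10) o o o (~ 114) (~ 80) (~ 6) ∷
  at3 5 5 4 (~ 1922) (+ 120) (+ 32) (+ 1706) o o (+ 216) o o ∷
  at3 5 5 5 (+ 1163) (+ 195) (~ 6) (+ 636) o o (~ 1426) o o ∷
  at3 5 5 6 (+ 795) (~ 449) (~ 616) (~ 764) (+ 374) (+ 650) (~ 1372) (+ 34) (~ 46) ∷
  at3 5 5 7 (+ 360) (+ 1788) (+ 18) o (~ 1696) o (+ 270) (+ 34) (~ 46) ∷
  at3 5 6 4 (+ 370) (~ 602) (~ 134) (+ 1776) (~ 427) (~ 40) o (+ 495) (+ 124) ∷
  at3 5 6 5 (~ 428) (~ 217) (+ 292) (+ 1662) (~ 246) (~ 302) o (+ 97) (+ 124) ∷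
  at3 5 6 6 (+ 742) (+ 704) (+ 70) (~ 2078) (~ 575) (+ 610) o o o ∷
  at3 5 6 7 o (+ 324) (+ 22) (+ 450) (~ 1962) o o (+ 398) o ∷
  at3 5 7 4 (~ 2530) (~ 723) (~ 18) (~ 290) (~ 103) o (+ 1704) (+ 869) o ∷
  at3 5 7 5 (~ 870) (~ 1488) (+ 26) (+ 1098) (+ 45) (~ 294) (+ 2496) (+ 2285) o ∷
  at3 5 7 6 o (+ 94) (+ 58) (~ 1242) (~ 1150) (~ 40) o (+ 1416) o ∷
  at3 5 7 7 o (+ 58) (+ 14) (+ 450) (~ 266) o (~ 792) o o ∷
  at3 6 4 4 (~ 540) (~ 444) (~ 16) o (+ 890) (+ 20) o (~ 914) (+ 4) ∷
  at3 6 4 5 (~ 256) (~ 847) (~ 42) (~ 42) (+ 1398) (+ 18) (+ 909) (~ 2119) (+ 104) ∷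
  at3 6 4 6 (~ 348) (+ 602) (~ 66) (+ 896) (+ 914) (+ 170) (+ 636) (~ 1814) (+ 102) ∷
  at3 6 4 7 (+ 134) (+ 996) (+ 10) o (~ 143) (+ 36) (~ 399) (~ 625) (+ 4) ∷
  at3 6 4 8 (~ 108) (~ 48) (~ 4) (~ 108) (~ 4) (+ 4) (~ 126) (~ 16) (+ 2) ∷
  at3 6 5 4 (~ 3196) (+ 1724) (+ 228) o (+ 1392) (+ 44) o (~ 934) (~ 164) ∷
  at3 6 5 5 (+ 684) (+ 2082) (+ 94) (~ 36) (+ 802) (~ 58) o (~ 1358) (~ 182) ∷
  at3 6 5 6 (~ 272) (~ 1165) (~ 974) (+ 1698) (+ 1410) (~ 60) (~ 436) (~ 916) (~ 94) ∷
  at3 6 5 7 (+ 266) (+ 3180) (~ 646) (~ 276) (~ 316) (+ 72) (~ 436) (~ 436) (~ 92) ∷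
  at3 6 5 8 (+ 378) (+ 1646) (~ 24) o (+ 80) o o (+ 56) (~ 16) ∷
  at3 6 6 4 (~ 970) (+ 50) (~ 32) (+ 1584) (+ 592) (~ 86) (~ 240) (~ 362) (~ 42) ∷
  at3 6 6 5 (+ 83) (~ 767) (+ 620) (+ 114) (+ 986) (~ 48) (~ 339) (~ 641) (~ 86) ∷
  at3 6 6 6 (+ 53) (+ 497) (+ 376) (+ 778) (+ 436) (~ 242) (+ 160) (~ 2) (~ 66) ∷
  at3 6 6 7 (~ 930) (+ 931) (~ 2) (~ 132) (~ 123) (+ 56) (+ 79) (+ 127) (~ 40) ∷
  at3 6 6 8 (+ 450) (+ 870) o o (+ 78) (~ 14) (~ 180) (~ 150) (~ 18) ∷
  at3 6 7 4 (~ 636) (~ 1530) (~ 138) (~ 234) (~ 194) (~ 12) o (~ 6) o ∷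
  at3 6 7 5 (+ 1108) (~ 2359) (~ 56) o (+ 74) (+ 20) (+ 22) o o ∷
  at3 6 7 6 (+ 890) (+ 248) (+ 730) o (+ 24) o (+ 60) (+ 64) o ∷
  at3 6 7 7 (~ 1440) (~ 201) (+ 642) (~ 60) (+ 156) (+ 20) (+ 38) (~ 82) o ∷
  at3 6 7 8 (~ 594) (~ 1060) (+ 26) (~ 432) (~ 100) (~ 12) o (~ 140) o ∷
  at3 6 8 4 (~ 2928) (~ 854) (+ 6) (~ 126) (~ 68) (~ 2) (~ 108) (~ 56) o ∷
  at3 6 8 5 (~ 1140) (~ 1592) (~ 278) o o o o (~ 56) (+ 8) ∷
  at3 6 8 6 (+ 1302) (~ 302) (~ 290) (~ 180) (~ 160) (~ 28) o (~ 120) o ∷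
  at3 6 8 7 (~ 1044) (~ 10) (~ 16) o (+ 146) o (+ 198) (~ 38) (~ 8) ∷
  at3 6 8 8 (~ 558) (~ 236) (+ 6) (~ 324) (~ 94) (~ 2) (+ 306) (+ 82) o ∷
  at3 7 4 4 (+ 450) (~ 54) (~ 20) o (+ 138) o o (~ 412) o ∷
  at3 7 4 5 (~ 479) (~ 652) (~ 64) (~ 906) (+ 422) (~ 68) (+ 1195) (~ 1904) (+ 26) ∷
  at3 7 4 6 (~ 1881) (~ 587) (~ 94) o (+ 550) o (+ 842) (~ 3303) o ∷
  at3 7 4 7 (+ 20) (+ 654) o o (~ 593) o (~ 353) (~ 2039) (~ 26) ∷
  at3 7 4 8 o (~ 30) (~ 10) o (~ 254) o o (~ 228) o ∷
  at3 7 5 4 (~ 1274) (+ 1228) (+ 196) (~ 1058) (+ 1976) (+ 212) o (~ 322) o ∷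
  at3 7 5 5 (+ 295) (+ 2211) (+ 100) (~ 1498) (+ 2395) (~ 258) (+ 1749) (~ 586) (+ 300) ∷
  at3 7 5 6 (~ 1699) (~ 1213) (~ 326) o o (~ 500) (+ 1466) (~ 291) (+ 280) ∷
  at3 7 5 7 o o (~ 294) o o (~ 672) (~ 691) (~ 137) (~ 60) ∷
  at3 7 5 8 (+ 810) (+ 1126) (~ 26) (+ 252) (+ 1122) (~ 52) (~ 408) (~ 110) (~ 40) ∷
  at3 7 6 4 (+ 442) (+ 1024) (+ 74) (+ 60) (+ 2290) (+ 200) (~ 216) (+ 90) (+ 100) ∷
  at3 7 6 5 o (+ 560) (+ 468) o (+ 2397) (~ 192) (~ 94) o (+ 206) ∷
  at3 7 6 6 (~ 376) (~ 264) (~ 104) (~ 1086) (~ 1036) o (+ 630) (~ 310) (+ 144) ∷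
  at3 7 6 7 (~ 408) (+ 530) (~ 32) (+ 604) (+ 947) (~ 672) (+ 508) (~ 220) (+ 38) ∷
  at3 7 6 8 (~ 126) (~ 56) (~ 26) (+ 450) (+ 1910) (~ 64) o o o ∷
  at3 7 7 4 (~ 1054) (+ 54) (~ 10) (+ 1874) (+ 776) (~ 12) o o o ∷
  at3 7 7 5 (~ 1772) (~ 984) (+ 180) (+ 1240) (+ 1022) o o o (~ 262) ∷
  at3 7 7 6 o (~ 438) (~ 424) (~ 1158) (~ 452) (+ 500) (~ 186) (~ 326) (~ 262) ∷
  at3 7 7 7 (~ 368) (+ 206) (~ 410) (+ 676) (+ 362) o (~ 186) (~ 728) o ∷
  at3 7 7 8 (~ 270) (+ 208) (~ 10) (+ 198) (+ 534) (~ 12) o (~ 402) o ∷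
  at3 8 4 4 (+ 558) (+ 132) (~ 6) (~ 108) (~ 152) (~ 4) (+ 684) (+ 296) o ∷
  at3 8 4 5 o (+ 56) o (~ 864) (~ 288) o (+ 2088) (+ 992) (+ 8) ∷
  at3 8 4 6 (~ 1260) (~ 550) (~ 4) (~ 648) (+ 42) (+ 24) (+ 1296) (+ 840) o ∷
  at3 8 4 7 o (~ 210) o o o o (~ 342) (+ 134) (~ 8) ∷
  at3 8 4 8 (+ 108) (+ 18) (~ 6) (~ 108) (+ 20) (~ 4) (~ 234) (~ 10) o ∷
  at3 8 5 4 o (~ 88) o o (~ 208) o o o o ∷
  at3 8 5 5 o (+ 152) o o (+ 126) (~ 228) (~ 216) (~ 150) (+ 244) ∷
  at3 8 5 6 o o (+ 118) o o (+ 428) (~ 432) (~ 258) (+ 226) ∷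
  at3 8 5 7 o o (+ 396) o o (+ 394) (~ 216) (+ 292) (~ 18) ∷
  at3 8 5 8 o (~ 316) o o (+ 136) o o (+ 400) o ∷
  at3 8 6 4 (~ 18) (+ 8) (~ 2) (+ 108) (~ 56) (+ 4) o (+ 20) o ∷
  at3 8 6 5 (~ 1008) o (+ 230) (+ 864) (+ 414) (~ 228) (~ 1404) (+ 326) (+ 238) ∷
  at3 8 6 6 (+ 324) (+ 114) (~ 258) (+ 648) (~ 42) (+ 404) (~ 1512) (+ 306) (+ 230) ∷
  at3 8 6 7 o o o o o (+ 394) o (+ 56) (~ 8) ∷
  at3 8 6 8 (~ 126) (~ 68) (~ 2) (+ 108) (+ 116) (+ 4) (+ 108) (+ 56) o ∷ []

certificate-s10 : Cert 3
certificate-s10 =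
  at3 4 4 4 o o o (+ 24) (+ 14) (+ 2) (~ 6) (~ 2) o ∷
  at3 4 4 5 (+ 110) (+ 72) (+ 10) o o o (~ 114) (~ 56) (~ 6) ∷
  at3 4 4 6 (+ 18) (+ 12) (+ 2) o o o (~ 108) (~ 54) (~ 6) ∷
  at3 4 5 4 o o o (+ 66) (+ 40) (+ 6) o o o ∷
  at3 4 5 5 (+ 274) (+ 295) (+ 81) (~ 303) (~ 320) (~ 73) o o o ∷
  at3 4 5 6 (+ 36) (+ 24) (+ 4) o o o o o o ∷
  at3 4 6 4 (~ 56) (~ 76) (~ 23) (+ 42) (+ 26) (+ 4) (+ 74) (+ 88) (+ 25) ∷
  at3 4 6 5 (~ 634) (~ 556) (~ 118) (~ 303) (~ 320) (~ 73) (+ 1042) (+ 765) (+ 147) ∷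
  at3 4 6 6 (+ 18) (+ 12) (+ 2) o o o (+ 968) (+ 677) (+ 122) ∷
  at3 5 4 4 o o o (+ 156) (+ 102) (+ 14) (~ 120) (~ 78) (~ 10) ∷
  at3 5 4 5 (~ 167) (~ 61) o (+ 180) (+ 103) (+ 8) o o o ∷
  at3 5 4 6 (+ 18) (+ 12) (+ 2) (+ 30) (+ 22) (+ 4) (+ 120) (+ 78) (+ 10) ∷
  at3 5 5 4 o o o (+ 186) (+ 144) (+ 22) o o o ∷ at3 5 5 5 (+ 316) (+ 327) (+ 87) o o o o o o ∷
  at3 5 5 6 o o o (+ 271) (+ 298) (+ 71) (~ 428) (~ 335) (~ 67) ∷
  at3 5 5 7 (~ 205) (~ 77) o o o o (~ 428) (~ 335) (~ 67) ∷
  at3 5 6 4 (+ 26) (~ 25) (~ 19) (+ 30) (+ 42) (+ 8) o o o ∷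
  at3 5 6 5 (~ 486) (~ 448) (~ 94) (~ 238) (~ 112) (+ 3) (+ 257) (+ 44) (~ 37) ∷
  at3 5 6 6 (+ 268) (+ 275) (+ 83) o o o (+ 111) (~ 47) (~ 47) ∷
  at3 5 6 7 (+ 53) (+ 66) (+ 12) o o o (~ 146) (~ 91) (~ 10) ∷
  at3 5 7 5 (+ 55) (+ 71) (+ 10) (~ 58) (~ 9) (+ 11) o o o ∷
  at3 5 7 6 (~ 37) (~ 95) (~ 26) (~ 241) (~ 276) (~ 67) (+ 154) (+ 7) (~ 10) ∷
  at3 5 7 7 (+ 624) (+ 583) (+ 128) o o o (+ 154) (+ 7) (~ 10) ∷
  at3 6 4 4 o o o (+ 132) (+ 104) (+ 20) (~ 114) (~ 92) (~ 18) ∷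
  at3 6 4 5 (~ 277) (~ 133) (~ 10) (~ 2) (~ 32) (~ 14) o o o ∷
  at3 6 4 6 o o o (+ 18) (+ 12) (+ 2) (+ 114) (+ 92) (+ 18) ∷
  at3 6 5 4 o o o (+ 120) (+ 112) (+ 24) o o o ∷ at3 6 5 5 o o o (+ 64) (+ 8) (~ 12) o o o ∷
  at3 6 5 6 (~ 225) (~ 116) (~ 16) (+ 190) (+ 132) (+ 18) o o o ∷
  at3 6 5 7 (~ 205) (~ 81) (~ 2) (+ 192) (+ 154) (+ 26) o o o ∷
  at3 6 6 4 (+ 82) (+ 51) (+ 4) (~ 12) (+ 8) (+ 4) (+ 18) (+ 12) (+ 2) ∷
  at3 6 6 5 o o o (+ 66) (+ 40) (+ 2) (+ 256) (+ 224) (+ 44) ∷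
  at3 6 6 6 (+ 193) (+ 278) (+ 85) (~ 31) (~ 32) (~ 1) o o o ∷
  at3 6 6 7 (+ 14) (+ 139) (+ 36) o o o (~ 256) (~ 224) (~ 44) ∷
  at3 6 6 8 (~ 156) (~ 106) (~ 18) (~ 369) (~ 252) (~ 43) (~ 18) (~ 12) (~ 2) ∷
  at3 6 7 5 (~ 93) (~ 72) (~ 32) o o o (+ 210) (+ 185) (+ 39) ∷
  at3 6 7 6 (~ 403) (~ 469) (~ 123) (~ 221) (~ 164) (~ 19) o o o ∷
  at3 6 7 7 (+ 682) (+ 617) (+ 130) (~ 192) (~ 195) (~ 47) o o o ∷
  at3 6 7 8 (+ 30) (+ 18) (+ 2) (~ 369) (~ 252) (~ 43) (+ 210) (+ 185) (+ 39) ∷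
  at3 6 8 6 o o o (~ 18) (~ 12) (~ 2) (~ 45) (+ 36) (+ 17) ∷
  at3 6 8 7 (~ 166) (~ 236) (~ 53) o (~ 41) (~ 21) (~ 63) (+ 24) (+ 15) ∷
  at3 6 8 8 (~ 190) (~ 87) (~ 4) o o o (~ 18) (~ 12) (~ 2) ∷
  at3 7 5 5 (~ 42) (~ 32) (~ 6) (+ 42) (+ 32) (+ 6) o o o ∷
  at3 7 5 6 (~ 189) (~ 92) (~ 12) (~ 126) (~ 97) (~ 16) o o o ∷
  at3 7 5 7 o (~ 4) (~ 2) (+ 120) (+ 110) (+ 24) o o o ∷
  at3 7 6 5 (~ 148) (~ 108) (~ 24) (+ 230) (+ 184) (+ 38) o o o ∷
  at3 7 6 6 (~ 75) (+ 3) (+ 2) (+ 90) (+ 76) (+ 14) (~ 85) (~ 171) (~ 48) ∷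
  at3 7 6 7 (~ 75) (+ 49) (+ 20) o o o (~ 11) (~ 105) (~ 34) ∷
  at3 7 6 8 (~ 174) (~ 118) (~ 20) (~ 81) (+ 13) (+ 14) (+ 74) (+ 66) (+ 14) ∷
  at3 7 7 5 (~ 148) (~ 143) (~ 42) (+ 188) (+ 152) (+ 32) (+ 118) (+ 79) (+ 14) ∷
  at3 7 7 6 (~ 402) (~ 398) (~ 101) (+ 186) (+ 151) (+ 26) (+ 156) (+ 142) (+ 38) ∷
  at3 7 7 7 o o o (~ 154) (~ 81) (~ 3) o o o ∷
  at3 7 7 8 (+ 30) (+ 18) (+ 2) (~ 81) (+ 13) (+ 14) (~ 38) (~ 63) (~ 24) ∷
  at3 7 8 6 (~ 18) (~ 12) (~ 2) (~ 30) (~ 22) (~ 4) (+ 109) (+ 130) (+ 24) ∷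
  at3 7 8 7 (~ 166) (~ 236) (~ 53) (~ 34) (+ 29) (+ 21) (+ 109) (+ 130) (+ 24) ∷
  at3 7 8 8 (+ 82) (+ 169) (+ 55) o o o o o o ∷ at3 8 6 6 (~ 18) (~ 12) (~ 2) o o o o o o ∷
  at3 8 6 7 (~ 36) (~ 24) (~ 4) o o o o o o ∷
  at3 8 6 8 (~ 18) (~ 12) (~ 2) (+ 6) (+ 14) (+ 4) o o o ∷
  at3 8 7 6 (~ 36) (~ 24) (~ 4) o o o (~ 2) (~ 12) (~ 6) ∷
  at3 8 7 7 (~ 58) (~ 34) (~ 2) o o o (~ 40) (~ 42) (~ 14) ∷
  at3 8 7 8 o o o o o o (~ 38) (~ 30) (~ 8) ∷
  at3 8 8 6 (~ 18) (~ 12) (~ 2) o o o (+ 88) (+ 29) (~ 4) ∷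
  at3 8 8 7 o o o o o o (~ 196) (~ 225) (~ 61) ∷
  at3 8 8 8 (+ 272) (+ 256) (+ 59) (~ 6) (~ 14) (~ 4) (~ 284) (~ 254) (~ 57) ∷ []

-- The offset 6 in the notation for exponents is due to this list: Λ has the exponents (-1, -3, 1)
-- and (-1, 1, -3), and their doubles appear as 4, 0, 8 and 4, 8, 0. The sum of the last two
-- coordinates is even throughout, as in Λ.
certificate-s18 : Cert 3
certificate-s18 =
  at3 4 0 8 (~ 216) (~ 94) (~ 8) (~ 108) (~ 50) (~ 4) (~ 576) (~ 268) (~ 24) ∷
  at3 4 1 7 o o o o (+ 52) o (~ 684) (~ 352) (~ 56) ∷
  at3 4 2 6 (+ 1440) (~ 1676) o o (+ 1478) o (+ 936) (+ 1194) (~ 192) ∷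
  at3 4 2 8 o (~ 384) o o (~ 4) o o (~ 360) o ∷
  at3 4 3 5 (+ 576) (~ 3680) (+ 60) (~ 396) (+ 2428) (+ 70) (+ 3060) (+ 2708) (~ 210) ∷
  at3 4 3 7 o (+ 1480) (+ 1128) o (~ 2546) (~ 1136) (~ 900) (~ 6394) (~ 2352) ∷
  at3 4 4 4 (+ 360) (~ 2866) (+ 220) (~ 2556) (+ 1412) (+ 146) (+ 3168) (+ 2310) (~ 178) ∷
  at3 4 4 6 (+ 504) (+ 1584) (+ 2110) (+ 864) (+ 654) (~ 856) (+ 4392) (~ 5078) (~ 2906) ∷
  at3 4 4 8 (+ 876) (~ 2204) (~ 1124) (+ 468) (+ 138) (~ 4) (+ 1620) (~ 1754) (~ 1140) ∷
  at3 4 5 3 (~ 1080) (~ 1086) (+ 228) (~ 2664) (~ 109) (+ 130) (+ 1656) (+ 795) (~ 38) ∷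
  at3 4 5 5 o (~ 24) (+ 2192) (~ 1980) (+ 6832) (+ 1160) (+ 3420) (~ 1872) (~ 1048) ∷
  at3 4 5 7 (+ 1608) (+ 828) (~ 932) (~ 3312) (~ 178) (+ 92) (~ 3636) (~ 594) (~ 688) ∷
  at3 4 6 2 o (+ 1014) (+ 176) (~ 2520) (~ 1175) (+ 48) o (~ 499) o ∷
  at3 4 6 4 (+ 396) (+ 935) (+ 1130) (~ 1980) (+ 4008) (+ 794) o (+ 111) (~ 96) ∷
  at3 4 6 6 (+ 2052) (+ 1668) o (~ 1584) o o (~ 2844) o o ∷
  at3 4 6 8 (~ 2748) (+ 242) (+ 112) (+ 576) (+ 188) o (~ 2700) (+ 306) (+ 96) ∷
  at3 4 7 1 o (+ 106) (+ 8) (~ 468) (~ 261) (~ 32) o (~ 17) o ∷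
  at3 4 7 3 o o (+ 64) (~ 684) (+ 336) (+ 8) o (+ 252) o ∷
  at3 4 7 5 (+ 1920) (+ 416) (~ 108) (+ 2232) o (~ 144) (+ 324) (+ 632) (~ 12) ∷
  at3 4 7 7 o (~ 136) o o (~ 676) o o (+ 660) o ∷
  at3 4 8 0 o (+ 2) o (~ 360) (~ 166) (~ 16) (~ 108) (~ 48) (~ 4) ∷
  at3 4 8 2 o (~ 105) o o (~ 73) o o o o ∷
  at3 4 8 4 (~ 84) (~ 330) (+ 12) (~ 540) (~ 514) (+ 44) (~ 252) (~ 48) (+ 12) ∷
  at3 4 8 6 (+ 192) o o o (~ 160) o (~ 144) o (+ 16) ∷
  at3 4 8 8 (+ 252) (+ 118) (+ 12) (+ 468) (+ 142) (~ 4) (~ 252) (~ 48) (+ 12) ∷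
  at3 5 2 8 o (+ 696) (+ 232) o (~ 696) (~ 232) o (~ 1160) (~ 464) ∷
  at3 5 3 7 (~ 1552) (+ 948) (+ 456) (~ 1205) (+ 524) (+ 48) (~ 5023) (+ 2216) (+ 176) ∷
  at3 5 4 6 (~ 2952) (~ 568) (+ 368) (+ 888) (~ 176) (~ 80) (~ 6148) (+ 2112) o ∷
  at3 5 4 8 (~ 2070) (~ 2426) (~ 976) (+ 342) (+ 1178) (+ 456) (~ 522) (+ 1120) (+ 888) ∷
  at3 5 5 5 (~ 1920) (~ 3036) (+ 376) (+ 4119) (~ 1032) (~ 1104) (~ 2823) (+ 1316) (~ 1472) ∷
  at3 5 5 7 (~ 1320) o (~ 1048) (+ 451) (+ 918) (~ 184) (~ 1157) (+ 1718) (~ 376) ∷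
  at3 5 6 4 (~ 2072) (~ 2304) (+ 552) (+ 9092) (+ 352) (+ 96) (+ 1288) (+ 1072) (~ 632) ∷
  at3 5 6 6 (+ 386) (~ 158) (~ 256) (+ 3138) (~ 26) (~ 358) (~ 646) (+ 628) (~ 322) ∷
  at3 5 6 8 (~ 6648) (+ 180) (+ 344) (+ 3126) (+ 448) (+ 32) (~ 2254) (+ 964) (~ 88) ∷
  at3 5 7 3 o (~ 332) (+ 640) (+ 3783) (~ 172) (+ 680) (+ 1213) o o ∷
  at3 5 7 5 (+ 4704) (+ 1240) o (+ 1469) (~ 98) (+ 504) (~ 731) (+ 430) o ∷
  at3 5 7 7 (+ 2336) (~ 452) o (+ 5339) (+ 104) (~ 812) (~ 1091) (+ 1692) (+ 660) ∷
  at3 5 8 2 o o (+ 400) o o (~ 200) o o (~ 200) ∷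
  at3 5 8 4 (+ 1810) (~ 894) (~ 200) (~ 726) (~ 921) (~ 312) (~ 1246) (~ 117) (~ 176) ∷
  at3 5 8 6 (+ 1532) (+ 488) (~ 328) (+ 390) o (~ 96) (~ 886) (~ 32) (~ 152) ∷
  at3 5 8 8 (+ 2334) (+ 770) o (+ 2982) (+ 828) (~ 100) (~ 1738) (~ 342) (+ 60) ∷
  at3 6 2 8 (+ 432) (+ 136) (+ 16) o (+ 56) o o (+ 80) o ∷
  at3 6 3 7 o (~ 136) (~ 48) o (~ 888) o (+ 360) (~ 2336) (~ 32) ∷
  at3 6 4 6 (~ 752) (+ 1015) (+ 34) (~ 376) (~ 366) (+ 10) (~ 40) (~ 4451) (~ 128) ∷
  at3 6 4 8 o (+ 112) o (~ 864) o (~ 32) (~ 864) o (~ 32) ∷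
  at3 6 5 5 (~ 912) (+ 830) o (+ 168) (+ 2221) (+ 138) (+ 1068) (~ 825) (+ 150) ∷
  at3 6 5 7 (+ 544) (~ 188) (~ 372) (+ 464) (~ 300) (+ 396) (+ 408) o (+ 752) ∷
  at3 6 6 4 (~ 2580) (~ 842) (~ 2) o (+ 2334) (~ 40) (+ 180) (+ 82) (~ 98) ∷
  at3 6 6 6 (+ 656) (+ 356) (~ 252) (+ 180) (+ 650) (+ 518) (+ 252) (+ 194) (~ 10) ∷
  at3 6 6 8 (~ 3684) (~ 450) (+ 240) (+ 720) (~ 190) (+ 132) (+ 604) (+ 400) (~ 204) ∷
  at3 6 7 3 (~ 1264) (~ 706) o (+ 1720) (+ 2596) o (+ 808) (+ 1100) o ∷
  at3 6 7 5 (+ 1176) (+ 1816) (+ 108) (~ 12) (~ 1418) (~ 864) (+ 348) (~ 630) (~ 436) ∷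
  at3 6 7 7 (+ 3620) (~ 424) o (~ 468) (~ 148) (~ 704) o o (+ 688) ∷
  at3 6 8 2 o o o o (~ 40) o o (~ 4) o ∷
  at3 6 8 4 o (+ 82) (~ 136) (~ 752) o (+ 244) (~ 624) o (+ 116) ∷
  at3 6 8 6 (~ 828) (+ 1011) (~ 544) (+ 96) (+ 96) o (+ 396) (~ 101) (~ 16) ∷
  at3 6 8 8 (+ 3912) (+ 1184) (~ 36) (+ 2406) (+ 902) (~ 92) (~ 2706) (~ 1142) (+ 56) ∷
  at3 7 5 7 o (~ 124) (~ 40) (+ 2325) (~ 468) o (+ 2181) (~ 504) o ∷
  at3 7 6 6 (+ 504) (+ 536) (+ 80) (~ 896) o o (~ 1256) o o ∷
  at3 7 6 8 (+ 216) (~ 388) (+ 8) (+ 432) (~ 74) (+ 8) o (+ 242) o ∷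
  at3 7 7 5 o (~ 28) (~ 40) (~ 1789) (+ 180) (+ 200) (~ 1645) (+ 312) (+ 200) ∷
  at3 7 7 7 (+ 1284) (~ 108) o (~ 3545) (~ 1498) (~ 16) (+ 681) (+ 298) (+ 56) ∷
  at3 7 8 4 o o o o o (~ 200) o o (~ 200) ∷
  at3 7 8 6 (~ 2012) (+ 330) (~ 216) (+ 1968) (+ 649) (+ 24) (+ 1016) (+ 483) (+ 176) ∷
  at3 7 8 8 (+ 1830) (+ 530) (~ 24) o (+ 264) (+ 8) (~ 1364) (~ 918) o ∷
  at3 8 4 8 o o o (~ 108) (~ 48) (~ 4) (~ 144) (~ 72) (~ 8) ∷
  at3 8 5 7 o (+ 60) (+ 32) (+ 144) (+ 964) (+ 32) (+ 396) (+ 1024) (+ 24) ∷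
  at3 8 6 6 (~ 240) (~ 176) (~ 32) (+ 72) (~ 351) (~ 44) (~ 288) (~ 375) (~ 12) ∷
  at3 8 6 8 o o o o o o o (~ 32) o ∷
  at3 8 7 5 (+ 240) (+ 116) o (~ 180) (~ 591) (+ 16) (~ 72) (~ 627) (~ 8) ∷
  at3 8 7 7 o o o o (~ 946) (~ 32) (~ 252) (+ 798) (+ 8) ∷
  at3 8 8 4 o o o (+ 72) (+ 26) o (+ 108) (+ 50) (+ 4) ∷
  at3 8 8 6 (+ 156) (~ 193) o o (+ 337) (+ 20) (+ 36) (+ 20) (+ 4) ∷
  at3 8 8 8 o (~ 2) o (+ 108) (+ 48) (+ 4) (~ 144) (~ 70) (~ 8) ∷ []

-- The Laurent polynomials of the sequences

open import Data.Unit using (tt)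
open import Agda.Builtin.FromNat using (Number; fromNat)
open import Agda.Builtin.FromNeg using (Negative; fromNeg)

instance
  numberℕ : Number ℕ
  numberℕ = Data.Nat.Literals.number
  numberℤ : Number ℤ
  numberℤ = Data.Integer.Literals.number
  negativeℤ : Negative ℤ
  negativeℤ = Data.Integer.Literals.negative

module Sequence-𝐀 where

  -- (x + 1)(y + 1)(x + y) / xy
  Λ : Laurent 2
  Λ =
    (-1 ∷ 0 ∷ [] , 1) ∷ (-1 ∷ 1 ∷ [] , 1) ∷ (0 ∷ -1 ∷ [] , 1) ∷ (0 ∷ 0 ∷ [] , 2) ∷
    (0 ∷ 1 ∷ [] , 1) ∷ (1 ∷ -1 ∷ [] , 1) ∷ (1 ∷ 0 ∷ [] , 1) ∷ []

  -- The choice of Λ reflects Σₖ binom(n, k)³: taking xᵏ yⁿ⁻ᵏ from (x + y)ⁿ leaves the coefficients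
  -- of xⁿ⁻ᵏ and yᵏ in (x + 1)ⁿ and (y + 1)ⁿ. The four `refl` evaluate the residue, u₀, and the
  -- steps n = 0 and n = 1.
  represents : Represents 𝐀 Λ
  represents n _ = zagier-represents 7 -8 2 1 Λ certificate-𝐀 refl refl refl refl n

  factored : Factorization Λ
  factored = factorization Λ
    ( ((0 ∷ 0 ∷ [] , 1) ∷ (1 ∷ 0 ∷ [] , 1) ∷ [])
    ∷ ((0 ∷ 0 ∷ [] , 1) ∷ (0 ∷ 1 ∷ [] , 1) ∷ [])
    ∷ ((-1 ∷ 0 ∷ [] , 1) ∷ (0 ∷ -1 ∷ [] , 1) ∷ [])
    ∷ []) refl

  -- The support points (-1, 0), (0, 1), (1, -1) have sum 0 and form a triangle around the origin;
  -- they alone get nonzero weights. The bounds y ≤ 1, x ≤ 1, -x - y ≤ 1 cut out a triangle with the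
  -- origin as only interior integral point.
  interior : OriginUniqueInteriorPoint Λ
  interior = originUniqueInteriorPoint Λ refl 2 2
    (1 ∷ 0 ∷ 0 ∷ 0 ∷ 1 ∷ 1 ∷ 0 ∷ [])
    ((-2 ∷ -1 ∷ []) ∷ (0 ∷ 0 ∷ []) ∷ (0 ∷ 0 ∷ []) ∷ (0 ∷ 0 ∷ []) ∷ (1 ∷ 2 ∷ []) ∷
     (1 ∷ -1 ∷ []) ∷ (0 ∷ 0 ∷ []) ∷ [])
    ((0 ∷ 1 ∷ []) ∷ (1 ∷ 0 ∷ []) ∷ (-1 ∷ -1 ∷ []) ∷ [])
    ((0 ∷ 1 ∷ 0 ∷ []) ∷ (1 ∷ 0 ∷ 0 ∷ []) ∷ [])
    ((1 ∷ 0 ∷ 1 ∷ []) ∷ (0 ∷ 1 ∷ 1 ∷ []) ∷ [])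

module Sequence-𝐁 where

  -- -(x + y + 1)(x² + y² + 1 - xy - x - y) / xy
  Λ : Laurent 2
  Λ =
    (-1 ∷ -1 ∷ [] , -1) ∷ (-1 ∷ 2 ∷ [] , -1) ∷ (0 ∷ 0 ∷ [] , 3) ∷ (2 ∷ -1 ∷ [] , -1) ∷ []

  -- The factorization is that of a³ + b³ + c³ - 3abc, so that Λ = 3 - (x³ + y³ + 1) / xy.
  represents : Represents 𝐁 Λ
  represents n _ = zagier-represents 9 27 3 1 Λ certificate-𝐁 refl refl refl refl n

  factored : Factorization Λ
  factored = factorization Λ
    ( ((0 ∷ 0 ∷ [] , 1) ∷ (0 ∷ 1 ∷ [] , 1) ∷ (1 ∷ 0 ∷ [] , 1) ∷ [])
    ∷ ((-1 ∷ -1 ∷ [] , -1) ∷ (-1 ∷ 0 ∷ [] , 1) ∷ (-1 ∷ 1 ∷ [] , -1) ∷ (0 ∷ -1 ∷ [] , 1) ∷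
        (0 ∷ 0 ∷ [] , 1) ∷ (1 ∷ -1 ∷ [] , -1) ∷ [])
    ∷ []) refl

  interior : OriginUniqueInteriorPoint Λ
  interior = originUniqueInteriorPoint Λ refl 2 1
    (1 ∷ 1 ∷ 0 ∷ 1 ∷ [])
    ((-1 ∷ -1 ∷ []) ∷ (0 ∷ 1 ∷ []) ∷ (0 ∷ 0 ∷ []) ∷ (1 ∷ 0 ∷ []) ∷ [])
    ((-1 ∷ 0 ∷ []) ∷ (0 ∷ -1 ∷ []) ∷ (1 ∷ 1 ∷ []) ∷ [])
    ((0 ∷ 1 ∷ 1 ∷ []) ∷ (1 ∷ 0 ∷ 1 ∷ []) ∷ [])
    ((1 ∷ 0 ∷ 0 ∷ []) ∷ (0 ∷ 1 ∷ 0 ∷ []) ∷ [])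

module Sequence-𝐂 where

  -- (x + y + 1)(xy + x + y) / xy
  Λ : Laurent 2
  Λ =
    (-1 ∷ 0 ∷ [] , 1) ∷ (-1 ∷ 1 ∷ [] , 1) ∷ (0 ∷ -1 ∷ [] , 1) ∷ (0 ∷ 0 ∷ [] , 3) ∷
    (0 ∷ 1 ∷ [] , 1) ∷ (1 ∷ -1 ∷ [] , 1) ∷ (1 ∷ 0 ∷ [] , 1) ∷ []

  -- Here Λ = (1 + x + y)(1 + 1/x + 1/y), whose powers have as constant terms the sums of squared
  -- trinomial coefficients.
  represents : Represents 𝐂 Λ
  represents n _ = zagier-represents 10 9 3 1 Λ certificate-𝐂 refl refl refl refl n

  factored : Factorization Λ
  factored = factorization Λ
    ( ((0 ∷ 0 ∷ [] , 1) ∷ (0 ∷ 1 ∷ [] , 1) ∷ (1 ∷ 0 ∷ [] , 1) ∷ [])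
    ∷ ((-1 ∷ 0 ∷ [] , 1) ∷ (0 ∷ -1 ∷ [] , 1) ∷ (0 ∷ 0 ∷ [] , 1) ∷ [])
    ∷ []) refl

  interior : OriginUniqueInteriorPoint Λ
  interior = originUniqueInteriorPoint Λ refl 2 2
    (1 ∷ 0 ∷ 0 ∷ 0 ∷ 1 ∷ 1 ∷ 0 ∷ [])
    ((-2 ∷ -1 ∷ []) ∷ (0 ∷ 0 ∷ []) ∷ (0 ∷ 0 ∷ []) ∷ (0 ∷ 0 ∷ []) ∷ (1 ∷ 2 ∷ []) ∷
     (1 ∷ -1 ∷ []) ∷ (0 ∷ 0 ∷ []) ∷ [])
    ((0 ∷ 1 ∷ []) ∷ (1 ∷ 0 ∷ []) ∷ (-1 ∷ -1 ∷ []) ∷ [])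
    ((0 ∷ 1 ∷ 0 ∷ []) ∷ (1 ∷ 0 ∷ 0 ∷ []) ∷ [])
    ((1 ∷ 0 ∷ 1 ∷ []) ∷ (0 ∷ 1 ∷ 1 ∷ []) ∷ [])

module Sequence-𝐃 where

  -- (x + 1)(y + 1)(x + y + 1) / xy
  Λ : Laurent 2
  Λ =
    (-1 ∷ -1 ∷ [] , 1) ∷ (-1 ∷ 0 ∷ [] , 2) ∷ (-1 ∷ 1 ∷ [] , 1) ∷ (0 ∷ -1 ∷ [] , 2) ∷
    (0 ∷ 0 ∷ [] , 3) ∷ (0 ∷ 1 ∷ [] , 1) ∷ (1 ∷ -1 ∷ [] , 1) ∷ (1 ∷ 0 ∷ [] , 1) ∷ []

  represents : Represents 𝐃 Λ
  represents n _ = zagier-represents 11 -1 3 1 Λ certificate-𝐃 refl refl refl refl n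

  factored : Factorization Λ
  factored = factorization Λ
    ( ((0 ∷ 0 ∷ [] , 1) ∷ (1 ∷ 0 ∷ [] , 1) ∷ [])
    ∷ ((0 ∷ 0 ∷ [] , 1) ∷ (0 ∷ 1 ∷ [] , 1) ∷ [])
    ∷ ((-1 ∷ -1 ∷ [] , 1) ∷ (-1 ∷ 0 ∷ [] , 1) ∷ (0 ∷ -1 ∷ [] , 1) ∷ [])
    ∷ []) refl

  interior : OriginUniqueInteriorPoint Λ
  interior = originUniqueInteriorPoint Λ refl 2 2
    (1 ∷ 0 ∷ 0 ∷ 0 ∷ 0 ∷ 1 ∷ 0 ∷ 1 ∷ [])
    ((-1 ∷ -1 ∷ []) ∷ (0 ∷ 0 ∷ []) ∷ (0 ∷ 0 ∷ []) ∷ (0 ∷ 0 ∷ []) ∷ (0 ∷ 0 ∷ []) ∷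
     (-1 ∷ 2 ∷ []) ∷ (0 ∷ 0 ∷ []) ∷ (2 ∷ -1 ∷ []) ∷ [])
    ((-1 ∷ 0 ∷ []) ∷ (0 ∷ -1 ∷ []) ∷ (1 ∷ 1 ∷ []) ∷ [])
    ((0 ∷ 1 ∷ 1 ∷ []) ∷ (1 ∷ 0 ∷ 1 ∷ []) ∷ [])
    ((1 ∷ 0 ∷ 0 ∷ []) ∷ (0 ∷ 1 ∷ 0 ∷ []) ∷ [])

module Sequence-𝐄 where

  -- (xy + 1 + x - y)(xy + 1 - x + y) / xy
  Λ : Laurent 2
  Λ =
    (-1 ∷ -1 ∷ [] , 1) ∷ (-1 ∷ 1 ∷ [] , -1) ∷ (0 ∷ 0 ∷ [] , 4) ∷ (1 ∷ -1 ∷ [] , -1) ∷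
    (1 ∷ 1 ∷ [] , 1) ∷ []

  -- A difference of squares: Λ = ((xy + 1)² - (x - y)²) / xy.
  represents : Represents 𝐄 Λ
  represents n _ = zagier-represents 12 32 4 1 Λ certificate-𝐄 refl refl refl refl n

  factored : Factorization Λ
  factored = factorization Λ
    ( ((0 ∷ 0 ∷ [] , 1) ∷ (0 ∷ 1 ∷ [] , -1) ∷ (1 ∷ 0 ∷ [] , 1) ∷ (1 ∷ 1 ∷ [] , 1) ∷ [])
    ∷ ((-1 ∷ -1 ∷ [] , 1) ∷ (-1 ∷ 0 ∷ [] , 1) ∷ (0 ∷ -1 ∷ [] , -1) ∷ (0 ∷ 0 ∷ [] , 1) ∷ [])
    ∷ []) refl

  interior : OriginUniqueInteriorPoint Λ
  interior = originUniqueInteriorPoint Λ refl 3 1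
    (1 ∷ 1 ∷ 0 ∷ 1 ∷ 1 ∷ [])
    ((-1 ∷ -1 ∷ []) ∷ (-1 ∷ 1 ∷ []) ∷ (0 ∷ 0 ∷ []) ∷ (1 ∷ -1 ∷ []) ∷ (1 ∷ 1 ∷ []) ∷ [])
    ((-1 ∷ 0 ∷ []) ∷ (0 ∷ -1 ∷ []) ∷ (0 ∷ 1 ∷ []) ∷ (1 ∷ 0 ∷ []) ∷ [])
    ((0 ∷ 0 ∷ 0 ∷ 1 ∷ []) ∷ (0 ∷ 0 ∷ 1 ∷ 0 ∷ []) ∷ [])
    ((1 ∷ 0 ∷ 0 ∷ 0 ∷ []) ∷ (0 ∷ 1 ∷ 0 ∷ 0 ∷ []) ∷ [])

module Sequence-𝐅 where

  -- 8 - (x + 1)(y + 1)(x + y) / xy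
  Λ : Laurent 2
  Λ =
    (-1 ∷ 0 ∷ [] , -1) ∷ (-1 ∷ 1 ∷ [] , -1) ∷ (0 ∷ -1 ∷ [] , -1) ∷ (0 ∷ 0 ∷ [] , 6) ∷
    (0 ∷ 1 ∷ [] , -1) ∷ (1 ∷ -1 ∷ [] , -1) ∷ (1 ∷ 0 ∷ [] , -1) ∷ []

  -- Subtracting the polynomial of 𝐀 from 8 amounts to the binomial transform Σₖ binom(n, k) 8ⁿ⁻ᵏ
  -- (-1)ᵏ aₖ of the sequence 𝐀.
  represents : Represents 𝐅 Λ
  represents n _ = zagier-represents 17 72 6 1 Λ certificate-𝐅 refl refl refl refl n

  interior : OriginUniqueInteriorPoint Λ
  interior = originUniqueInteriorPoint Λ refl 2 2
    (1 ∷ 0 ∷ 0 ∷ 0 ∷ 1 ∷ 1 ∷ 0 ∷ [])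
    ((-2 ∷ -1 ∷ []) ∷ (0 ∷ 0 ∷ []) ∷ (0 ∷ 0 ∷ []) ∷ (0 ∷ 0 ∷ []) ∷ (1 ∷ 2 ∷ []) ∷
     (1 ∷ -1 ∷ []) ∷ (0 ∷ 0 ∷ []) ∷ [])
    ((0 ∷ 1 ∷ []) ∷ (1 ∷ 0 ∷ []) ∷ (-1 ∷ -1 ∷ []) ∷ [])
    ((0 ∷ 1 ∷ 0 ∷ []) ∷ (1 ∷ 0 ∷ 0 ∷ []) ∷ [])
    ((1 ∷ 0 ∷ 1 ∷ []) ∷ (0 ∷ 1 ∷ 1 ∷ []) ∷ [])

module Sequence-𝐅-factored where

  -- -(1 + x - y² + xy²)(1 - x - y - xy)(1 - x + y + xy) / x²y²
  -- Mutating 8 - (x + 1)(y + 1)(x + y) / xy to the triangle -(y² - 6xy + 2y + (1 + x)³) / xy and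
  -- putting x = -w² makes it split as (y + (1 + w)³)(y + (1 - w)³) / w²y; the substitutions
  -- y ↦ y(1 + w)²(1 - w) and y = -v² then bring all coefficients of the factors into {-1, 0, 1}.
  Λ : Laurent 2
  Λ =
    (-2 ∷ -2 ∷ [] , -1) ∷ (-2 ∷ 0 ∷ [] , 2) ∷ (-2 ∷ 2 ∷ [] , -1) ∷ (-1 ∷ -2 ∷ [] , 1) ∷
    (-1 ∷ 2 ∷ [] , -1) ∷ (0 ∷ -2 ∷ [] , 1) ∷ (0 ∷ 0 ∷ [] , 6) ∷ (0 ∷ 2 ∷ [] , 1) ∷
    (1 ∷ -2 ∷ [] , -1) ∷ (1 ∷ 2 ∷ [] , 1) ∷ []

  represents : Represents 𝐅 Λ
  represents n _ = zagier-represents 17 72 6 4 Λ certificate-𝐅-factored refl refl refl refl n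

  factored : Factorization Λ
  factored = factorization Λ
    ( ((0 ∷ 0 ∷ [] , 1) ∷ (0 ∷ 2 ∷ [] , -1) ∷ (1 ∷ 0 ∷ [] , 1) ∷ (1 ∷ 2 ∷ [] , 1) ∷ [])
    ∷ ((0 ∷ 0 ∷ [] , 1) ∷ (0 ∷ 1 ∷ [] , -1) ∷ (1 ∷ 0 ∷ [] , -1) ∷ (1 ∷ 1 ∷ [] , -1) ∷ [])
    ∷ ((-2 ∷ -2 ∷ [] , -1) ∷ (-2 ∷ -1 ∷ [] , -1) ∷ (-1 ∷ -2 ∷ [] , 1) ∷ (-1 ∷ -1 ∷ [] , -1) ∷
        [])
    ∷ []) refl

module Sequence-δ where

  -- (x + y - 1)(x + z + 1)(y - x + z)(y - z + 1) / xyz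
  Λ : Laurent 3
  Λ =
    (-1 ∷ -1 ∷ 0 ∷ [] , -1) ∷ (-1 ∷ -1 ∷ 2 ∷ [] , 1) ∷ (-1 ∷ 0 ∷ -1 ∷ [] , -1) ∷
    (-1 ∷ 0 ∷ 2 ∷ [] , -1) ∷ (-1 ∷ 2 ∷ -1 ∷ [] , 1) ∷ (-1 ∷ 2 ∷ 0 ∷ [] , 1) ∷
    (0 ∷ -1 ∷ -1 ∷ [] , 1) ∷ (0 ∷ -1 ∷ 2 ∷ [] , -1) ∷ (0 ∷ 0 ∷ 0 ∷ [] , 3) ∷
    (0 ∷ 2 ∷ -1 ∷ [] , 1) ∷ (2 ∷ -1 ∷ -1 ∷ [] , -1) ∷ (2 ∷ -1 ∷ 0 ∷ [] , 1) ∷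
    (2 ∷ 0 ∷ -1 ∷ [] , -1) ∷ []

  represents : Represents δ Λ
  represents n _ = cooper-represents 7 3 81 0 8 Λ certificate-δ refl refl refl refl n

  factored : Factorization Λ
  factored = factorization Λ
    ( ((0 ∷ 0 ∷ 0 ∷ [] , -1) ∷ (0 ∷ 1 ∷ 0 ∷ [] , 1) ∷ (1 ∷ 0 ∷ 0 ∷ [] , 1) ∷ [])
    ∷ ((0 ∷ 0 ∷ 0 ∷ [] , 1) ∷ (0 ∷ 0 ∷ 1 ∷ [] , 1) ∷ (1 ∷ 0 ∷ 0 ∷ [] , 1) ∷ [])
    ∷ ((0 ∷ 0 ∷ 1 ∷ [] , 1) ∷ (0 ∷ 1 ∷ 0 ∷ [] , 1) ∷ (1 ∷ 0 ∷ 0 ∷ [] , -1) ∷ [])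
    ∷ ((-1 ∷ -1 ∷ -1 ∷ [] , 1) ∷ (-1 ∷ -1 ∷ 0 ∷ [] , -1) ∷ (-1 ∷ 0 ∷ -1 ∷ [] , 1) ∷ [])
    ∷ []) refl

  -- The weights sit on a tetrahedron of four support points with sum 0. Its barycentric coordinates
  -- have denominator 8, so the value 1/4 at the origin is written as 2/8. The bounds are those of
  -- the simplex x, y, z ≥ -1, x + y + z ≤ 1.
  interior : OriginUniqueInteriorPoint Λ
  interior = originUniqueInteriorPoint Λ refl 7 4
    (2 ∷ 2 ∷ 0 ∷ 0 ∷ 0 ∷ 0 ∷ 0 ∷ 0 ∷ 0 ∷ 2 ∷ 0 ∷ 0 ∷ 2 ∷ [])
    ((-3 ∷ -3 ∷ -4 ∷ []) ∷ (1 ∷ 1 ∷ 4 ∷ []) ∷ (0 ∷ 0 ∷ 0 ∷ []) ∷ (0 ∷ 0 ∷ 0 ∷ []) ∷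
     (0 ∷ 0 ∷ 0 ∷ []) ∷ (0 ∷ 0 ∷ 0 ∷ []) ∷ (0 ∷ 0 ∷ 0 ∷ []) ∷ (0 ∷ 0 ∷ 0 ∷ []) ∷
     (0 ∷ 0 ∷ 0 ∷ []) ∷ (-1 ∷ 3 ∷ 0 ∷ []) ∷ (0 ∷ 0 ∷ 0 ∷ []) ∷ (0 ∷ 0 ∷ 0 ∷ []) ∷
     (3 ∷ -1 ∷ 0 ∷ []) ∷ [])
    ((-1 ∷ 0 ∷ 0 ∷ []) ∷ (0 ∷ -1 ∷ 0 ∷ []) ∷ (0 ∷ 0 ∷ -1 ∷ []) ∷ (1 ∷ 1 ∷ 1 ∷ []) ∷ [])
    ((0 ∷ 1 ∷ 1 ∷ 1 ∷ []) ∷ (1 ∷ 0 ∷ 1 ∷ 1 ∷ []) ∷ (1 ∷ 1 ∷ 0 ∷ 1 ∷ []) ∷ [])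
    ((1 ∷ 0 ∷ 0 ∷ 0 ∷ []) ∷ (0 ∷ 1 ∷ 0 ∷ 0 ∷ []) ∷ (0 ∷ 0 ∷ 1 ∷ 0 ∷ []) ∷ [])

module Sequence-η where

  -- (zx + xy - yz - x - 1)(xy + yz - zx - y - 1)(yz + zx - xy - z - 1) / xyz
  Λ : Laurent 3
  Λ =
    (-1 ∷ -1 ∷ -1 ∷ [] , -1) ∷ (-1 ∷ -1 ∷ 0 ∷ [] , -1) ∷ (-1 ∷ 0 ∷ -1 ∷ [] , -1) ∷
    (-1 ∷ 1 ∷ 2 ∷ [] , 1) ∷ (-1 ∷ 2 ∷ 1 ∷ [] , 1) ∷ (-1 ∷ 2 ∷ 2 ∷ [] , -1) ∷
    (0 ∷ -1 ∷ -1 ∷ [] , -1) ∷ (0 ∷ 0 ∷ 0 ∷ [] , 5) ∷ (0 ∷ 0 ∷ 2 ∷ [] , -2) ∷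
    (0 ∷ 1 ∷ 1 ∷ [] , -1) ∷ (0 ∷ 1 ∷ 2 ∷ [] , 1) ∷ (0 ∷ 2 ∷ 0 ∷ [] , -2) ∷
    (0 ∷ 2 ∷ 1 ∷ [] , 1) ∷ (1 ∷ -1 ∷ 2 ∷ [] , 1) ∷ (1 ∷ 0 ∷ 1 ∷ [] , -1) ∷
    (1 ∷ 0 ∷ 2 ∷ [] , 1) ∷ (1 ∷ 1 ∷ 0 ∷ [] , -1) ∷ (1 ∷ 1 ∷ 1 ∷ [] , -2) ∷
    (1 ∷ 2 ∷ -1 ∷ [] , 1) ∷ (1 ∷ 2 ∷ 0 ∷ [] , 1) ∷ (2 ∷ -1 ∷ 1 ∷ [] , 1) ∷
    (2 ∷ -1 ∷ 2 ∷ [] , -1) ∷ (2 ∷ 0 ∷ 0 ∷ [] , -2) ∷ (2 ∷ 0 ∷ 1 ∷ [] , 1) ∷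
    (2 ∷ 1 ∷ -1 ∷ [] , 1) ∷ (2 ∷ 1 ∷ 0 ∷ [] , 1) ∷ (2 ∷ 2 ∷ -1 ∷ [] , -1) ∷ []

  represents : Represents η Λ
  represents n _ = cooper-represents 11 5 125 0 288 Λ certificate-η refl refl refl refl n

  factored : Factorization Λ
  factored = factorization Λ
    ( ((0 ∷ 0 ∷ 0 ∷ [] , -1) ∷ (0 ∷ 1 ∷ 1 ∷ [] , -1) ∷ (1 ∷ 0 ∷ 0 ∷ [] , -1) ∷
        (1 ∷ 0 ∷ 1 ∷ [] , 1) ∷ (1 ∷ 1 ∷ 0 ∷ [] , 1) ∷ [])
    ∷ ((0 ∷ 0 ∷ 0 ∷ [] , -1) ∷ (0 ∷ 1 ∷ 0 ∷ [] , -1) ∷ (0 ∷ 1 ∷ 1 ∷ [] , 1) ∷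
        (1 ∷ 0 ∷ 1 ∷ [] , -1) ∷ (1 ∷ 1 ∷ 0 ∷ [] , 1) ∷ [])
    ∷ ((-1 ∷ -1 ∷ -1 ∷ [] , -1) ∷ (-1 ∷ -1 ∷ 0 ∷ [] , -1) ∷ (-1 ∷ 0 ∷ 0 ∷ [] , 1) ∷
        (0 ∷ -1 ∷ 0 ∷ [] , 1) ∷ (0 ∷ 0 ∷ -1 ∷ [] , -1) ∷ [])
    ∷ []) refl

module Sequence-α where

  -- (1 + x + y + z)(xyz + yz + xz + xy) / xyz
  Λ : Laurent 3
  Λ =
    (-1 ∷ 0 ∷ 0 ∷ [] , 1) ∷ (-1 ∷ 0 ∷ 1 ∷ [] , 1) ∷ (-1 ∷ 1 ∷ 0 ∷ [] , 1) ∷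
    (0 ∷ -1 ∷ 0 ∷ [] , 1) ∷ (0 ∷ -1 ∷ 1 ∷ [] , 1) ∷ (0 ∷ 0 ∷ -1 ∷ [] , 1) ∷
    (0 ∷ 0 ∷ 0 ∷ [] , 4) ∷ (0 ∷ 0 ∷ 1 ∷ [] , 1) ∷ (0 ∷ 1 ∷ -1 ∷ [] , 1) ∷
    (0 ∷ 1 ∷ 0 ∷ [] , 1) ∷ (1 ∷ -1 ∷ 0 ∷ [] , 1) ∷ (1 ∷ 0 ∷ -1 ∷ [] , 1) ∷
    (1 ∷ 0 ∷ 0 ∷ [] , 1) ∷ []

  -- Here Λ = (1 + x + y + z)(1 + 1/x + 1/y + 1/z), whose powers have as constant terms the sums of
  -- squared multinomial coefficients.
  represents : Represents α Λ
  represents n _ = cooper-represents 10 4 64 0 1 Λ certificate-α refl refl refl refl n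

  factored : Factorization Λ
  factored = factorization Λ
    ( ((0 ∷ 0 ∷ 0 ∷ [] , 1) ∷ (0 ∷ 0 ∷ 1 ∷ [] , 1) ∷ (0 ∷ 1 ∷ 0 ∷ [] , 1) ∷
        (1 ∷ 0 ∷ 0 ∷ [] , 1) ∷ [])
    ∷ ((-1 ∷ 0 ∷ 0 ∷ [] , 1) ∷ (0 ∷ -1 ∷ 0 ∷ [] , 1) ∷ (0 ∷ 0 ∷ -1 ∷ [] , 1) ∷
        (0 ∷ 0 ∷ 0 ∷ [] , 1) ∷ [])
    ∷ []) refl

  -- The Newton polytope lies in the cube [-1, 1]³, whose only interior integral point is the
  -- origin, so ± x, ± y, ± z serve as functionals.
  interior : OriginUniqueInteriorPoint Λ
  interior = originUniqueInteriorPoint Λ refl 3 5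
    (1 ∷ 0 ∷ 0 ∷ 0 ∷ 1 ∷ 0 ∷ 0 ∷ 0 ∷ 0 ∷ 1 ∷ 0 ∷ 1 ∷ 0 ∷ [])
    ((-3 ∷ -1 ∷ -2 ∷ []) ∷ (0 ∷ 0 ∷ 0 ∷ []) ∷ (0 ∷ 0 ∷ 0 ∷ []) ∷ (0 ∷ 0 ∷ 0 ∷ []) ∷
     (1 ∷ -1 ∷ 2 ∷ []) ∷ (0 ∷ 0 ∷ 0 ∷ []) ∷ (0 ∷ 0 ∷ 0 ∷ []) ∷ (0 ∷ 0 ∷ 0 ∷ []) ∷
     (0 ∷ 0 ∷ 0 ∷ []) ∷ (1 ∷ 3 ∷ 2 ∷ []) ∷ (0 ∷ 0 ∷ 0 ∷ []) ∷ (1 ∷ -1 ∷ -2 ∷ []) ∷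
     (0 ∷ 0 ∷ 0 ∷ []) ∷ [])
    ((-1 ∷ 0 ∷ 0 ∷ []) ∷ (0 ∷ -1 ∷ 0 ∷ []) ∷ (0 ∷ 0 ∷ -1 ∷ []) ∷ (0 ∷ 0 ∷ 1 ∷ []) ∷
     (0 ∷ 1 ∷ 0 ∷ []) ∷ (1 ∷ 0 ∷ 0 ∷ []) ∷ [])
    ((0 ∷ 0 ∷ 0 ∷ 0 ∷ 0 ∷ 1 ∷ []) ∷ (0 ∷ 0 ∷ 0 ∷ 0 ∷ 1 ∷ 0 ∷ []) ∷
     (0 ∷ 0 ∷ 0 ∷ 1 ∷ 0 ∷ 0 ∷ []) ∷ [])
    ((1 ∷ 0 ∷ 0 ∷ 0 ∷ 0 ∷ 0 ∷ []) ∷ (0 ∷ 1 ∷ 0 ∷ 0 ∷ 0 ∷ 0 ∷ []) ∷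
     (0 ∷ 0 ∷ 1 ∷ 0 ∷ 0 ∷ 0 ∷ []) ∷ [])

module Sequence-ε where

  -- (1 + x(1 + y)(1 + z))(x + (1 + y)(1 + z)) / xyz
  Λ : Laurent 3
  Λ =
    (-1 ∷ -1 ∷ -1 ∷ [] , 1) ∷ (-1 ∷ -1 ∷ 0 ∷ [] , 1) ∷ (-1 ∷ 0 ∷ -1 ∷ [] , 1) ∷
    (-1 ∷ 0 ∷ 0 ∷ [] , 1) ∷ (0 ∷ -1 ∷ -1 ∷ [] , 2) ∷ (0 ∷ -1 ∷ 0 ∷ [] , 2) ∷
    (0 ∷ -1 ∷ 1 ∷ [] , 1) ∷ (0 ∷ 0 ∷ -1 ∷ [] , 2) ∷ (0 ∷ 0 ∷ 0 ∷ [] , 4) ∷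
    (0 ∷ 0 ∷ 1 ∷ [] , 2) ∷ (0 ∷ 1 ∷ -1 ∷ [] , 1) ∷ (0 ∷ 1 ∷ 0 ∷ [] , 2) ∷
    (0 ∷ 1 ∷ 1 ∷ [] , 1) ∷ (1 ∷ -1 ∷ -1 ∷ [] , 1) ∷ (1 ∷ -1 ∷ 0 ∷ [] , 1) ∷
    (1 ∷ 0 ∷ -1 ∷ [] , 1) ∷ (1 ∷ 0 ∷ 0 ∷ [] , 1) ∷ []

  represents : Represents ε Λ
  represents n _ = cooper-represents 12 4 16 0 1 Λ certificate-ε refl refl refl refl n

  factored : Factorization Λ
  factored = factorization Λ
    ( ((0 ∷ 0 ∷ 0 ∷ [] , 1) ∷ (1 ∷ 0 ∷ 0 ∷ [] , 1) ∷ (1 ∷ 0 ∷ 1 ∷ [] , 1) ∷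
        (1 ∷ 1 ∷ 0 ∷ [] , 1) ∷ (1 ∷ 1 ∷ 1 ∷ [] , 1) ∷ [])
    ∷ ((-1 ∷ -1 ∷ -1 ∷ [] , 1) ∷ (-1 ∷ -1 ∷ 0 ∷ [] , 1) ∷ (-1 ∷ 0 ∷ -1 ∷ [] , 1) ∷
        (-1 ∷ 0 ∷ 0 ∷ [] , 1) ∷ (0 ∷ -1 ∷ -1 ∷ [] , 1) ∷ [])
    ∷ []) refl

  -- The support contains the tetrahedron (-1, -1, -1), (1, 0, 0), (0, 1, 0), (0, 0, 1) around the
  -- origin and lies in the cube [-1, 1]³. The same holds for ζ, γ, s7 and s10.
  interior : OriginUniqueInteriorPoint Λ
  interior = originUniqueInteriorPoint Λ refl 3 4
    (1 ∷ 0 ∷ 0 ∷ 0 ∷ 0 ∷ 0 ∷ 0 ∷ 0 ∷ 0 ∷ 1 ∷ 0 ∷ 1 ∷ 0 ∷ 0 ∷ 0 ∷ 0 ∷ 1 ∷ [])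
    ((-1 ∷ -1 ∷ -1 ∷ []) ∷ (0 ∷ 0 ∷ 0 ∷ []) ∷ (0 ∷ 0 ∷ 0 ∷ []) ∷ (0 ∷ 0 ∷ 0 ∷ []) ∷
     (0 ∷ 0 ∷ 0 ∷ []) ∷ (0 ∷ 0 ∷ 0 ∷ []) ∷ (0 ∷ 0 ∷ 0 ∷ []) ∷ (0 ∷ 0 ∷ 0 ∷ []) ∷
     (0 ∷ 0 ∷ 0 ∷ []) ∷ (-1 ∷ -1 ∷ 3 ∷ []) ∷ (0 ∷ 0 ∷ 0 ∷ []) ∷ (-1 ∷ 3 ∷ -1 ∷ []) ∷
     (0 ∷ 0 ∷ 0 ∷ []) ∷ (0 ∷ 0 ∷ 0 ∷ []) ∷ (0 ∷ 0 ∷ 0 ∷ []) ∷ (0 ∷ 0 ∷ 0 ∷ []) ∷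
     (3 ∷ -1 ∷ -1 ∷ []) ∷ [])
    ((-1 ∷ 0 ∷ 0 ∷ []) ∷ (0 ∷ -1 ∷ 0 ∷ []) ∷ (0 ∷ 0 ∷ -1 ∷ []) ∷ (0 ∷ 0 ∷ 1 ∷ []) ∷
     (0 ∷ 1 ∷ 0 ∷ []) ∷ (1 ∷ 0 ∷ 0 ∷ []) ∷ [])
    ((0 ∷ 0 ∷ 0 ∷ 0 ∷ 0 ∷ 1 ∷ []) ∷ (0 ∷ 0 ∷ 0 ∷ 0 ∷ 1 ∷ 0 ∷ []) ∷
     (0 ∷ 0 ∷ 0 ∷ 1 ∷ 0 ∷ 0 ∷ []) ∷ [])
    ((1 ∷ 0 ∷ 0 ∷ 0 ∷ 0 ∷ 0 ∷ []) ∷ (0 ∷ 1 ∷ 0 ∷ 0 ∷ 0 ∷ 0 ∷ []) ∷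
     (0 ∷ 0 ∷ 1 ∷ 0 ∷ 0 ∷ 0 ∷ []) ∷ [])

module Sequence-ζ where

  -- (1 + x(1 + y)(1 + z))(1 + x)(1 + y + z) / xyz
  Λ : Laurent 3
  Λ =
    (-1 ∷ -1 ∷ -1 ∷ [] , 1) ∷ (-1 ∷ -1 ∷ 0 ∷ [] , 1) ∷ (-1 ∷ 0 ∷ -1 ∷ [] , 1) ∷
    (0 ∷ -1 ∷ -1 ∷ [] , 2) ∷ (0 ∷ -1 ∷ 0 ∷ [] , 3) ∷ (0 ∷ -1 ∷ 1 ∷ [] , 1) ∷
    (0 ∷ 0 ∷ -1 ∷ [] , 3) ∷ (0 ∷ 0 ∷ 0 ∷ [] , 3) ∷ (0 ∷ 0 ∷ 1 ∷ [] , 1) ∷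
    (0 ∷ 1 ∷ -1 ∷ [] , 1) ∷ (0 ∷ 1 ∷ 0 ∷ [] , 1) ∷ (1 ∷ -1 ∷ -1 ∷ [] , 1) ∷
    (1 ∷ -1 ∷ 0 ∷ [] , 2) ∷ (1 ∷ -1 ∷ 1 ∷ [] , 1) ∷ (1 ∷ 0 ∷ -1 ∷ [] , 2) ∷
    (1 ∷ 0 ∷ 0 ∷ [] , 3) ∷ (1 ∷ 0 ∷ 1 ∷ [] , 1) ∷ (1 ∷ 1 ∷ -1 ∷ [] , 1) ∷
    (1 ∷ 1 ∷ 0 ∷ [] , 1) ∷ []

  represents : Represents ζ Λ
  represents n _ = cooper-represents 9 3 -27 0 2 Λ certificate-ζ refl refl refl refl n

  factored : Factorization Λ
  factored = factorization Λ
    ( ((0 ∷ 0 ∷ 0 ∷ [] , 1) ∷ (1 ∷ 0 ∷ 0 ∷ [] , 1) ∷ (1 ∷ 0 ∷ 1 ∷ [] , 1) ∷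
        (1 ∷ 1 ∷ 0 ∷ [] , 1) ∷ (1 ∷ 1 ∷ 1 ∷ [] , 1) ∷ [])
    ∷ ((0 ∷ 0 ∷ 0 ∷ [] , 1) ∷ (1 ∷ 0 ∷ 0 ∷ [] , 1) ∷ [])
    ∷ ((-1 ∷ -1 ∷ -1 ∷ [] , 1) ∷ (-1 ∷ -1 ∷ 0 ∷ [] , 1) ∷ (-1 ∷ 0 ∷ -1 ∷ [] , 1) ∷ [])
    ∷ []) refl

  interior : OriginUniqueInteriorPoint Λ
  interior = originUniqueInteriorPoint Λ refl 3 4
    (1 ∷ 0 ∷ 0 ∷ 0 ∷ 0 ∷ 0 ∷ 0 ∷ 0 ∷ 1 ∷ 0 ∷ 1 ∷ 0 ∷ 0 ∷ 0 ∷ 0 ∷ 1 ∷ 0 ∷ 0 ∷ 0 ∷ [])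
    ((-1 ∷ -1 ∷ -1 ∷ []) ∷ (0 ∷ 0 ∷ 0 ∷ []) ∷ (0 ∷ 0 ∷ 0 ∷ []) ∷ (0 ∷ 0 ∷ 0 ∷ []) ∷
     (0 ∷ 0 ∷ 0 ∷ []) ∷ (0 ∷ 0 ∷ 0 ∷ []) ∷ (0 ∷ 0 ∷ 0 ∷ []) ∷ (0 ∷ 0 ∷ 0 ∷ []) ∷
     (-1 ∷ -1 ∷ 3 ∷ []) ∷ (0 ∷ 0 ∷ 0 ∷ []) ∷ (-1 ∷ 3 ∷ -1 ∷ []) ∷ (0 ∷ 0 ∷ 0 ∷ []) ∷
     (0 ∷ 0 ∷ 0 ∷ []) ∷ (0 ∷ 0 ∷ 0 ∷ []) ∷ (0 ∷ 0 ∷ 0 ∷ []) ∷ (3 ∷ -1 ∷ -1 ∷ []) ∷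
     (0 ∷ 0 ∷ 0 ∷ []) ∷ (0 ∷ 0 ∷ 0 ∷ []) ∷ (0 ∷ 0 ∷ 0 ∷ []) ∷ [])
    ((-1 ∷ 0 ∷ 0 ∷ []) ∷ (0 ∷ -1 ∷ 0 ∷ []) ∷ (0 ∷ 0 ∷ -1 ∷ []) ∷ (0 ∷ 0 ∷ 1 ∷ []) ∷
     (0 ∷ 1 ∷ 0 ∷ []) ∷ (1 ∷ 0 ∷ 0 ∷ []) ∷ [])
    ((0 ∷ 0 ∷ 0 ∷ 0 ∷ 0 ∷ 1 ∷ []) ∷ (0 ∷ 0 ∷ 0 ∷ 0 ∷ 1 ∷ 0 ∷ []) ∷
     (0 ∷ 0 ∷ 0 ∷ 1 ∷ 0 ∷ 0 ∷ []) ∷ [])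
    ((1 ∷ 0 ∷ 0 ∷ 0 ∷ 0 ∷ 0 ∷ []) ∷ (0 ∷ 1 ∷ 0 ∷ 0 ∷ 0 ∷ 0 ∷ []) ∷
     (0 ∷ 0 ∷ 1 ∷ 0 ∷ 0 ∷ 0 ∷ []) ∷ [])

module Sequence-γ where

  -- (1 + x(1 + y)(1 + z))(1 + x)(1 + y)(1 + z) / xyz
  Λ : Laurent 3
  Λ =
    (-1 ∷ -1 ∷ -1 ∷ [] , 1) ∷ (-1 ∷ -1 ∷ 0 ∷ [] , 1) ∷ (-1 ∷ 0 ∷ -1 ∷ [] , 1) ∷
    (-1 ∷ 0 ∷ 0 ∷ [] , 1) ∷ (0 ∷ -1 ∷ -1 ∷ [] , 2) ∷ (0 ∷ -1 ∷ 0 ∷ [] , 3) ∷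
    (0 ∷ -1 ∷ 1 ∷ [] , 1) ∷ (0 ∷ 0 ∷ -1 ∷ [] , 3) ∷ (0 ∷ 0 ∷ 0 ∷ [] , 5) ∷
    (0 ∷ 0 ∷ 1 ∷ [] , 2) ∷ (0 ∷ 1 ∷ -1 ∷ [] , 1) ∷ (0 ∷ 1 ∷ 0 ∷ [] , 2) ∷
    (0 ∷ 1 ∷ 1 ∷ [] , 1) ∷ (1 ∷ -1 ∷ -1 ∷ [] , 1) ∷ (1 ∷ -1 ∷ 0 ∷ [] , 2) ∷
    (1 ∷ -1 ∷ 1 ∷ [] , 1) ∷ (1 ∷ 0 ∷ -1 ∷ [] , 2) ∷ (1 ∷ 0 ∷ 0 ∷ [] , 4) ∷
    (1 ∷ 0 ∷ 1 ∷ [] , 2) ∷ (1 ∷ 1 ∷ -1 ∷ [] , 1) ∷ (1 ∷ 1 ∷ 0 ∷ [] , 2) ∷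
    (1 ∷ 1 ∷ 1 ∷ [] , 1) ∷ []

  -- Choosing x(1 + y)(1 + z) from k of the n first factors leaves binom(n, k) from (1 + x)ⁿ and
  -- binom(n + k, n) from each of (1 + y)ⁿ⁺ᵏ and (1 + z)ⁿ⁺ᵏ.
  represents : Represents γ Λ
  represents n _ = cooper-represents 17 5 1 0 4 Λ certificate-γ refl refl refl refl n

  factored : Factorization Λ
  factored = factorization Λ
    ( ((0 ∷ 0 ∷ 0 ∷ [] , 1) ∷ (1 ∷ 0 ∷ 0 ∷ [] , 1) ∷ (1 ∷ 0 ∷ 1 ∷ [] , 1) ∷
        (1 ∷ 1 ∷ 0 ∷ [] , 1) ∷ (1 ∷ 1 ∷ 1 ∷ [] , 1) ∷ [])
    ∷ ((0 ∷ 0 ∷ 0 ∷ [] , 1) ∷ (1 ∷ 0 ∷ 0 ∷ [] , 1) ∷ [])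
    ∷ ((0 ∷ 0 ∷ 0 ∷ [] , 1) ∷ (0 ∷ 1 ∷ 0 ∷ [] , 1) ∷ [])
    ∷ ((-1 ∷ -1 ∷ -1 ∷ [] , 1) ∷ (-1 ∷ -1 ∷ 0 ∷ [] , 1) ∷ [])
    ∷ []) refl

  interior : OriginUniqueInteriorPoint Λ
  interior = originUniqueInteriorPoint Λ refl 3 4
    (1 ∷ 0 ∷ 0 ∷ 0 ∷ 0 ∷ 0 ∷ 0 ∷ 0 ∷ 0 ∷ 1 ∷ 0 ∷ 1 ∷ 0 ∷ 0 ∷ 0 ∷ 0 ∷ 0 ∷ 1 ∷ 0 ∷ 0 ∷ 0 ∷ 0 ∷ [])
    ((-1 ∷ -1 ∷ -1 ∷ []) ∷ (0 ∷ 0 ∷ 0 ∷ []) ∷ (0 ∷ 0 ∷ 0 ∷ []) ∷ (0 ∷ 0 ∷ 0 ∷ []) ∷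
     (0 ∷ 0 ∷ 0 ∷ []) ∷ (0 ∷ 0 ∷ 0 ∷ []) ∷ (0 ∷ 0 ∷ 0 ∷ []) ∷ (0 ∷ 0 ∷ 0 ∷ []) ∷
     (0 ∷ 0 ∷ 0 ∷ []) ∷ (-1 ∷ -1 ∷ 3 ∷ []) ∷ (0 ∷ 0 ∷ 0 ∷ []) ∷ (-1 ∷ 3 ∷ -1 ∷ []) ∷
     (0 ∷ 0 ∷ 0 ∷ []) ∷ (0 ∷ 0 ∷ 0 ∷ []) ∷ (0 ∷ 0 ∷ 0 ∷ []) ∷ (0 ∷ 0 ∷ 0 ∷ []) ∷
     (0 ∷ 0 ∷ 0 ∷ []) ∷ (3 ∷ -1 ∷ -1 ∷ []) ∷ (0 ∷ 0 ∷ 0 ∷ []) ∷ (0 ∷ 0 ∷ 0 ∷ []) ∷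
     (0 ∷ 0 ∷ 0 ∷ []) ∷ (0 ∷ 0 ∷ 0 ∷ []) ∷ [])
    ((-1 ∷ 0 ∷ 0 ∷ []) ∷ (0 ∷ -1 ∷ 0 ∷ []) ∷ (0 ∷ 0 ∷ -1 ∷ []) ∷ (0 ∷ 0 ∷ 1 ∷ []) ∷
     (0 ∷ 1 ∷ 0 ∷ []) ∷ (1 ∷ 0 ∷ 0 ∷ []) ∷ [])
    ((0 ∷ 0 ∷ 0 ∷ 0 ∷ 0 ∷ 1 ∷ []) ∷ (0 ∷ 0 ∷ 0 ∷ 0 ∷ 1 ∷ 0 ∷ []) ∷
     (0 ∷ 0 ∷ 0 ∷ 1 ∷ 0 ∷ 0 ∷ []) ∷ [])
    ((1 ∷ 0 ∷ 0 ∷ 0 ∷ 0 ∷ 0 ∷ []) ∷ (0 ∷ 1 ∷ 0 ∷ 0 ∷ 0 ∷ 0 ∷ []) ∷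
     (0 ∷ 0 ∷ 1 ∷ 0 ∷ 0 ∷ 0 ∷ []) ∷ [])

module Sequence-s7 where

  -- (1 + x(1 + y)(1 + z))(1 + x + y)(1 + z) / xyz
  Λ : Laurent 3
  Λ =
    (-1 ∷ -1 ∷ -1 ∷ [] , 1) ∷ (-1 ∷ -1 ∷ 0 ∷ [] , 1) ∷ (-1 ∷ 0 ∷ -1 ∷ [] , 1) ∷
    (-1 ∷ 0 ∷ 0 ∷ [] , 1) ∷ (0 ∷ -1 ∷ -1 ∷ [] , 2) ∷ (0 ∷ -1 ∷ 0 ∷ [] , 3) ∷
    (0 ∷ -1 ∷ 1 ∷ [] , 1) ∷ (0 ∷ 0 ∷ -1 ∷ [] , 2) ∷ (0 ∷ 0 ∷ 0 ∷ [] , 4) ∷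
    (0 ∷ 0 ∷ 1 ∷ [] , 2) ∷ (0 ∷ 1 ∷ -1 ∷ [] , 1) ∷ (0 ∷ 1 ∷ 0 ∷ [] , 2) ∷
    (0 ∷ 1 ∷ 1 ∷ [] , 1) ∷ (1 ∷ -1 ∷ -1 ∷ [] , 1) ∷ (1 ∷ -1 ∷ 0 ∷ [] , 2) ∷
    (1 ∷ -1 ∷ 1 ∷ [] , 1) ∷ (1 ∷ 0 ∷ -1 ∷ [] , 1) ∷ (1 ∷ 0 ∷ 0 ∷ [] , 2) ∷
    (1 ∷ 0 ∷ 1 ∷ [] , 1) ∷ []

  represents : Represents s7 Λ
  represents n _ = cooper-represents 13 4 -27 3 2 Λ certificate-s7 refl refl refl refl n

  factored : Factorization Λ
  factored = factorization Λ
    ( ((0 ∷ 0 ∷ 0 ∷ [] , 1) ∷ (1 ∷ 0 ∷ 0 ∷ [] , 1) ∷ (1 ∷ 0 ∷ 1 ∷ [] , 1) ∷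
        (1 ∷ 1 ∷ 0 ∷ [] , 1) ∷ (1 ∷ 1 ∷ 1 ∷ [] , 1) ∷ [])
    ∷ ((0 ∷ 0 ∷ 0 ∷ [] , 1) ∷ (0 ∷ 1 ∷ 0 ∷ [] , 1) ∷ (1 ∷ 0 ∷ 0 ∷ [] , 1) ∷ [])
    ∷ ((-1 ∷ -1 ∷ -1 ∷ [] , 1) ∷ (-1 ∷ -1 ∷ 0 ∷ [] , 1) ∷ [])
    ∷ []) refl

  interior : OriginUniqueInteriorPoint Λ
  interior = originUniqueInteriorPoint Λ refl 3 4
    (1 ∷ 0 ∷ 0 ∷ 0 ∷ 0 ∷ 0 ∷ 0 ∷ 0 ∷ 0 ∷ 1 ∷ 0 ∷ 1 ∷ 0 ∷ 0 ∷ 0 ∷ 0 ∷ 0 ∷ 1 ∷ 0 ∷ [])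
    ((-1 ∷ -1 ∷ -1 ∷ []) ∷ (0 ∷ 0 ∷ 0 ∷ []) ∷ (0 ∷ 0 ∷ 0 ∷ []) ∷ (0 ∷ 0 ∷ 0 ∷ []) ∷
     (0 ∷ 0 ∷ 0 ∷ []) ∷ (0 ∷ 0 ∷ 0 ∷ []) ∷ (0 ∷ 0 ∷ 0 ∷ []) ∷ (0 ∷ 0 ∷ 0 ∷ []) ∷
     (0 ∷ 0 ∷ 0 ∷ []) ∷ (-1 ∷ -1 ∷ 3 ∷ []) ∷ (0 ∷ 0 ∷ 0 ∷ []) ∷ (-1 ∷ 3 ∷ -1 ∷ []) ∷
     (0 ∷ 0 ∷ 0 ∷ []) ∷ (0 ∷ 0 ∷ 0 ∷ []) ∷ (0 ∷ 0 ∷ 0 ∷ []) ∷ (0 ∷ 0 ∷ 0 ∷ []) ∷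
     (0 ∷ 0 ∷ 0 ∷ []) ∷ (3 ∷ -1 ∷ -1 ∷ []) ∷ (0 ∷ 0 ∷ 0 ∷ []) ∷ [])
    ((-1 ∷ 0 ∷ 0 ∷ []) ∷ (0 ∷ -1 ∷ 0 ∷ []) ∷ (0 ∷ 0 ∷ -1 ∷ []) ∷ (0 ∷ 0 ∷ 1 ∷ []) ∷
     (0 ∷ 1 ∷ 0 ∷ []) ∷ (1 ∷ 0 ∷ 0 ∷ []) ∷ [])
    ((0 ∷ 0 ∷ 0 ∷ 0 ∷ 0 ∷ 1 ∷ []) ∷ (0 ∷ 0 ∷ 0 ∷ 0 ∷ 1 ∷ 0 ∷ []) ∷
     (0 ∷ 0 ∷ 0 ∷ 1 ∷ 0 ∷ 0 ∷ []) ∷ [])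
    ((1 ∷ 0 ∷ 0 ∷ 0 ∷ 0 ∷ 0 ∷ []) ∷ (0 ∷ 1 ∷ 0 ∷ 0 ∷ 0 ∷ 0 ∷ []) ∷
     (0 ∷ 0 ∷ 1 ∷ 0 ∷ 0 ∷ 0 ∷ []) ∷ [])

module Sequence-s10 where

  -- (1 + x)(1 + y)(1 + z)(1 + xyz) / xyz
  Λ : Laurent 3
  Λ =
    (-1 ∷ -1 ∷ -1 ∷ [] , 1) ∷ (-1 ∷ -1 ∷ 0 ∷ [] , 1) ∷ (-1 ∷ 0 ∷ -1 ∷ [] , 1) ∷
    (-1 ∷ 0 ∷ 0 ∷ [] , 1) ∷ (0 ∷ -1 ∷ -1 ∷ [] , 1) ∷ (0 ∷ -1 ∷ 0 ∷ [] , 1) ∷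
    (0 ∷ 0 ∷ -1 ∷ [] , 1) ∷ (0 ∷ 0 ∷ 0 ∷ [] , 2) ∷ (0 ∷ 0 ∷ 1 ∷ [] , 1) ∷
    (0 ∷ 1 ∷ 0 ∷ [] , 1) ∷ (0 ∷ 1 ∷ 1 ∷ [] , 1) ∷ (1 ∷ 0 ∷ 0 ∷ [] , 1) ∷ (1 ∷ 0 ∷ 1 ∷ [] , 1) ∷
    (1 ∷ 1 ∷ 0 ∷ [] , 1) ∷ (1 ∷ 1 ∷ 1 ∷ [] , 1) ∷ []

  -- Choosing xyz from k of the n last factors leaves binom(n, k) from each of the other three
  -- powers, hence Σₖ binom(n, k)⁴.
  represents : Represents s10 Λ
  represents n _ = cooper-represents 6 2 -64 4 2 Λ certificate-s10 refl refl refl refl n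

  factored : Factorization Λ
  factored = factorization Λ
    ( ((0 ∷ 0 ∷ 0 ∷ [] , 1) ∷ (1 ∷ 0 ∷ 0 ∷ [] , 1) ∷ [])
    ∷ ((0 ∷ 0 ∷ 0 ∷ [] , 1) ∷ (0 ∷ 1 ∷ 0 ∷ [] , 1) ∷ [])
    ∷ ((0 ∷ 0 ∷ 0 ∷ [] , 1) ∷ (0 ∷ 0 ∷ 1 ∷ [] , 1) ∷ [])
    ∷ ((-1 ∷ -1 ∷ -1 ∷ [] , 1) ∷ (0 ∷ 0 ∷ 0 ∷ [] , 1) ∷ [])
    ∷ []) refl

  interior : OriginUniqueInteriorPoint Λ
  interior = originUniqueInteriorPoint Λ refl 3 4
    (1 ∷ 0 ∷ 0 ∷ 0 ∷ 0 ∷ 0 ∷ 0 ∷ 0 ∷ 1 ∷ 1 ∷ 0 ∷ 1 ∷ 0 ∷ 0 ∷ 0 ∷ [])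
    ((-1 ∷ -1 ∷ -1 ∷ []) ∷ (0 ∷ 0 ∷ 0 ∷ []) ∷ (0 ∷ 0 ∷ 0 ∷ []) ∷ (0 ∷ 0 ∷ 0 ∷ []) ∷
     (0 ∷ 0 ∷ 0 ∷ []) ∷ (0 ∷ 0 ∷ 0 ∷ []) ∷ (0 ∷ 0 ∷ 0 ∷ []) ∷ (0 ∷ 0 ∷ 0 ∷ []) ∷
     (-1 ∷ -1 ∷ 3 ∷ []) ∷ (-1 ∷ 3 ∷ -1 ∷ []) ∷ (0 ∷ 0 ∷ 0 ∷ []) ∷ (3 ∷ -1 ∷ -1 ∷ []) ∷
     (0 ∷ 0 ∷ 0 ∷ []) ∷ (0 ∷ 0 ∷ 0 ∷ []) ∷ (0 ∷ 0 ∷ 0 ∷ []) ∷ [])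
    ((-1 ∷ 0 ∷ 0 ∷ []) ∷ (0 ∷ -1 ∷ 0 ∷ []) ∷ (0 ∷ 0 ∷ -1 ∷ []) ∷ (0 ∷ 0 ∷ 1 ∷ []) ∷
     (0 ∷ 1 ∷ 0 ∷ []) ∷ (1 ∷ 0 ∷ 0 ∷ []) ∷ [])
    ((0 ∷ 0 ∷ 0 ∷ 0 ∷ 0 ∷ 1 ∷ []) ∷ (0 ∷ 0 ∷ 0 ∷ 0 ∷ 1 ∷ 0 ∷ []) ∷
     (0 ∷ 0 ∷ 0 ∷ 1 ∷ 0 ∷ 0 ∷ []) ∷ [])
    ((1 ∷ 0 ∷ 0 ∷ 0 ∷ 0 ∷ 0 ∷ []) ∷ (0 ∷ 1 ∷ 0 ∷ 0 ∷ 0 ∷ 0 ∷ []) ∷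
     (0 ∷ 0 ∷ 1 ∷ 0 ∷ 0 ∷ 0 ∷ []) ∷ [])

module Sequence-s18 where

  -- (xyz + xy - xz + h + y - z)(xyz - xy + xz + h - y + z) / xyz with h = yz + y/z + 1 + z/y
  -- Up to a mutation and finite covers of the torus this is (x + r + 3)² / x - (1 - t)² / xrt,
  -- a difference of squares when r and t are squares.
  Λ : Laurent 3
  Λ =
    (-1 ∷ -3 ∷ 1 ∷ [] , 1) ∷ (-1 ∷ -2 ∷ 0 ∷ [] , 2) ∷ (-1 ∷ -1 ∷ -1 ∷ [] , 3) ∷
    (-1 ∷ -1 ∷ 1 ∷ [] , 1) ∷ (-1 ∷ 0 ∷ -2 ∷ [] , 2) ∷ (-1 ∷ 0 ∷ 0 ∷ [] , 4) ∷
    (-1 ∷ 1 ∷ -3 ∷ [] , 1) ∷ (-1 ∷ 1 ∷ -1 ∷ [] , 1) ∷ (-1 ∷ 1 ∷ 1 ∷ [] , 1) ∷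
    (0 ∷ 0 ∷ 0 ∷ [] , 6) ∷ (0 ∷ 1 ∷ 1 ∷ [] , 2) ∷ (1 ∷ -1 ∷ 1 ∷ [] , -1) ∷
    (1 ∷ 0 ∷ 0 ∷ [] , 2) ∷ (1 ∷ 1 ∷ -1 ∷ [] , -1) ∷ (1 ∷ 1 ∷ 1 ∷ [] , 1) ∷ []

  represents : Represents s18 Λ
  represents n _ = cooper-represents 14 6 192 -12 4 Λ certificate-s18 refl refl refl refl n

  factored : Factorization Λ
  factored = factorization Λ
    ( ((0 ∷ -1 ∷ 1 ∷ [] , 1) ∷ (0 ∷ 0 ∷ 0 ∷ [] , 1) ∷ (0 ∷ 0 ∷ 1 ∷ [] , -1) ∷
        (0 ∷ 1 ∷ -1 ∷ [] , 1) ∷ (0 ∷ 1 ∷ 0 ∷ [] , 1) ∷ (0 ∷ 1 ∷ 1 ∷ [] , 1) ∷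
        (1 ∷ 0 ∷ 1 ∷ [] , -1) ∷ (1 ∷ 1 ∷ 0 ∷ [] , 1) ∷ (1 ∷ 1 ∷ 1 ∷ [] , 1) ∷ [])
    ∷ ((-1 ∷ -2 ∷ 0 ∷ [] , 1) ∷ (-1 ∷ -1 ∷ -1 ∷ [] , 1) ∷ (-1 ∷ -1 ∷ 0 ∷ [] , 1) ∷
        (-1 ∷ 0 ∷ -2 ∷ [] , 1) ∷ (-1 ∷ 0 ∷ -1 ∷ [] , -1) ∷ (-1 ∷ 0 ∷ 0 ∷ [] , 1) ∷
        (0 ∷ -1 ∷ 0 ∷ [] , 1) ∷ (0 ∷ 0 ∷ -1 ∷ [] , -1) ∷ (0 ∷ 0 ∷ 0 ∷ [] , 1) ∷ [])
    ∷ []) refl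

  -- The tetrahedron is (-1, -2, 0), (-1, 0, 0), (1, 1, -1), (1, 1, 1), with sum 0. The polytope
  -- leaves the cube, so the bounds are those of the simplex x ≥ -1, y ≤ 1, z ≤ 1, x - y - z ≤ 1.
  interior : OriginUniqueInteriorPoint Λ
  interior = originUniqueInteriorPoint Λ refl 3 4
    (0 ∷ 1 ∷ 0 ∷ 0 ∷ 0 ∷ 1 ∷ 0 ∷ 0 ∷ 0 ∷ 0 ∷ 0 ∷ 0 ∷ 0 ∷ 1 ∷ 1 ∷ [])
    ((0 ∷ 0 ∷ 0 ∷ []) ∷ (1 ∷ -2 ∷ 0 ∷ []) ∷ (0 ∷ 0 ∷ 0 ∷ []) ∷ (0 ∷ 0 ∷ 0 ∷ []) ∷
     (0 ∷ 0 ∷ 0 ∷ []) ∷ (-3 ∷ 2 ∷ 0 ∷ []) ∷ (0 ∷ 0 ∷ 0 ∷ []) ∷ (0 ∷ 0 ∷ 0 ∷ []) ∷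
     (0 ∷ 0 ∷ 0 ∷ []) ∷ (0 ∷ 0 ∷ 0 ∷ []) ∷ (0 ∷ 0 ∷ 0 ∷ []) ∷ (0 ∷ 0 ∷ 0 ∷ []) ∷
     (0 ∷ 0 ∷ 0 ∷ []) ∷ (1 ∷ 0 ∷ -2 ∷ []) ∷ (1 ∷ 0 ∷ 2 ∷ []) ∷ [])
    ((-1 ∷ 0 ∷ 0 ∷ []) ∷ (0 ∷ 0 ∷ 1 ∷ []) ∷ (0 ∷ 1 ∷ 0 ∷ []) ∷ (1 ∷ -1 ∷ -1 ∷ []) ∷ [])
    ((0 ∷ 1 ∷ 1 ∷ 1 ∷ []) ∷ (0 ∷ 0 ∷ 1 ∷ 0 ∷ []) ∷ (0 ∷ 1 ∷ 0 ∷ 0 ∷ []) ∷ [])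
    ((1 ∷ 0 ∷ 0 ∷ 0 ∷ []) ∷ (1 ∷ 1 ∷ 0 ∷ 1 ∷ []) ∷ (1 ∷ 0 ∷ 1 ∷ 1 ∷ []) ∷ [])

-- Assembly

fromOne : ∀ s {Λ : Laurent (nvars s)} → Represents s Λ → Factorization Λ → OriginUniqueInteriorPoint Λ →
  (Σ (Laurent (nvars s)) λ Λ → Represents s Λ) ×
  (Σ (Laurent (nvars s)) λ Λ → Represents s Λ × Factorization Λ) ×
  (s ≢ η → Σ (Laurent (nvars s)) λ Λ → Represents s Λ × OriginUniqueInteriorPoint Λ)
fromOne _ {Λ} represents factored interior =
  (Λ , represents) , (Λ , represents , factored) , λ _ → Λ , represents , interior

theorem1p1 : (s : Sporadic) →
    (Σ (Laurent (nvars s)) λ Λ → Represents s Λ) ×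
    (Σ (Laurent (nvars s)) λ Λ → Represents s Λ ×
    Σ (List (Laurent (nvars s))) λ fs → All Coeffs01 fs × (Λ ≈L productL fs)) ×
    (s ≢ η → Σ (Laurent (nvars s)) λ Λ → Represents s Λ × OriginUniqueInteriorPoint Λ)
theorem1p1 𝐀 = fromOne 𝐀 represents factored interior
  where open Sequence-𝐀
theorem1p1 𝐁 = fromOne 𝐁 represents factored interior
  where open Sequence-𝐁
theorem1p1 𝐂 = fromOne 𝐂 represents factored interior
  where open Sequence-𝐂
theorem1p1 𝐃 = fromOne 𝐃 represents factored interior
  where open Sequence-𝐃
theorem1p1 𝐄 = fromOne 𝐄 represents factored interior
  where open Sequence-𝐄
-- Two polynomials are used: the Newton polytope of the factored one is the rectangle [-2, 1] ×
-- [-2, 2], which has interior integral points besides the origin, such as (0, 1).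
theorem1p1 𝐅 = (I.Λ , I.represents) , (F.Λ , F.represents , F.factored) , λ _ → I.Λ , I.represents , I.interior
  where
  module I = Sequence-𝐅
  module F = Sequence-𝐅-factored
theorem1p1 δ = fromOne δ represents factored interior
  where open Sequence-δ
-- For this Λ the point (0, 1, 1) is interior too: in the plane x + y + z = 2 it is the midpoint of
-- (0, 0, 2), (0, 2, 0) and of (-1, 1, 2), (1, 1, 0), and there are support points on both sides of
-- the plane.
theorem1p1 η = (Λ , represents) , (Λ , represents , factored) , λ η≢η → contradiction refl η≢η
  where open Sequence-η
theorem1p1 α = fromOne α represents factored interior
  where open Sequence-α
theorem1p1 ε = fromOne ε represents factored interior
  where open Sequence-ε
theorem1p1 ζ = fromOne ζ represents factored interior
  where open Sequence-ζ
theorem1p1 γ = fromOne γ represents factored interior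
  where open Sequence-γ
theorem1p1 s7 = fromOne s7 represents factored interior
  where open Sequence-s7
theorem1p1 s10 = fromOne s10 represents factored interior
  where open Sequence-s10
theorem1p1 s18 = fromOne s18 represents factored interior
  where open Sequence-s18
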